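{- Let $\mathscr G=(X,\mathcal L)$ be an interval greedoid, let $1\le k<\mathrm{rk}(\mathscr G)$, and let $q:\mathcal L\to\mathbb R_{>0}$ be a $k$-admissible weight function. Then $$\mathrm L_q(k)^2\ =\ \mathrm L_q(k-1)\cdot\mathrm L_q(k+1)$$ if and only if there is a constant $s>0$ such that for every $\alpha\in\mathcal L$ with $|\alpha|=k-1$ we have $$\mathrm L_{q,\alpha}(2)\ =\ s\,\mathrm L_{q,\alpha}(1)\ =\ s^2\,\mathrm L_{q,\alpha}(0).$$ Here $\mathrm L_{q,\alpha}(j)=\sum_{\beta\in\mathrm{Cont}_j(\alpha)}q(\alpha\beta)$ and $\mathrm L_q(j)=\sum_{\alpha\in\mathcal L,\,|\alpha|=j}q(\alpha)$.
   Context: **Greedoids.** Let $X$ be a finite set, $X^*$ the set of finite words in $X$; a word is simple if no letter repeats; $|\alpha|$ is the length of $\alpha$. A greedoid is a pair $\mathscr G=(X,\mathcal L)$ with $\mathcal L\subset X^*$ finite such that: the empty word is in $\mathcal L$; every $\alpha\in\mathcal L$ is simple; $\alpha\beta\in\mathcal L\Rightarrow\alpha\in\mathcal L$; and if $\alpha,\beta\in\mathcal L$ with $|\alpha|>|\beta|$ then there is a letter $x$ of $\alpha$ with $\beta x\in\mathcal L$. $\mathrm{rk}(\mathscr G)=\max\{|\alpha|:\alpha\in\mathcal L\}$. It is an interval greedoid if moreover for all $\alpha,\beta,\gamma\in X^*$, $x\in X$: $\alpha x,\ \alpha\beta\gamma x\in\mathcal L\Rightarrow\alpha\beta x\in\mathcal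 L$. **Notation.** For $\alpha\in\mathcal L$: $\mathrm{Cont}_r(\alpha)=\{\beta\in X^*:|\beta|=r,\ \alpha\beta\in\mathcal L\}$, $\mathrm{Cont}(\alpha)=\mathrm{Cont}_1(\alpha)$ (and these sets are empty if $\alpha\notin\mathcal L$). On $\mathrm{Cont}(\alpha)$ the relation $x\sim_\alpha y\iff\alpha xy\notin\mathcal L$ is an equivalence relation; $\mathrm{Par}(\alpha)$ is the set of its classes. For $x\in\mathrm{Cont}(\alpha)$, $\mathrm{Des}_\alpha(x)=\{y\in X:\alpha xy\in\mathcal L,\ \alpha y\notin\mathcal L\}$. For $x,y\in X$, $\mathrm{Pas}_\alpha(x,y)=\{z\in X:\alpha z\notin\mathcal L,\ \alpha xz\notin\mathcal L,\ \alpha yz\notin\mathcal L,\ \alpha xyz\in\mathcal L\}$, $\mathrm{Act}_\alpha(x,y)=\{z\in X:\alpha z\notin\mathcal L,\ \alpha xz\in\mathcal L,\ \alpha yz\in\mathcal L,\ \alpha xyz\in\mathcal L\}$. **$k$-admissible.** Let $m=\mathrm{rk}(\mathscr G)$ and $1\le k<m$. Extend $q:\mathcal L\to\mathbb R_{>0}$ to $X^*$ by $0$ outside $\mathcal L$. $q$ is $k$-admissible if there is a scale sequence $(c_0,\dots,c_m)\in\mathbb R_{>0}^{m+1}$ such that, with $\omega(\alpha):=q(\alpha)/c_{|\alpha|}$, the following hold for every $\alpha\in\mathcal L$ with $\ell:=|\alpha|<k$: 1. (ContInv) $q(\alpha xy\beta)=q(\alpha yx\beta)$ for all $x,y\in\mathrm{Cont}(\alpha)$,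 $\beta\in X^*$. 2. (PAMon) for all distinct $x,y\in\mathrm{Cont}(\alpha)$ and all $r\ge0$: $\sum_{z\in\mathrm{Pas}_\alpha(x,y)}\sum_{\beta\in\mathrm{Cont}_r(\alpha xyz)}q(\alpha xyz\beta)\ \ge\ \sum_{z\in\mathrm{Act}_\alpha(x,y)}\sum_{\beta\in\mathrm{Cont}_r(\alpha xyz)}q(\alpha xyz\beta)$. 3. (LogMod) $\omega(\alpha x)\,\omega(\alpha y)=\omega(\alpha)\,\omega(\alpha xy)$ for all $x,y\in\mathrm{Cont}(\alpha)$ with $\alpha xy\in\mathcal L$. 4. (FewDes) for every $\mathcal C\in\mathrm{Par}(\alpha)$ with $|\mathcal C|\ge2$ and every $x\in\mathcal C$: $\mathrm{Des}_\alpha(x)=\varnothing$. 5. (SynMon) $\omega(\alpha x)^2\ge\sum_{y\in\mathrm{Des}_\alpha(x)}\omega(\alpha)\,\omega(\alpha xy)$ for all $x\in\mathrm{Cont}(\alpha)$. 6. (ScaleMon) $\Bigl(1-\frac{c_{\ell+1}^2}{c_\ell c_{\ell+2}}\Bigr)\sum_{\mathcal C\in\mathrm{Par}(\alpha)}\frac{1}{1-b_\alpha(\mathcal C)}\le1$, where $b_\alpha(\mathcal C)=\sum_{y\in\mathrm{Des}_\alpha(x)}\frac{\omega(\alpha)\omega(\alpha xy)}{\omega(\alpha x)^2}$ if $\mathcal C=\{x\}$ and $b_\alpha(\mathcal C)=0$ if $|\mathcal C|\ge2$. Convention: this is considered satisfied whenever $c_{\ell+1}^2\ge c_\ell c_{\ell+2}$;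 and when $c_{\ell+1}^2<c_\ell c_{\ell+2}$ it includes the requirement $b_\alpha(\mathcal C)<1$ for all $\mathcal C\in\mathrm{Par}(\alpha)$. -}

module Defs where

open import Level using (Level; 0ℓ; _⊔_) renaming (suc to lsuc)
open import Algebra.Bundles using (CommutativeRing)
import Algebra.Definitions.RawMonoid as Multiples
open import Data.Fin using (Fin)
open import Data.Fin.Properties using (_≟_)
open import Data.List
  using (List; []; _∷_; [_]; _++_; _∷ʳ_; length; map; concatMap; filter; foldr; allFin; deduplicate)
open import Data.List.Membership.Propositional using (_∈_)
open import Data.List.Properties using (≡-dec)
open import Data.List.Relation.Unary.All as All using (All)
open import Data.List.Relation.Unary.Unique.Propositional using (Unique)
open import Data.Nat as ℕ using (ℕ; zero; suc)
open import Data.Product using (Σ-syntax; ∃-syntax; _×_; _,_; proj₁; proj₂)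
open import Relation.Binary using (Rel; IsStrictPartialOrder; Cotransitive)
open import Relation.Binary.PropositionalEquality using (_≡_; _≢_)
open import Relation.Nullary using (¬_; yes; no; ¬?; _×-dec_)
open import Relation.Unary using (Pred; Decidable)

-- The real numbers, axiomatically: a Cauchy-complete Archimedean ordered field.
-- Classically ℝ is the only model up to isomorphism.  The order is not assumed
-- to be decidable, only cotransitive and tight, so that constructive
-- constructions of ℝ (for instance by regular sequences) are models as well.
record Reals (c ℓ₁ ℓ₂ : Level) : Set (lsuc (c ⊔ ℓ₁ ⊔ ℓ₂)) where
  infix 4 _<_ _≤_

  field
    commutativeRing : CommutativeRing c ℓ₁

  open CommutativeRing commutativeRing public

  field
    _<_                  : Rel Carrier ℓ₂
    isStrictPartialOrder : IsStrictPartialOrder _≈_ _<_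
    <-cotrans            : Cotransitive _<_
    <-tight              : ∀ {x y} → ¬ x < y → ¬ y < x → x ≈ y
    0<1                  : 0# < 1#
    +-monoʳ-<            : ∀ z {x y} → x < y → z + x < z + y
    *-pos                : ∀ {x y} → 0# < x → 0# < y → 0# < x * y
    invertible           : ∀ x → 0# < x → ∃[ y ] 0# < y × x * y ≈ 1#
    archimedean          : ∀ x → ∃[ n ] x < Multiples._×_ +-rawMonoid n 1#
    complete             : (s : ℕ → Carrier) →
      (∀ ε → 0# < ε → ∃[ N ] ∀ i j → N ℕ.≤ i → N ℕ.≤ j → s i < s j + ε) →
      ∃[ l ] ∀ ε → 0# < ε → ∃[ N ] ∀ i → N ℕ.≤ i → s i < l + ε × l < s i + ε

  module <-Order = IsStrictPartialOrder isStrictPartialOrder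

  _≤_ : Rel Carrier ℓ₂
  x ≤ y = ¬ y < x

  recip : ∀ x → 0# < x → Carrier
  recip x 0<x = proj₁ (invertible x 0<x)

  recip-pos : ∀ x (0<x : 0# < x) → 0# < recip x 0<x
  recip-pos x 0<x = proj₁ (proj₂ (invertible x 0<x))

  x<y⇒0<y-x : ∀ {x y} → x < y → 0# < y - x
  x<y⇒0<y-x {x} {y} x<y =
    <-Order.<-respʳ-≈ (+-comm (- x) y)
      (<-Order.<-respˡ-≈ (-‿inverseˡ x) (+-monoʳ-< (- x) x<y))

  sum : List Carrier → Carrier
  sum = foldr _+_ 0#

  ∑ : ∀ {a} {A : Set a} → List A → (A → Carrier) → Carrier
  ∑ xs f = sum (map f xs)

  infix 5 ∑
  syntax ∑ xs (λ x → e) = ∑[ x ∈ xs ] e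

Word : ℕ → Set
Word n = List (Fin n)

-- Every word of length r over Fin n, exactly once.
words : (n r : ℕ) → List (Word n)
words n zero    = [ [] ]
words n (suc r) = concatMap (λ x → map (x ∷_) (words n r)) (allFin n)

-- The ground set is X = Fin n.  A language of simple words has words of length
-- at most n only, so it is finite as soon as membership is decidable.
record Greedoid (n : ℕ) : Set₁ where
  field
    Lang       : Pred (Word n) 0ℓ
    Lang?      : Decidable Lang
    empty      : Lang []
    simple     : ∀ {α} → Lang α → Unique α
    hereditary : ∀ α β → Lang (α ++ β) → Lang α
    exchange   : ∀ {α β} → Lang α → Lang β → length β ℕ.< length α →
                 ∃[ x ] x ∈ α × Lang (β ∷ʳ x)

module _ {n : ℕ} (G : Greedoid n) where
  open Greedoid G

  IsInterval : Set
  IsInterval = ∀ α β γ x → Lang (α ∷ʳ x) → Lang (α ++ β ++ γ ∷ʳ x) → Lang (α ++ β ∷ʳ x)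

  IsRank : ℕ → Set
  IsRank m = (∃[ α ] Lang α × length α ≡ m) × (∀ α → Lang α → length α ℕ.≤ m)

  -- Finite sets are duplicate-free lists: all of those below are filtered from
  -- `words` or `allFin`, except Par.  By heredity, Contᵣ and
  -- Cont are empty when α is not in the language.
  Contᵣ : ℕ → Word n → List (Word n)
  Contᵣ r α = filter (λ β → Lang? (α ++ β)) (words n r)

  Cont : Word n → List (Fin n)
  Cont α = filter (λ x → Lang? (α ∷ʳ x)) (allFin n)

  Class : Word n → Fin n → List (Fin n)
  Class α x = filter (λ y → ¬? (Lang? (α ++ x ∷ y ∷ []))) (Cont α)

  -- Class lists its elements in the order of allFin, so two classes are equal
  -- as sets exactly when they are equal as lists.
  Par : Word n → List (List (Fin n))
  Par α = deduplicate (≡-dec _≟_) (map (Class α) (Cont α))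

  Des : Word n → Fin n → List (Fin n)
  Des α x = filter (λ y → Lang? (α ++ x ∷ y ∷ []) ×-dec ¬? (Lang? (α ∷ʳ y))) (allFin n)

  Pas : Word n → Fin n → Fin n → List (Fin n)
  Pas α x y = filter
    (λ z → ¬? (Lang? (α ∷ʳ z))
      ×-dec ¬? (Lang? (α ++ x ∷ z ∷ []))
      ×-dec ¬? (Lang? (α ++ y ∷ z ∷ []))
      ×-dec Lang? (α ++ x ∷ y ∷ z ∷ []))
    (allFin n)

  Act : Word n → Fin n → Fin n → List (Fin n)
  Act α x y = filter
    (λ z → ¬? (Lang? (α ∷ʳ z))
      ×-dec Lang? (α ++ x ∷ z ∷ [])
      ×-dec Lang? (α ++ y ∷ z ∷ [])
      ×-dec Lang? (α ++ x ∷ y ∷ z ∷ []))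
    (allFin n)

module _ {c ℓ₁ ℓ₂ : Level} (ℝ : Reals c ℓ₁ ℓ₂) {n : ℕ} (G : Greedoid n) where
  open Reals ℝ
  open Greedoid G

  -- A positive weight function on the language, extended by zero to all words.
  record WeightFunction : Set (c ⊔ ℓ₁ ⊔ ℓ₂) where
    field
      weight   : Word n → Carrier
      positive : ∀ α → Lang α → 0# < weight α
      outside  : ∀ α → ¬ Lang α → weight α ≈ 0#

  -- Only c₀, …, c_m with m the rank matter below: the others are not used at
  -- words of the language, nor in ScaleMon.
  record ScaleSequence : Set (c ⊔ ℓ₂) where
    field
      scale     : ℕ → Carrier
      scale-pos : ∀ i → 0# < scale i

  module _ (Q : WeightFunction) where
    open WeightFunction Q renaming (weight to q)

    Lqα : Word n → ℕ → Carrier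
    Lqα α j = ∑[ β ∈ Contᵣ G j α ] q (α ++ β)

    Lq : ℕ → Carrier
    Lq j = ∑[ α ∈ filter Lang? (words n j) ] q α

    module _ (S : ScaleSequence) where
      open ScaleSequence S

      ω : Word n → Carrier
      ω α = q α * recip (scale (length α)) (scale-pos (length α))

      ω-pos : ∀ α → Lang α → 0# < ω α
      ω-pos α α∈L = *-pos (positive α α∈L) (recip-pos (scale (length α)) (scale-pos (length α)))

      -- 1/ω on the language.  It is only used there: the value 0 elsewhere is junk.
      ω⁻¹ : Word n → Carrier
      ω⁻¹ α with Lang? α
      ... | yes α∈L = recip (ω α) (ω-pos α α∈L)
      ... | no  _   = 0#

      b : Word n → List (Fin n) → Carrier
      b α (x ∷ []) = ∑[ y ∈ Des G α x ] ω α * ω (α ++ x ∷ y ∷ []) * (ω⁻¹ (α ∷ʳ x) * ω⁻¹ (α ∷ʳ x))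
      b α _        = 0#

      ContInv : Word n → Set ℓ₁
      ContInv α = ∀ {x y} → x ∈ Cont G α → y ∈ Cont G α → ∀ β →
        q (α ++ x ∷ y ∷ β) ≈ q (α ++ y ∷ x ∷ β)

      PAMon : Word n → Set ℓ₂
      PAMon α = ∀ {x y} → x ∈ Cont G α → y ∈ Cont G α → x ≢ y → (r : ℕ) →
        (∑[ z ∈ Act G α x y ] Lqα (α ++ x ∷ y ∷ z ∷ []) r) ≤
        (∑[ z ∈ Pas G α x y ] Lqα (α ++ x ∷ y ∷ z ∷ []) r)

      LogMod : Word n → Set ℓ₁
      LogMod α = ∀ {x y} → x ∈ Cont G α → y ∈ Cont G α → Lang (α ++ x ∷ y ∷ []) →
        ω (α ∷ʳ x) * ω (α ∷ʳ y) ≈ ω α * ω (α ++ x ∷ y ∷ [])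

      FewDes : Word n → Set
      FewDes α = ∀ {C} → C ∈ Par G α → 2 ℕ.≤ length C → ∀ {x} → x ∈ C → Des G α x ≡ []

      SynMon : Word n → Set ℓ₂
      SynMon α = ∀ {x} → x ∈ Cont G α →
        (∑[ y ∈ Des G α x ] ω α * ω (α ++ x ∷ y ∷ [])) ≤ ω (α ∷ʳ x) * ω (α ∷ʳ x)

      -- Vacuous unless c₁² < c₀c₂, in which case every b α C has to be below 1,
      -- and the list summed is that of the 1 / (1 - b α C).
      ScaleMon : Word n → Set ℓ₂
      ScaleMon α =
        let c₀     = scale (length α)
            c₁     = scale (1 ℕ.+ length α)
            c₂     = scale (2 ℕ.+ length α)
            c₀c₂>0 = *-pos (scale-pos (length α)) (scale-pos (2 ℕ.+ length α))
        in c₁ * c₁ < c₀ * c₂ →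
           Σ[ b<1 ∈ All (λ C → b α C < 1#) (Par G α) ]
             (1# - c₁ * c₁ * recip (c₀ * c₂) c₀c₂>0)
               * sum (All.reduce (λ {C} bC<1 → recip (1# - b α C) (x<y⇒0<y-x bC<1)) b<1)
             ≤ 1#

    record Admissible (k : ℕ) : Set (c ⊔ ℓ₁ ⊔ ℓ₂) where
      field
        scaleSequence : ScaleSequence
        contInv  : ∀ α → Lang α → length α ℕ.< k → ContInv  scaleSequence α
        paMon    : ∀ α → Lang α → length α ℕ.< k → PAMon    scaleSequence α
        logMod   : ∀ α → Lang α → length α ℕ.< k → LogMod   scaleSequence α
        fewDes   : ∀ α → Lang α → length α ℕ.< k → FewDes   scaleSequence α
        synMon   : ∀ α → Lang α → length α ℕ.< k → SynMon   scaleSequence α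
        scaleMon : ∀ α → Lang α → length α ℕ.< k → ScaleMon scaleSequence α

{-# OPTIONS --safe #-}

-- The proof is that of Chan and Pak, by a combinatorial atlas.  To a word α of the language and
-- r ≥ 0 one attaches a symmetric matrix A(α,r) indexed by the letters and a null point, with
-- L_{q,α}(r), L_{q,α}(r+1) and L_{q,α}(r+2) as its values at (null,null), (null,1_X) and (1_X,1_X).
-- For |α| + r < k it is hyperbolic, that is B(v,v)B(e,e) ≤ B(v,e)² for e = 1_null.  For r = 0 this
-- is an explicit computation from LogMod, FewDes, SynMon and ScaleMon.  For r > 0 one takes
-- M = A(α,r) + εA(α,r-1), whose rows are given by the matrices A(αx,r-1) and A(α,r-1), hyperbolic by
-- induction; with the inequality `Pull` coming from PAMon they show that every eigenvalue λ of the
-- normalised M satisfies λ ≤ λ², so that all but the Perron eigenvalue are ≤ 0; then ε → 0.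
--
-- If equality holds, then 1_X - s 1_null is isotropic for A(∅,k-1), hence in its kernel.  The rows
-- of the kernel relation, with the log-concavity of L_{q,x}, make it isotropic for A(x,k-2) as well,
-- and so on down to A(α,0) with |α| = k-1.

module Submission where

open import Defs
open import Level using (Level; _⊔_)
open import Algebra.Solver.Ring.AlmostCommutativeRing
  using (fromCommutativeRing; _-Raw-AlmostCommutative⟶_)
import Algebra.Definitions.RawMonoid as Multiples
import Algebra.Properties.Ring as RingProperties
import Algebra.Properties.Semiring.Mult.TCOptimised as SemiringMult
import Algebra.Solver.Ring as RingSolver
open import Data.Empty using (⊥-elim)
open import Data.Fin using (Fin)
open import Data.Fin.Properties using (_≟_)
open import Data.Integer as ℤ using (ℤ; +_; -[1+_]; _⊖_)
import Data.Integer.Properties as ℤ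
open import Data.List
  using (List; []; _∷_; [_]; _++_; _∷ʳ_; map; concatMap; filter; length; allFin)
open import Data.List.Membership.Propositional using (_∈_)
open import Data.List.Membership.Propositional.Properties
  using (∈-allFin; ∈-filter⁺; ∈-filter⁻; ∈-map⁺; ∈-map⁻; ∈-++⁻; ∈-++⁺ʳ; ∈-deduplicate⁺; ∈-deduplicate⁻)
open import Data.List.Properties using (++-assoc; ++-identityʳ; length-++; ≡-dec)
open import Data.List.Relation.Unary.All as All using (All; []; _∷_)
open import Data.List.Relation.Unary.AllPairs using ([]; _∷_)
open import Data.List.Relation.Unary.Any using (here; there)
open import Data.List.Relation.Unary.Unique.Propositional using (Unique)
import Data.List.Relation.Unary.Unique.Propositional.Properties as Unique
import Data.List.Relation.Unary.Unique.DecPropositional.Properties as UniqueDec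
open import Data.Maybe using (Maybe; just; nothing)
open import Data.Nat as ℕ using (ℕ; zero; suc; _∸_)
import Data.Nat.Properties as ℕ
open import Data.Product using (Σ-syntax; ∃-syntax; _×_; _,_; proj₁; proj₂)
open import Data.Sum using (_⊎_; inj₁; inj₂)
open import Function.Bundles using (_⇔_; mk⇔)
open import Relation.Binary.Definitions using (DecidableEquality)
open import Relation.Binary.PropositionalEquality as ≡ using (_≡_)
open import Relation.Nullary using (¬_; yes; no; Dec; ¬?; _×-dec_)
import Relation.Unary as U

-- The order of the reals is undecidable, so eigenvectors of a symmetric matrix cannot in general be
-- computed, and the argument on eigenvalues is run on quadratic forms. A bound (1+κ)W ≤ D on the
-- complement of the Perron vector doubles its κ by a polynomial identity, and the Archimedean axiom
-- then leaves only W ≤ 0. The initial κ > 0 comes from a Poincaré inequality: in the weighted graph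
-- of the matrix every point with a nonzero row is joined to the null point. The perturbation by ε
-- has two purposes. It makes the Perron vector h = 1_X + ε 1_null positive at every point, so that
-- one can divide by it. And since the same ε multiplies A(α,r-1), each row of M, applied to a
-- vector, is a value of the form of one child at that very h; this is where the hyperbolicity of
-- the children can enter.

module _ {c ℓ₁ ℓ₂ : Level} (ℝ : Reals c ℓ₁ ℓ₂) where

  open Reals ℝ hiding (zero)
  open import Relation.Binary.Reasoning.Setoid setoid

  -- Integer coefficients for the ring solver.

  module IntegerCoefficients where
    open SemiringMult semiring using (×-homo-+; ×1-homo-*; 1+×) renaming (_×_ to _·_)
    open RingProperties ring
      using (-0#≈0#; -‿+-comm; -‿involutive; -‿distribˡ-*; -‿distribʳ-*)

    ⟦_⟧ : ℤ → Carrier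
    ⟦ + n ⟧      = n · 1#
    ⟦ -[1+ n ] ⟧ = - (suc n · 1#)

    negate : ∀ i → ⟦ ℤ.- i ⟧ ≈ - ⟦ i ⟧
    negate (+ zero)    = sym -0#≈0#
    negate (+ (suc n)) = refl
    negate -[1+ n ]    = sym (-‿involutive _)

    cancel-1 : ∀ a b → a - b ≈ (1# + a) - (1# + b)
    cancel-1 a b = begin
      a - b                       ≈⟨ +-identityˡ _ ⟨
      0# + (a - b)                ≈⟨ +-congʳ (-‿inverseʳ 1#) ⟨
      (1# - 1#) + (a - b)         ≈⟨ +-assoc 1# (- 1#) (a - b) ⟩
      1# + (- 1# + (a - b))       ≈⟨ +-congˡ (+-comm _ _) ⟩
      1# + ((a - b) - 1#)         ≈⟨ +-congˡ (+-assoc a (- b) (- 1#)) ⟩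
      1# + (a + (- b - 1#))       ≈⟨ +-assoc 1# a _ ⟨
      (1# + a) + (- b - 1#)       ≈⟨ +-congˡ (-‿+-comm b 1#) ⟩
      (1# + a) - (b + 1#)         ≈⟨ +-congˡ (-‿cong (+-comm b 1#)) ⟩
      (1# + a) - (1# + b)         ∎

    minus : ∀ m n → ⟦ m ⊖ n ⟧ ≈ m · 1# - n · 1#
    minus zero    zero    = sym (-‿inverseʳ 0#)
    minus zero    (suc n) = sym (+-identityˡ _)
    minus (suc m) zero    = sym (trans (+-congˡ -0#≈0#) (+-identityʳ _))
    minus (suc m) (suc n) =
      trans (reflexive (≡.cong ⟦_⟧ (ℤ.[1+m]⊖[1+n]≡m⊖n m n)))
        (trans (minus m n) (trans (cancel-1 _ _)
          (sym (+-cong (1+× m 1#) (-‿cong (1+× n 1#))))))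

    plus : ∀ i j → ⟦ i ℤ.+ j ⟧ ≈ ⟦ i ⟧ + ⟦ j ⟧
    plus (+ m)    (+ n)    = ×-homo-+ 1# m n
    plus (+ m)    -[1+ n ] = minus m (suc n)
    plus -[1+ m ] (+ n)    = trans (minus n (suc m)) (+-comm _ _)
    plus -[1+ m ] -[1+ n ] = begin
      - (suc (suc (m ℕ.+ n)) · 1#)     ≈⟨ -‿cong (reflexive (≡.cong (_· 1#) (≡.cong suc (≡.sym (ℕ.+-suc m n))))) ⟩
      - ((suc m ℕ.+ suc n) · 1#)       ≈⟨ -‿cong (×-homo-+ 1# (suc m) (suc n)) ⟩
      - (suc m · 1# + suc n · 1#)      ≈⟨ -‿+-comm _ _ ⟨
      - (suc m · 1#) - (suc n · 1#)    ∎

    times⁺ : ∀ m n → ⟦ + m ℤ.* + n ⟧ ≈ ⟦ + m ⟧ * ⟦ + n ⟧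
    times⁺ m n = trans (reflexive (≡.cong ⟦_⟧ (≡.sym (ℤ.pos-* m n)))) (×1-homo-* m n)

    timesʳ : ∀ m j → ⟦ + m ℤ.* j ⟧ ≈ ⟦ + m ⟧ * ⟦ j ⟧
    timesʳ m (+ n)    = times⁺ m n
    timesʳ m -[1+ n ] = trans (reflexive (≡.cong ⟦_⟧ (≡.sym (ℤ.neg-distribʳ-* (+ m) (+ suc n)))))
      (trans (negate (+ m ℤ.* + suc n)) (trans (-‿cong (times⁺ m (suc n))) (-‿distribʳ-* _ _)))

    times : ∀ i j → ⟦ i ℤ.* j ⟧ ≈ ⟦ i ⟧ * ⟦ j ⟧
    times (+ m)    j = timesʳ m j
    times -[1+ m ] j = trans (reflexive (≡.cong ⟦_⟧ (≡.sym (ℤ.neg-distribˡ-* (+ suc m) j))))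
      (trans (negate (+ suc m ℤ.* j)) (trans (-‿cong (timesʳ (suc m) j)) (-‿distribˡ-* _ _)))

    -- Equality of reals is undecidable, whereas the solver has to compare coefficients; they are
    -- therefore taken in ℤ. With the optimised multiples, `⟦ + 1 ⟧` and `⟦ + 2 ⟧` reduce to `1#`
    -- and `1# + 1#`, so that `:1` and `:2` below fit such terms by definition.
    morphism : ℤ.+-*-rawRing -Raw-AlmostCommutative⟶ fromCommutativeRing commutativeRing
    morphism = record
      { ⟦_⟧ = ⟦_⟧ ; +-homo = plus ; *-homo = times ; -‿homo = negate
      ; 0-homo = refl ; 1-homo = refl }

    coefficients≟ : ∀ i j → Maybe (⟦ i ⟧ ≈ ⟦ j ⟧)
    coefficients≟ i j with i ℤ.≟ j
    ... | yes i≡j = just (reflexive (≡.cong ⟦_⟧ i≡j))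
    ... | no  _   = nothing


  open RingSolver ℤ.+-*-rawRing (fromCommutativeRing commutativeRing)
    IntegerCoefficients.morphism IntegerCoefficients.coefficients≟
    using (solve; con; _:=_; _:+_; _:*_; _:-_; :-_; Polynomial)

  :0 :1 :2 : ∀ {n} → Polynomial n
  :0 = con (+ 0)
  :1 = con (+ 1)
  :2 = con (+ 2)

  -- Order of the real numbers.

  <-irrefl : ∀ {x} → ¬ x < x
  <-irrefl = <-Order.irrefl refl

  <-resp : ∀ {x y x′ y′} → x ≈ x′ → y ≈ y′ → x < y → x′ < y′
  <-resp x≈x′ y≈y′ x<y = <-Order.<-respʳ-≈ y≈y′ (<-Order.<-respˡ-≈ x≈x′ x<y)

  ≤-resp : ∀ {x y x′ y′} → x ≈ x′ → y ≈ y′ → x ≤ y → x′ ≤ y′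
  ≤-resp x≈x′ y≈y′ x≤y y′<x′ = x≤y (<-resp (sym y≈y′) (sym x≈x′) y′<x′)

  ≤-reflexive : ∀ {x y} → x ≈ y → x ≤ y
  ≤-reflexive x≈y y<x = <-Order.irrefl (sym x≈y) y<x

  <⇒≤ : ∀ {x y} → x < y → x ≤ y
  <⇒≤ x<y y<x = <-irrefl (<-Order.trans x<y y<x)

  ≤-trans : ∀ {x y z} → x ≤ y → y ≤ z → x ≤ z
  ≤-trans {x} {y} x≤y y≤z z<x with <-cotrans z<x y
  ... | inj₁ z<y = y≤z z<y
  ... | inj₂ y<x = x≤y y<x

  <-≤-trans : ∀ {x y z} → x < y → y ≤ z → x < z
  <-≤-trans {x} {y} {z} x<y y≤z with <-cotrans x<y z
  ... | inj₁ x<z = x<z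
  ... | inj₂ z<y = ⊥-elim (y≤z z<y)

  ≤-antisym : ∀ {x y} → x ≤ y → y ≤ x → x ≈ y
  ≤-antisym x≤y y≤x = <-tight y≤x x≤y

  -- As `_≤_` is a negation, the proof of an inequality may distinguish these three cases although
  -- the order is undecidable.
  ¬¬-trichotomy : ∀ x y → ¬ ¬ (x < y ⊎ x ≈ y ⊎ y < x)
  ¬¬-trichotomy x y none = none (inj₂ (inj₁ (<-tight
    (λ x<y → none (inj₁ x<y)) (λ y<x → none (inj₂ (inj₂ y<x))))))

  x<y⇐0<y-x : ∀ {x y} → 0# < y - x → x < y
  x<y⇐0<y-x {x} {y} p = <-resp (+-identityʳ x)
    (solve 2 (λ x y → x :+ (y :- x) := y) refl x y) (+-monoʳ-< x p)

  -- Most inequalities below are proved by exhibiting the difference of the two sides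
  -- as a combination of nonnegative terms.
  ≤-by : ∀ {x y d} → y - x ≈ d → 0# ≤ d → x ≤ y
  ≤-by {x} {y} y-x≈d 0≤d y<x = 0≤d (<-resp y-x≈d (-‿inverseʳ x)
    (<-resp (+-comm (- x) y) (+-comm (- x) x) (+-monoʳ-< (- x) y<x)))

  0≤y-x : ∀ {x y} → x ≤ y → 0# ≤ y - x
  0≤y-x {x} {y} x≤y y-x<0 = x≤y (<-resp
    (solve 2 (λ x y → x :+ (y :- x) := y) refl x y) (+-identityʳ x) (+-monoʳ-< x y-x<0))

  0<-x : ∀ {x} → x < 0# → 0# < - x
  0<-x {x} x<0 = <-resp refl (+-identityˡ (- x)) (x<y⇒0<y-x x<0)

  -x<0 : ∀ {x} → 0# < - x → x < 0#
  -x<0 {x} p = x<y⇐0<y-x (<-resp refl (sym (+-identityˡ (- x))) p)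

  +-nonneg : ∀ {x y} → 0# ≤ x → 0# ≤ y → 0# ≤ x + y
  +-nonneg {x} {y} 0≤x 0≤y = ≤-trans 0≤x
    (≤-by (solve 2 (λ x y → x :+ y :- x := y) refl x y) 0≤y)

  +-pos-nonneg : ∀ {x y} → 0# < x → 0# ≤ y → 0# < x + y
  +-pos-nonneg {x} {y} 0<x 0≤y = <-≤-trans 0<x
    (≤-by (solve 2 (λ x y → x :+ y :- x := y) refl x y) 0≤y)

  +-nonneg-pos : ∀ {x y} → 0# ≤ x → 0# < y → 0# < x + y
  +-nonneg-pos {x} {y} 0≤x 0<y = <-resp refl (+-comm y x) (+-pos-nonneg 0<y 0≤x)

  *-nonneg : ∀ {x y} → 0# ≤ x → 0# ≤ y → 0# ≤ x * y
  *-nonneg {x} {y} 0≤x 0≤y xy<0 = ¬¬-trichotomy 0# x λ where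
    (inj₂ (inj₂ x<0)) → 0≤x x<0
    (inj₂ (inj₁ 0≈x)) → <-irrefl (<-resp (trans (*-congʳ (sym 0≈x)) (zeroˡ y)) refl xy<0)
    (inj₁ 0<x) → ¬¬-trichotomy 0# y λ where
      (inj₂ (inj₂ y<0)) → 0≤y y<0
      (inj₂ (inj₁ 0≈y)) → <-irrefl (<-resp (trans (*-congˡ (sym 0≈y)) (zeroʳ x)) refl xy<0)
      (inj₁ 0<y) → <⇒≤ (*-pos 0<x 0<y) xy<0

  square-nonneg : ∀ x → 0# ≤ x * x
  square-nonneg x xx<0 = ¬¬-trichotomy 0# x λ where
    (inj₁ 0<x)        → <⇒≤ (*-pos 0<x 0<x) xx<0
    (inj₂ (inj₁ 0≈x)) → <-irrefl (<-resp (trans (*-congʳ (sym 0≈x)) (zeroˡ x)) refl xx<0)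
    (inj₂ (inj₂ x<0)) → <⇒≤ (<-resp refl (solve 1 (λ x → (:- x) :* (:- x) := x :* x) refl x)
                          (*-pos (0<-x x<0) (0<-x x<0))) xx<0

  square≈0⇒≈0 : ∀ {x} → x * x ≈ 0# → x ≈ 0#
  square≈0⇒≈0 {x} xx≈0 = <-tight
    (λ x<0 → <-irrefl (<-resp refl (trans (solve 1 (λ x → (:- x) :* (:- x) := x :* x) refl x) xx≈0)
               (*-pos (0<-x x<0) (0<-x x<0))))
    (λ 0<x → <-irrefl (<-resp refl xx≈0 (*-pos 0<x 0<x)))

  *-monoʳ-≤ : ∀ {a x y} → 0# ≤ a → x ≤ y → a * x ≤ a * y
  *-monoʳ-≤ {a} {x} {y} 0≤a x≤y =
    ≤-by (solve 3 (λ a x y → a :* y :- a :* x := a :* (y :- x)) refl a x y) (*-nonneg 0≤a (0≤y-x x≤y))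

  *-cancel-nonneg : ∀ {a x} → 0# < a → 0# ≤ a * x → 0# ≤ x
  *-cancel-nonneg {a} {x} 0<a 0≤ax x<0 = 0≤ax (-x<0 (<-resp refl
    (solve 2 (λ a x → a :* (:- x) := :- (a :* x)) refl a x) (*-pos 0<a (0<-x x<0))))

  *-cancelˡ-≤ : ∀ {a x y} → 0# < a → a * x ≤ a * y → x ≤ y
  *-cancelˡ-≤ {a} {x} {y} 0<a ax≤ay = ≤-by refl (*-cancel-nonneg 0<a
    (≤-resp refl (solve 3 (λ a x y → a :* y :- a :* x := a :* (y :- x)) refl a x y) (0≤y-x ax≤ay)))

  *-cancelˡ-≈ : ∀ {a x y} → 0# < a → a * x ≈ a * y → x ≈ y
  *-cancelˡ-≈ 0<a ax≈ay = ≤-antisym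
    (*-cancelˡ-≤ 0<a (≤-reflexive ax≈ay)) (*-cancelˡ-≤ 0<a (≤-reflexive (sym ax≈ay)))

  0<2 : 0# < 1# + 1#
  0<2 = +-pos-nonneg 0<1 (<⇒≤ 0<1)

  x-y≈0⇒x≈y : ∀ {x y} → x - y ≈ 0# → x ≈ y
  x-y≈0⇒x≈y {x} {y} x-y≈0 = begin
    x             ≈⟨ solve 2 (λ x y → x := y :+ (x :- y)) refl x y ⟩
    y + (x - y)   ≈⟨ +-congˡ x-y≈0 ⟩
    y + 0#        ≈⟨ +-identityʳ y ⟩
    y             ∎

  x≈y⇒x-y≈0 : ∀ {x y} → x ≈ y → x - y ≈ 0#
  x≈y⇒x-y≈0 {x} {y} x≈y = trans (+-congʳ x≈y) (-‿inverseʳ y)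

  recip-inverse : ∀ x (0<x : 0# < x) → x * recip x 0<x ≈ 1#
  recip-inverse x 0<x = proj₂ (proj₂ (invertible x 0<x))

  -- The limit ε → 0, made explicit: were `a` negative, the expression would be negative at one ε
  -- computed from `a`, `b` and `d`.
  nonneg-at-0 : ∀ {a b d} → (∀ ε → 0# < ε → 0# ≤ a + ε * (b + ε * d)) → 0# ≤ a
  nonneg-at-0 {a} {b} {d} nonneg a<0 = nonneg ε 0<ε (-x<0 (<-≤-trans (*-pos 0<ε 0<m)
      (≤-by bound (*-nonneg (<⇒≤ 0<ε) (+-nonneg (+-nonneg (<⇒≤ 0<1) (0≤bound b))
        (0≤bound′ ε d (<⇒≤ 0<ε) ε≤1))))))
    where
    m  = - a
    0<m : 0# < m
    0<m = 0<-x a<0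
    -- `1# + x * x` bounds `x` from above and stands in for its absolute value, so that no sign has
    -- to be known.
    B : Carrier → Carrier
    B x = 1# + x * x
    0≤B : ∀ x → 0# ≤ B x
    0≤B x = +-nonneg (<⇒≤ 0<1) (square-nonneg x)
    0≤bound : ∀ x → 0# ≤ B x - x
    0≤bound x = *-cancel-nonneg 0<2 (≤-resp refl
      (solve 1 (λ x → (x :- :1) :* (x :- :1) :+ (:1 :+ x :* x) := :2 :* ((:1 :+ x :* x) :- x)) refl x)
      (+-nonneg (square-nonneg (x - 1#)) (0≤B x)))
    0≤bound′ : ∀ e x → 0# ≤ e → e ≤ 1# → 0# ≤ B x - e * x
    0≤bound′ e x 0≤e e≤1 = ≤-resp refl
      (solve 2 (λ e x → e :* ((:1 :+ x :* x) :- x) :+ (:1 :- e) :* (:1 :+ x :* x)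
                          := (:1 :+ x :* x) :- e :* x) refl e x)
      (+-nonneg (*-nonneg 0≤e (0≤bound x)) (*-nonneg (0≤y-x e≤1) (0≤B x)))
    K = 1# + B b + B d
    0<K : 0# < K
    0<K = +-pos-nonneg (+-pos-nonneg 0<1 (0≤B b)) (0≤B d)
    0<m+K = +-pos-nonneg 0<m (<⇒≤ 0<K)
    r = recip (m + K) 0<m+K
    -- With ε = m / (m + K) one has ε ≤ 1 and ε(m + K) = m, and so -(a + ε(b + εd)) is at least εm.
    ε = m * r
    0<ε : 0# < ε
    0<ε = *-pos 0<m (recip-pos _ 0<m+K)
    ε[m+K]≈m : ε * (m + K) ≈ m
    ε[m+K]≈m = trans (solve 3 (λ m k r → m :* r :* (m :+ k) := m :* ((m :+ k) :* r)) refl m K r)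
      (trans (*-congˡ (recip-inverse _ 0<m+K)) (*-identityʳ m))
    ε≤1 : ε ≤ 1#
    ε≤1 = *-cancelˡ-≤ 0<m+K (≤-by
      (trans (+-congˡ (-‿cong (trans (*-comm _ _) ε[m+K]≈m)))
         (solve 2 (λ m k → (m :+ k) :* :1 :- m := k) refl m K)) (<⇒≤ 0<K))
    bound : - (a + ε * (b + ε * d)) - ε * m ≈ ε * ((1# + (B b - b)) + (B d - ε * d))
    bound = begin
      - (a + ε * (b + ε * d)) - ε * m
        ≈⟨ solve 4 (λ a e b d → :- (a :+ e :* (b :+ e :* d)) :- e :* (:- a) :=
             (:- a) :- e :* ((:- a) :+ b :+ e :* d)) refl a ε b d ⟩
      m - ε * (m + b + ε * d)
        ≈⟨ +-congʳ (sym ε[m+K]≈m) ⟩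
      ε * (m + K) - ε * (m + b + ε * d)
        ≈⟨ solve 6 (λ e m b d B₁ B₂ → e :* (m :+ (:1 :+ B₁ :+ B₂)) :- e :* (m :+ b :+ e :* d)
              := e :* ((:1 :+ (B₁ :- b)) :+ (B₂ :- e :* d))) refl ε m b d (B b) (B d) ⟩
      ε * ((1# + (B b - b)) + (B d - ε * d)) ∎

  double : ℕ → Carrier → Carrier
  double zero    y = y
  double (suc j) y = double j y + double j y

  -- `double j y` is 2ʲy, which is at least jy if y > 0, so a bound uniform in j would contradict
  -- the Archimedean axiom. Powers of two appear because the gaps below are doubled.
  archimedean-double : ∀ {x y} → (∀ j → double j y ≤ x) → y ≤ 0#
  archimedean-double {x} {y} bounded 0<y with archimedean (x * recip y 0<y)
  ... | N , x/y<N = bounded N (<-≤-trans x<Ny (multiple≤double N))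
    where
    n·1 = Multiples._×_ +-rawMonoid N 1#
    multiple≤double : ∀ n → Multiples._×_ +-rawMonoid n 1# * y ≤ double n y
    multiple≤double zero    = ≤-trans (≤-reflexive (zeroˡ y)) (<⇒≤ 0<y)
    multiple≤double (suc n) = ≤-by
      (solve 3 (λ k y D → (D :+ D) :- (:1 :+ k) :* y := (D :- k :* y) :+ (D :- y)) refl (Multiples._×_ +-rawMonoid n 1#) y (double n y))
      (+-nonneg (0≤y-x (multiple≤double n)) (0≤y-x (y≤double n)))
      where
      y≤double : ∀ n → y ≤ double n y
      0≤double : ∀ n → 0# ≤ double n y
      y≤double zero    = ≤-reflexive refl
      y≤double (suc n) = ≤-by (solve 2 (λ y D → (D :+ D) :- y := (D :- y) :+ D) refl y (double n y))
        (+-nonneg (0≤y-x (y≤double n)) (0≤double n))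
      0≤double zero    = <⇒≤ 0<y
      0≤double (suc n) = +-nonneg (0≤double n) (0≤double n)
    x<Ny : x < n·1 * y
    x<Ny = x<y⇐0<y-x (<-resp refl
      (begin
        y * (n·1 - x * recip y 0<y)
          ≈⟨ solve 4 (λ y k x r → y :* (k :- x :* r) := k :* y :- x :* (y :* r)) refl y n·1 x (recip y 0<y) ⟩
        n·1 * y - x * (y * recip y 0<y)
          ≈⟨ +-congˡ (-‿cong (trans (*-congˡ (recip-inverse y 0<y)) (*-identityʳ x))) ⟩
        n·1 * y - x ∎)
      (*-pos 0<y (x<y⇒0<y-x x/y<N)))

  -- Indicators and finite sums.

  𝟙 : ∀ {p} {P : Set p} → Dec P → Carrier
  𝟙 (yes _) = 1#
  𝟙 (no  _) = 0#

  𝟙-yes : ∀ {p} {P : Set p} (P? : Dec P) → P → 𝟙 P? ≈ 1#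
  𝟙-yes (yes _) p = refl
  𝟙-yes (no ¬p) p = ⊥-elim (¬p p)

  𝟙-no : ∀ {p} {P : Set p} (P? : Dec P) → ¬ P → 𝟙 P? ≈ 0#
  𝟙-no (yes p) ¬p = ⊥-elim (¬p p)
  𝟙-no (no _)  ¬p = refl

  𝟙-nonneg : ∀ {p} {P : Set p} (P? : Dec P) → 0# ≤ 𝟙 P?
  𝟙-nonneg (yes _) = <⇒≤ 0<1
  𝟙-nonneg (no _)  = ≤-reflexive refl

  𝟙-cong : ∀ {p q} {P : Set p} {Q : Set q} (P? : Dec P) (Q? : Dec Q) → (P → Q) → (Q → P) → 𝟙 P? ≈ 𝟙 Q?
  𝟙-cong (yes p) Q? f g = sym (𝟙-yes Q? (f p))
  𝟙-cong (no ¬p) Q? f g = sym (𝟙-no Q? (λ q → ¬p (g q)))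

  𝟙*-cong : ∀ {p} {P : Set p} (P? : Dec P) {x y} → (P → x ≈ y) → 𝟙 P? * x ≈ 𝟙 P? * y
  𝟙*-cong (yes p) x≈y = *-congˡ (x≈y p)
  𝟙*-cong (no _) x≈y  = trans (zeroˡ _) (sym (zeroˡ _))

  module _ {a : Level} {A : Set a} where

    ∑-cong∈ : ∀ (xs : List A) {f g} → (∀ {x} → x ∈ xs → f x ≈ g x) → ∑ xs f ≈ ∑ xs g
    ∑-cong∈ []       f≈g = refl
    ∑-cong∈ (x ∷ xs) f≈g = +-cong (f≈g (here ≡.refl)) (∑-cong∈ xs (λ x∈xs → f≈g (there x∈xs)))

    ∑-cong : ∀ (xs : List A) {f g} → (∀ x → f x ≈ g x) → ∑ xs f ≈ ∑ xs g
    ∑-cong xs f≈g = ∑-cong∈ xs (λ {x} _ → f≈g x)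

    ∑-zero∈ : ∀ (xs : List A) {f} → (∀ {x} → x ∈ xs → f x ≈ 0#) → ∑ xs f ≈ 0#
    ∑-zero∈ []       f≈0 = refl
    ∑-zero∈ (x ∷ xs) f≈0 =
      trans (+-cong (f≈0 (here ≡.refl)) (∑-zero∈ xs (λ x∈xs → f≈0 (there x∈xs)))) (+-identityˡ 0#)

    ∑-zero : ∀ (xs : List A) {f} → (∀ x → f x ≈ 0#) → ∑ xs f ≈ 0#
    ∑-zero xs f≈0 = ∑-zero∈ xs (λ {x} _ → f≈0 x)

    ∑-+ : ∀ (xs : List A) f g → ∑ xs (λ x → f x + g x) ≈ ∑ xs f + ∑ xs g
    ∑-+ []       f g = sym (+-identityˡ 0#)
    ∑-+ (x ∷ xs) f g = trans (+-congˡ (∑-+ xs f g))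
      (solve 4 (λ a b c d → (a :+ b) :+ (c :+ d) := (a :+ c) :+ (b :+ d)) refl (f x) (g x) (∑ xs f) (∑ xs g))

    ∑-*ˡ : ∀ (xs : List A) k f → ∑ xs (λ x → k * f x) ≈ k * ∑ xs f
    ∑-*ˡ []       k f = sym (zeroʳ k)
    ∑-*ˡ (x ∷ xs) k f = trans (+-congˡ (∑-*ˡ xs k f)) (sym (distribˡ k (f x) (∑ xs f)))

    ∑-*ʳ : ∀ (xs : List A) k f → ∑ xs (λ x → f x * k) ≈ ∑ xs f * k
    ∑-*ʳ xs k f = trans (∑-cong xs (λ x → *-comm (f x) k)) (trans (∑-*ˡ xs k f) (*-comm k _))

    ∑-linear : ∀ (xs : List A) k f l g → ∑ xs (λ x → k * f x + l * g x) ≈ k * ∑ xs f + l * ∑ xs g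
    ∑-linear xs k f l g = trans (∑-+ xs _ _) (+-cong (∑-*ˡ xs k f) (∑-*ˡ xs l g))

    ∑-minus : ∀ (xs : List A) f g → ∑ xs (λ x → f x - g x) ≈ ∑ xs f - ∑ xs g
    ∑-minus xs f g = trans (∑-cong xs (λ x → solve 2 (λ a b → a :- b := :1 :* a :+ (:- :1) :* b) refl (f x) (g x)))
      (trans (∑-linear xs 1# f (- 1#) g) (solve 2 (λ a b → :1 :* a :+ (:- :1) :* b := a :- b) refl (∑ xs f) (∑ xs g)))

    ∑-++ : ∀ (xs ys : List A) f → ∑ (xs ++ ys) f ≈ ∑ xs f + ∑ ys f
    ∑-++ []       ys f = sym (+-identityˡ _)
    ∑-++ (x ∷ xs) ys f = trans (+-congˡ (∑-++ xs ys f)) (sym (+-assoc _ _ _))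

    ∑-filter : ∀ {p} {P : U.Pred A p} (P? : U.Decidable P) (xs : List A) f →
      ∑ (filter P? xs) f ≈ ∑ xs (λ x → 𝟙 (P? x) * f x)
    ∑-filter P? []       f = refl
    ∑-filter P? (x ∷ xs) f with P? x
    ... | yes _ = +-cong (sym (*-identityˡ (f x))) (∑-filter P? xs f)
    ... | no  _ = trans (∑-filter P? xs f) (sym (trans (+-congʳ (zeroˡ (f x))) (+-identityˡ _)))

    ∑-nonneg∈ : ∀ (xs : List A) {f} → (∀ {x} → x ∈ xs → 0# ≤ f x) → 0# ≤ ∑ xs f
    ∑-nonneg∈ []       0≤f = ≤-reflexive refl
    ∑-nonneg∈ (x ∷ xs) 0≤f = +-nonneg (0≤f (here ≡.refl)) (∑-nonneg∈ xs (λ x∈xs → 0≤f (there x∈xs)))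

    ∑-nonneg : ∀ (xs : List A) {f} → (∀ x → 0# ≤ f x) → 0# ≤ ∑ xs f
    ∑-nonneg xs 0≤f = ∑-nonneg∈ xs (λ {x} _ → 0≤f x)

    ∑-mono : ∀ (xs : List A) {f g} → (∀ x → f x ≤ g x) → ∑ xs f ≤ ∑ xs g
    ∑-mono xs {f} {g} f≤g = ≤-by (sym (∑-minus xs g f)) (∑-nonneg xs (λ x → 0≤y-x (f≤g x)))

    term≤∑ : ∀ {xs : List A} {f x} → (∀ x → 0# ≤ f x) → x ∈ xs → f x ≤ ∑ xs f
    term≤∑ {y ∷ xs} {f} 0≤f (here ≡.refl) =
      ≤-by (solve 2 (λ x y → x :+ y :- x := y) refl (f y) (∑ xs f)) (∑-nonneg xs 0≤f)
    term≤∑ {y ∷ xs} {f} 0≤f (there x∈xs) = ≤-trans (term≤∑ 0≤f x∈xs)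
      (≤-by (solve 2 (λ x y → y :+ x :- x := y) refl (∑ xs f) (f y)) (0≤f y))

    ∑≈0⇒term≈0 : ∀ {xs : List A} {f x} → (∀ x → 0# ≤ f x) → ∑ xs f ≈ 0# → x ∈ xs → f x ≈ 0#
    ∑≈0⇒term≈0 0≤f ∑≈0 x∈xs = ≤-antisym (≤-trans (term≤∑ 0≤f x∈xs) (≤-reflexive ∑≈0)) (0≤f _)

    ∑-indicator : (_≟_ : DecidableEquality A) → ∀ {xs : List A} {x} (f : A → Carrier) → Unique xs → x ∈ xs →
      ∑ xs (λ y → 𝟙 (x ≟ y) * f y) ≈ f x
    ∑-indicator _≟_ {y ∷ xs} f (y∉xs ∷ unique) (here ≡.refl) =
      trans (+-cong (trans (*-congʳ (𝟙-yes (y ≟ y) ≡.refl)) (*-identityˡ _))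
                    (∑-zero∈ xs (λ {z} z∈xs → trans (*-congʳ (𝟙-no (y ≟ z) (All.lookup y∉xs z∈xs))) (zeroˡ _))))
            (+-identityʳ _)
    ∑-indicator _≟_ {y ∷ xs} {x} f (y∉xs ∷ unique) (there x∈xs) =
      trans (+-cong (trans (*-congʳ (𝟙-no (x ≟ y) (λ { ≡.refl → All.lookup y∉xs x∈xs ≡.refl }))) (zeroˡ _))
                    (∑-indicator _≟_ f unique x∈xs))
            (+-identityˡ _)

  module _ {a b : Level} {A : Set a} {B : Set b} where

    ∑-map : ∀ (g : A → B) (xs : List A) f → ∑ (map g xs) f ≈ ∑ xs (λ x → f (g x))
    ∑-map g []       f = refl
    ∑-map g (x ∷ xs) f = +-congˡ (∑-map g xs f)

    ∑-concatMap : ∀ (g : A → List B) (xs : List A) f → ∑ (concatMap g xs) f ≈ ∑ xs (λ x → ∑ (g x) f)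
    ∑-concatMap g []       f = refl
    ∑-concatMap g (x ∷ xs) f = trans (∑-++ (g x) (concatMap g xs) f) (+-congˡ (∑-concatMap g xs f))

    ∑-swap : ∀ (xs : List A) (ys : List B) (f : A → B → Carrier) →
      ∑ xs (λ x → ∑ ys (f x)) ≈ ∑ ys (λ y → ∑ xs (λ x → f x y))
    ∑-swap []       ys f = sym (∑-zero ys (λ _ → refl))
    ∑-swap (x ∷ xs) ys f = trans (+-congˡ (∑-swap xs ys f)) (sym (∑-+ ys (f x) (λ y → ∑ xs (λ x → f x y))))

  module _ {a b : Level} {A : Set a} {B : Set b} where

    ∑-fibres : (_≟_ : DecidableEquality B) (key : A → B) {xs : List A} {ys : List B} → Unique ys →
      (∀ {x} → x ∈ xs → key x ∈ ys) → (f : A → Carrier) →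
      ∑ xs f ≈ ∑ ys (λ y → ∑ xs (λ x → 𝟙 (key x ≟ y) * f x))
    ∑-fibres _≟_ key {xs} {ys} unique key∈ys f = sym (trans (∑-swap ys xs _)
      (∑-cong∈ xs (λ {x} x∈xs → ∑-indicator _≟_ (λ _ → f x) unique (key∈ys x∈xs))))

  -- Symmetric bilinear forms and hyperbolicity.

  module _ {a : Level} {I : Set a} where

    combine : Carrier → (I → Carrier) → Carrier → (I → Carrier) → I → Carrier
    combine a u b w x = a * u x + b * w x

    𝟏 : I → Carrier
    𝟏 _ = 1#

  record SymmetricForm {a : Level} (I : Set a) : Set (a ⊔ c ⊔ ℓ₁) where
    field
      form      : (I → Carrier) → (I → Carrier) → Carrier
      linear    : ∀ a u b w z → form (combine a u b w) z ≈ a * form u z + b * form w z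
      symmetric : ∀ u w → form u w ≈ form w u

    linearʳ : ∀ a u b w z → form z (combine a u b w) ≈ a * form z u + b * form z w
    linearʳ a u b w z = begin
      form z (combine a u b w)       ≈⟨ symmetric _ _ ⟩
      form (combine a u b w) z       ≈⟨ linear a u b w z ⟩
      a * form u z + b * form w z    ≈⟨ +-cong (*-congˡ (symmetric u z)) (*-congˡ (symmetric w z)) ⟩
      a * form z u + b * form z w    ∎

    quadratic : ∀ a u b w → form (combine a u b w) (combine a u b w) ≈
      a * a * form u u + (1# + 1#) * (a * b) * form u w + b * b * form w w
    quadratic a u b w = begin
      form (combine a u b w) (combine a u b w)
        ≈⟨ linear a u b w _ ⟩
      a * form u (combine a u b w) + b * form w (combine a u b w)
        ≈⟨ +-cong (*-congˡ (linearʳ a u b w u)) (*-congˡ (linearʳ a u b w w)) ⟩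
      a * (a * form u u + b * form u w) + b * (a * form w u + b * form w w)
        ≈⟨ +-congˡ (*-congˡ (+-congʳ (*-congˡ (symmetric w u)))) ⟩
      a * (a * form u u + b * form u w) + b * (a * form u w + b * form w w)
        ≈⟨ solve 5 (λ a b p q r → a :* (a :* p :+ b :* q) :+ b :* (a :* q :+ b :* r)
             := a :* a :* p :+ :2 :* (a :* b) :* q :+ b :* b :* r)
             refl a b (form u u) (form u w) (form w w) ⟩
      a * a * form u u + (1# + 1#) * (a * b) * form u w + b * b * form w w ∎

    NegativeOn⊥ : (I → Carrier) → Set (a ⊔ c ⊔ ℓ₁ ⊔ ℓ₂)
    NegativeOn⊥ g = ∀ v → form v g ≈ 0# → form v v ≤ 0#

    HyperbolicAt : (I → Carrier) → Set (a ⊔ c ⊔ ℓ₂)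
    HyperbolicAt e = ∀ v → form v v * form e e ≤ form v e * form v e

    -- A reverse Cauchy-Schwarz inequality: the combination `w` of `v` and `e` orthogonal to `g` has
    -- nonpositive square, and the rest is completing a square. It serves to change the reference
    -- vector, from `null` to `tilt ε` in the children and back from `tilt ε` to `null` in their
    -- parent.
    negative⇒hyperbolic : ∀ {g e} → NegativeOn⊥ g → 0# < form e g → 0# ≤ form e e → HyperbolicAt e
    negative⇒hyperbolic {g} {e} negative 0<β 0≤Qe v = *-cancelˡ-≤ (*-pos 0<β 0<β) (≤-by certificate
        (+-nonneg (square-nonneg (β * form v e - α * form e e))
                  (*-nonneg 0≤Qe (≤-resp refl (+-identityˡ _) (0≤y-x (negative w w⊥g))))))
      where
      α = form v g
      β = form e g
      w = combine β v (- α) e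
      w⊥g : form w g ≈ 0#
      w⊥g = trans (linear β v (- α) e g)
        (solve 2 (λ a b → b :* a :+ (:- a) :* b := :0) refl α β)
      certificate : β * β * (form v e * form v e) - β * β * (form v v * form e e) ≈
        (β * form v e - α * form e e) * (β * form v e - α * form e e) + form e e * (- form w w)
      certificate = begin
        β * β * (form v e * form v e) - β * β * (form v v * form e e)
          ≈⟨ solve 5 (λ a b B q p → b :* b :* (B :* B) :- b :* b :* (q :* p) :=
               (b :* B :- a :* p) :* (b :* B :- a :* p) :+
               p :* (:- (b :* b :* q :+ :2 :* (b :* (:- a)) :* B :+ (:- a) :* (:- a) :* p)))
               refl α β (form v e) (form v v) (form e e) ⟩
        _ ≈⟨ +-congˡ (*-congˡ (-‿cong (quadratic β v (- α) e))) ⟨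
        _ ∎

    hyperbolic⇒negative : ∀ {e} → 0# < form e e → HyperbolicAt e → NegativeOn⊥ e
    hyperbolic⇒negative {e} 0<Qe hyperbolic v v⊥e = *-cancelˡ-≤ 0<Qe (≤-resp (*-comm _ _)
      (trans (*-congˡ v⊥e) (trans (zeroʳ _) (sym (zeroʳ _)))) (hyperbolic v))

    -- The form v ↦ B(v,e)² - Q(v)Q(e) is nonnegative, so its isotropic vectors are in its radical.
    isotropic⇒radical : ∀ {e z} → 0# < form e e → HyperbolicAt e →
      form z e ≈ 0# → form z z ≈ 0# → ∀ w → form z w ≈ 0#
    isotropic⇒radical {e} {z} 0<Qe hyperbolic z⊥e Qz≈0 w = square≈0⇒≈0 (≤-antisym ββ≤0 (square-nonneg β))
      where
      β = form z w
      r = form w e * form w e - form w w * form e e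
      perturbed : ∀ ε → 0# < ε → 0# ≤ (- ((1# + 1#) * (β * β) * form e e)) + ε * (β * β * r + ε * 0#)
      perturbed ε 0<ε = *-cancel-nonneg 0<ε (≤-resp refl
        (begin
          form v e * form v e - form v v * form e e
            ≈⟨ +-cong (*-cong Bve Bve) (-‿cong (*-congʳ (quadratic 1# z (ε * β) w))) ⟩
          (1# * 0# + ε * β * form w e) * (1# * 0# + ε * β * form w e) -
            (1# * 1# * form z z + (1# + 1#) * (1# * (ε * β)) * β + ε * β * (ε * β) * form w w) * form e e
            ≈⟨ +-congˡ (-‿cong (*-congʳ (+-congʳ (+-congʳ (*-congˡ Qz≈0))))) ⟩
          (1# * 0# + ε * β * form w e) * (1# * 0# + ε * β * form w e) -
            (1# * 1# * 0# + (1# + 1#) * (1# * (ε * β)) * β + ε * β * (ε * β) * form w w) * form e e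
            ≈⟨ solve 5 (λ ε β x y p →
                 (:1 :* :0 :+ ε :* β :* x) :* (:1 :* :0 :+ ε :* β :* x) :-
                 (:1 :* :1 :* :0 :+ :2 :* (:1 :* (ε :* β)) :* β :+ ε :* β :* (ε :* β) :* y) :* p
                 := ε :* ((:- (:2 :* (β :* β) :* p)) :+ ε :* (β :* β :* (x :* x :- y :* p) :+ ε :* :0)))
                 refl ε β (form w e) (form w w) (form e e) ⟩
          ε * ((- ((1# + 1#) * (β * β) * form e e)) + ε * (β * β * r + ε * 0#)) ∎)
        (0≤y-x (hyperbolic v)))
        where
        -- The coefficient `β` makes the term of first order in ε equal to -2β²Q(e), whose sign is
        -- known whatever that of `β`.
        v = combine 1# z (ε * β) w
        Bve : form v e ≈ 1# * 0# + ε * β * form w e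
        Bve = trans (linear 1# z (ε * β) w e) (+-congʳ (*-congˡ z⊥e))
      ββ≤0 : β * β ≤ 0#
      ββ≤0 = *-cancelˡ-≤ (*-pos 0<2 0<Qe) (≤-by
        (solve 2 (λ β p → :2 :* p :* :0 :- :2 :* p :* (β :* β) := :- (:2 :* (β :* β) :* p)) refl β (form e e))
        (nonneg-at-0 perturbed))


  -- Spectral gap of a self-adjoint operator.

  open SymmetricForm

  -- Here P is a self-adjoint operator with W(u,w) = D(u,Pw), fixing g, with P ≥ -1 and P ≤ P².
  -- On the orthogonal complement of g, (1+κ)P ≤ 1 implies (1+2κ)P ≤ 1, hence P ≤ 0.
  module _ {a : Level} {I : Set a} (D W : SymmetricForm I) (P : (I → Carrier) → (I → Carrier))
    (g : I → Carrier)
    (adjoint : ∀ u w → form D u (P w) ≈ form W u w)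
    (fixed   : ∀ u → form W g u ≈ form D g u)
    (lower   : ∀ u → 0# ≤ form D u u + form W u u)
    (pull    : ∀ u → form W u u ≤ form D (P u) (P u))
    where

    GapBy : Carrier → Set (a ⊔ c ⊔ ℓ₁ ⊔ ℓ₂)
    GapBy κ = ∀ u → form D g u ≈ 0# → (1# + κ) * form W u u ≤ form D u u

    -- Apply the gap to u + Pu, and P ≥ -1 to u - (1+κ)Pu.
    gap-double : ∀ {κ} → 0# < κ → GapBy κ → GapBy (κ + κ)
    gap-double {κ} 0<κ gap u u⊥g = *-cancelˡ-≤ 0<2+κ (≤-by
        -- For Pu = λu and D(u,u) = 1 the identity reads (2+κ)(1-(1+2κ)λ) = (1+λ)(1-(1+κ)λ)² +
        -- (1+κ)(1+λ)²(1-(1+κ)λ) + (2+κ)(1+κ)(λ²-λ). The three summands are nonnegative by `lower`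
        -- at `y`, `gap` at `z` and `pull` at `u`.
        (solve 5 (λ k p w s t →
          (:1 :+ (:1 :+ k)) :* p :- (:1 :+ (:1 :+ k)) :* ((:1 :+ (k :+ k)) :* w) :=
          ((:1 :* :1 :* p :+ :2 :* (:1 :* (:- (:1 :+ k))) :* w :+ (:- (:1 :+ k)) :* (:- (:1 :+ k)) :* s) :+
           (:1 :* :1 :* w :+ :2 :* (:1 :* (:- (:1 :+ k))) :* s :+ (:- (:1 :+ k)) :* (:- (:1 :+ k)) :* t)) :+
          (:1 :+ k) :* ((:1 :* :1 :* p :+ :2 :* (:1 :* :1) :* w :+ :1 :* :1 :* s) :-
                        (:1 :+ k) :* (:1 :* :1 :* w :+ :2 :* (:1 :* :1) :* s :+ :1 :* :1 :* t)) :+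
          (:1 :+ (:1 :+ k)) :* (:1 :+ k) :* (s :- w)) refl κ p w s t)
        (+-nonneg (+-nonneg
          (≤-resp refl (+-cong Dy Wy) (lower y))
          (*-nonneg (<⇒≤ 0<1+κ) (≤-resp refl (+-cong Dz (-‿cong (*-congˡ Wz))) (0≤y-x (gap z z⊥g)))))
          (*-nonneg (*-nonneg (<⇒≤ 0<2+κ) (<⇒≤ 0<1+κ)) (0≤y-x (pull u)))))
      where
      p = form D u u
      w = form W u u
      s = form D (P u) (P u)
      t = form W (P u) (P u)
      z = combine 1# u 1# (P u)
      y = combine 1# u (- (1# + κ)) (P u)
      0<1+κ : 0# < 1# + κ
      0<1+κ = +-pos-nonneg 0<1 (<⇒≤ 0<κ)
      0<2+κ : 0# < 1# + (1# + κ)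
      0<2+κ = +-pos-nonneg 0<1 (<⇒≤ 0<1+κ)
      WuPu : form W u (P u) ≈ s
      WuPu = trans (symmetric W u (P u)) (sym (adjoint (P u) u))
      z⊥g : form D g z ≈ 0#
      z⊥g = begin
        form D g z                            ≈⟨ linearʳ D 1# u 1# (P u) g ⟩
        1# * form D g u + 1# * form D g (P u) ≈⟨ +-congˡ (*-congˡ (trans (adjoint g u) (fixed u))) ⟩
        1# * form D g u + 1# * form D g u     ≈⟨ +-cong (*-congˡ u⊥g) (*-congˡ u⊥g) ⟩
        1# * 0# + 1# * 0#                     ≈⟨ solve 0 (:1 :* :0 :+ :1 :* :0 := :0) refl ⟩
        0#                                    ∎
      Dz = trans (quadratic D 1# u 1# (P u)) (+-congʳ (+-congˡ (*-congˡ (adjoint u u))))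
      Wz = trans (quadratic W 1# u 1# (P u)) (+-congʳ (+-congˡ (*-congˡ WuPu)))
      Dy = trans (quadratic D 1# u (- (1# + κ)) (P u)) (+-congʳ (+-congˡ (*-congˡ (adjoint u u))))
      Wy = trans (quadratic W 1# u (- (1# + κ)) (P u)) (+-congʳ (+-congˡ (*-congˡ WuPu)))

    -- Iterated doubling keeps 2ʲκW(u,u) below D(u,u) - W(u,u) for every j, which the Archimedean
    -- axiom allows only for W(u,u) ≤ 0.
    gap⇒negative : ∀ {κ} → 0# < κ → GapBy κ → ∀ u → form D g u ≈ 0# → form W u u ≤ 0#
    gap⇒negative {κ} 0<κ gap u u⊥g = *-cancelˡ-≤ 0<κ (≤-trans (archimedean-double bounded)
        (≤-reflexive (sym (zeroʳ κ))))
      where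
      0<double : ∀ j → 0# < double j κ
      0<double zero    = 0<κ
      0<double (suc j) = +-pos-nonneg (0<double j) (<⇒≤ (0<double j))
      gaps : ∀ j → GapBy (double j κ)
      gaps zero    = gap
      gaps (suc j) = gap-double (0<double j) (gaps j)
      double-* : ∀ j w → double j (κ * w) ≈ double j κ * w
      double-* zero    w = refl
      double-* (suc j) w = trans (+-cong (double-* j w) (double-* j w)) (sym (distribʳ _ _ _))
      bounded : ∀ j → double j (κ * form W u u) ≤ form D u u - form W u u
      bounded j = ≤-by (trans (+-congˡ (-‿cong (double-* j _)))
        (solve 3 (λ p w d → p :- w :- d :* w := p :- (:1 :+ d) :* w) refl (form D u u) (form W u u) (double j κ)))
        (0≤y-x (gaps j u u⊥g))

  -- Matrices and weighted graphs.

  module _ {a : Level} {I : Set a} (xs : List I) where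

    infix 8 _▹_

    _▹_ : (I → I → Carrier) → (I → Carrier) → I → Carrier
    (M ▹ u) x = ∑ xs (λ y → M x y * u y)

    bilinear : (I → I → Carrier) → (I → Carrier) → (I → Carrier) → Carrier
    bilinear M u w = ∑ xs (λ x → u x * (M ▹ w) x)

    ▹-cong : ∀ M {u w} → (∀ x → u x ≈ w x) → ∀ x → (M ▹ u) x ≈ (M ▹ w) x
    ▹-cong M u≈w x = ∑-cong xs (λ y → *-congˡ (u≈w y))

    bilinear-cong : ∀ M {u u′ w w′} → (∀ x → u x ≈ u′ x) → (∀ x → w x ≈ w′ x) →
      bilinear M u w ≈ bilinear M u′ w′
    bilinear-cong M u≈u′ w≈w′ = ∑-cong xs (λ x → *-cong (u≈u′ x) (▹-cong M w≈w′ x))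

    matrixForm : (M : I → I → Carrier) → (∀ x y → M x y ≈ M y x) → SymmetricForm I
    matrixForm M M-sym = record
      { form      = bilinear M
      ; linear    = λ a u b w z → trans
          (∑-cong xs (λ x → solve 5 (λ a u b w m → (a :* u :+ b :* w) :* m := a :* (u :* m) :+ b :* (w :* m))
                              refl a (u x) b (w x) ((M ▹ z) x)))
          (∑-linear xs a (λ x → u x * (M ▹ z) x) b (λ x → w x * (M ▹ z) x))
      ; symmetric = λ u w → begin
          ∑ xs (λ x → u x * ∑ xs (λ y → M x y * w y))
            ≈⟨ ∑-cong xs (λ x → sym (∑-*ˡ xs (u x) (λ y → M x y * w y))) ⟩
          ∑ xs (λ x → ∑ xs (λ y → u x * (M x y * w y)))
            ≈⟨ ∑-swap xs xs (λ x y → u x * (M x y * w y)) ⟩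
          ∑ xs (λ y → ∑ xs (λ x → u x * (M x y * w y)))
            ≈⟨ ∑-cong xs (λ y → trans
                 (∑-cong xs (λ x → trans (*-congˡ (*-congʳ (M-sym x y)))
                   (solve 3 (λ u m w → u :* (m :* w) := w :* (m :* u)) refl (u x) (M y x) (w y))))
                 (∑-*ˡ xs (w y) (λ x → M y x * u x))) ⟩
          ∑ xs (λ y → w y * ∑ xs (λ x → M y x * u x)) ∎
      }

    diagonalForm : (I → Carrier) → SymmetricForm I
    diagonalForm d = record
      { form      = λ u w → ∑ xs (λ x → d x * (u x * w x))
      ; linear    = λ a u b w z → trans
          (∑-cong xs (λ x → solve 6 (λ d a u b w z → d :* ((a :* u :+ b :* w) :* z)
                                := a :* (d :* (u :* z)) :+ b :* (d :* (w :* z)))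
                              refl (d x) a (u x) b (w x) (z x)))
          (∑-linear xs a (λ x → d x * (u x * z x)) b (λ x → d x * (w x * z x)))
      ; symmetric = λ u w → ∑-cong xs (λ x → *-congˡ (*-comm (u x) (w x)))
      }

    module _ (W : I → I → Carrier) (W-sym : ∀ x y → W x y ≈ W y x) (W-nonneg : ∀ x y → 0# ≤ W x y) where

      degree : I → Carrier
      degree x = ∑ xs (W x)

      private
        D = diagonalForm degree
        Wᶠ = matrixForm W W-sym

      -- For σ = -1 this is the Dirichlet form 2(D - W), for σ = 1 its signless variant 2(D + W).
      -- Their nonnegativity says that the eigenvalues of d⁻¹W lie between -1 and 1.
      ∑-weighted-squares : ∀ σ u → ∑ xs (λ x → ∑ xs (λ y → W x y * ((u x + σ * u y) * (u x + σ * u y)))) ≈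
        (1# + σ * σ) * form D u u + (1# + 1#) * σ * bilinear W u u
      ∑-weighted-squares σ u = begin
        ∑ xs (λ x → ∑ xs (λ y → W x y * ((u x + σ * u y) * (u x + σ * u y))))
          ≈⟨ ∑-cong xs (λ x → row x) ⟩
        ∑ xs (λ x → (degree x * (u x * u x) + (1# + 1#) * σ * (u x * (W ▹ u) x)) + σ * σ * ∑ xs (λ y → W x y * (u y * u y)))
          ≈⟨ ∑-+ xs _ _ ⟩
        ∑ xs (λ x → degree x * (u x * u x) + (1# + 1#) * σ * (u x * (W ▹ u) x))
          + ∑ xs (λ x → σ * σ * ∑ xs (λ y → W x y * (u y * u y)))
          ≈⟨ +-cong (trans (∑-+ xs _ _) (+-congˡ (∑-*ˡ xs _ _))) (trans (∑-*ˡ xs _ _) (*-congˡ columns)) ⟩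
        (form D u u + (1# + 1#) * σ * bilinear W u u) + σ * σ * form D u u
          ≈⟨ solve 3 (λ s d w → (d :+ :2 :* s :* w) :+ s :* s :* d := (:1 :+ s :* s) :* d :+ :2 :* s :* w) refl σ _ _ ⟩
        (1# + σ * σ) * form D u u + (1# + 1#) * σ * bilinear W u u ∎
        where
        row : ∀ x → ∑ xs (λ y → W x y * ((u x + σ * u y) * (u x + σ * u y))) ≈
          (degree x * (u x * u x) + (1# + 1#) * σ * (u x * (W ▹ u) x)) + σ * σ * ∑ xs (λ y → W x y * (u y * u y))
        row x = begin
          ∑ xs (λ y → W x y * ((u x + σ * u y) * (u x + σ * u y)))
            ≈⟨ ∑-cong xs (λ y → solve 4 (λ W a b s → W :* ((a :+ s :* b) :* (a :+ s :* b)) :=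
                 (W :* (a :* a) :+ :2 :* s :* a :* (W :* b)) :+ s :* s :* (W :* (b :* b))) refl (W x y) (u x) (u y) σ) ⟩
          ∑ xs (λ y → (W x y * (u x * u x) + (1# + 1#) * σ * u x * (W x y * u y)) + σ * σ * (W x y * (u y * u y)))
            ≈⟨ trans (∑-+ xs _ _) (+-cong (trans (∑-+ xs _ _) (+-cong (∑-*ʳ xs (u x * u x) (W x)) (∑-*ˡ xs _ _))) (∑-*ˡ xs _ _)) ⟩
          (degree x * (u x * u x) + (1# + 1#) * σ * u x * (W ▹ u) x) + σ * σ * ∑ xs (λ y → W x y * (u y * u y))
            ≈⟨ +-congʳ (+-congˡ (*-assoc _ (u x) _)) ⟩
          _ ∎
        columns : ∑ xs (λ x → ∑ xs (λ y → W x y * (u y * u y))) ≈ form D u u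
        columns = trans (∑-swap xs xs (λ x y → W x y * (u y * u y)))
          (∑-cong xs (λ y → trans (∑-*ʳ xs (u y * u y) (λ x → W x y))
            (*-congʳ (∑-cong xs (λ x → W-sym x y)))))

      ∑-weighted-squares-nonneg : ∀ σ u → 0# ≤ (1# + σ * σ) * form D u u + (1# + 1#) * σ * bilinear W u u
      ∑-weighted-squares-nonneg σ u = ≤-resp refl (∑-weighted-squares σ u)
        (∑-nonneg xs (λ x → ∑-nonneg xs (λ y → *-nonneg (W-nonneg x y) (square-nonneg _))))

      -- The negativity of the eigenvalues of P = d⁻¹W other than the Perron eigenvalue 1: by `pull`
      -- each of them satisfies λ ≤ λ², and the comparison with the row of e separates them from 1.
      negativeOn⊥𝟏 : (P : (I → Carrier) → (I → Carrier)) →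
        (∀ u x → degree x * P u x ≈ (W ▹ u) x) →
        (∀ u → bilinear W u u ≤ ∑ xs (λ x → degree x * (P u x * P u x))) →
        ∀ {e} → e ∈ xs → ∀ {K} → 0# < K → (∀ y → degree y ≤ K * W e y) →
        ∀ u → ∑ xs (λ x → degree x * u x) ≈ 0# → bilinear W u u ≤ 0#
      negativeOn⊥𝟏 P P-spec pull {e} e∈xs {K} 0<K degree≤ u u⊥𝟏 =
        gap⇒negative D Wᶠ P 𝟏 adjoint fixed lower pull (recip-pos _ 0<2K) gap u
          (trans (∑-cong xs (λ x → *-congˡ (*-identityˡ (u x)))) u⊥𝟏)
        where
        0<2K = *-pos 0<2 0<K
        κ = recip _ 0<2K
        adjoint : ∀ u w → form D u (P w) ≈ bilinear W u w
        adjoint u w = ∑-cong xs (λ x → trans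
          (solve 3 (λ d a b → d :* (a :* b) := a :* (d :* b)) refl (degree x) (u x) (P w x))
          (*-congˡ (P-spec w x)))
        fixed : ∀ u → bilinear W 𝟏 u ≈ form D 𝟏 u
        fixed u = trans (symmetric Wᶠ 𝟏 u) (∑-cong xs (λ x → trans
          (*-congˡ (∑-cong xs (λ y → *-identityʳ (W x y))))
          (solve 2 (λ u d → u :* d := d :* (:1 :* u)) refl (u x) (degree x))))
        lower : ∀ u → 0# ≤ form D u u + bilinear W u u
        lower u = *-cancel-nonneg 0<2 (≤-resp refl
          (solve 2 (λ d w → (:1 :+ :1 :* :1) :* d :+ :2 :* :1 :* w := :2 :* (d :+ w)) refl _ _)
          (∑-weighted-squares-nonneg 1# u))
        W≤D : ∀ u → 0# ≤ form D u u - bilinear W u u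
        W≤D u = *-cancel-nonneg 0<2 (≤-resp refl
          (solve 2 (λ d w → (:1 :+ (:- :1) :* (:- :1)) :* d :+ :2 :* (:- :1) :* w := :2 :* (d :- w)) refl _ _)
          (∑-weighted-squares-nonneg (- 1#) u))
        -- Poincaré inequality. Of the Dirichlet form 2(D - W) only the row of `e` is kept. As the
        -- degrees are at most `K` times that row, 2K(D - W) dominates the sum of the squares (u e -
        -- u y)² weighted by degree, and this is at least D(u,u) because `u` is orthogonal to `𝟏`.
        -- Hence D ≤ 2K(D - W), and κ = 1/(2K).
        gap : GapBy D Wᶠ P 𝟏 adjoint fixed lower pull κ
        gap u u⊥𝟏 = ≤-by (solve 3 (λ k d w → d :- (:1 :+ k) :* w := (d :- w :- k :* d) :+ k :* (d :- w)) refl κ Duu Wuu)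
            (+-nonneg 0≤D-W-κD (*-nonneg (<⇒≤ (recip-pos _ 0<2K)) (W≤D u)))
          where
          Duu = form D u u
          Wuu = bilinear W u u
          row-e = ∑ xs (λ y → W e y * ((u e + - 1# * u y) * (u e + - 1# * u y)))
          row-e≤ : row-e ≤ (1# + 1#) * (Duu - Wuu)
          row-e≤ = ≤-trans
            (term≤∑ {f = λ x → ∑ xs (λ y → W x y * ((u x + - 1# * u y) * (u x + - 1# * u y)))}
              (λ x → ∑-nonneg xs (λ y → *-nonneg (W-nonneg x y) (square-nonneg _))) e∈xs)
            (≤-reflexive (trans (∑-weighted-squares (- 1#) u)
              (solve 2 (λ d w → (:1 :+ (:- :1) :* (:- :1)) :* d :+ :2 :* (:- :1) :* w := :2 :* (d :- w)) refl _ _)))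
          variance : ∑ xs (λ y → degree y * ((u e + - 1# * u y) * (u e + - 1# * u y))) ≈ u e * u e * ∑ xs degree + Duu
          variance = begin
            ∑ xs (λ y → degree y * ((u e + - 1# * u y) * (u e + - 1# * u y)))
              ≈⟨ ∑-cong xs (λ y → solve 3 (λ d a b → d :* ((a :+ (:- :1) :* b) :* (a :+ (:- :1) :* b)) :=
                   (a :* a :* d :+ (:- (:2 :* a)) :* (d :* (:1 :* b))) :+ d :* (b :* b)) refl (degree y) (u e) (u y)) ⟩
            ∑ xs (λ y → (u e * u e * degree y + (- ((1# + 1#) * u e)) * (degree y * (1# * u y))) + degree y * (u y * u y))
              ≈⟨ trans (∑-+ xs _ _) (+-congʳ (∑-linear xs _ _ _ _)) ⟩
            (u e * u e * ∑ xs degree + (- ((1# + 1#) * u e)) * form D 𝟏 u) + Duu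
              ≈⟨ +-congʳ (trans (+-congˡ (trans (*-congˡ u⊥𝟏) (zeroʳ _))) (+-identityʳ _)) ⟩
            u e * u e * ∑ xs degree + Duu ∎
          D≤ : Duu ≤ (1# + 1#) * K * (Duu - Wuu)
          D≤ = ≤-trans
            (≤-by (solve 2 (λ a b → (a :+ b) :- b := a) refl _ Duu)
                  (*-nonneg (square-nonneg (u e)) (∑-nonneg xs (λ x → ∑-nonneg xs (W-nonneg x)))))
            (≤-trans (≤-reflexive (sym variance))
            (≤-trans (∑-mono xs (λ y → ≤-resp (*-comm _ _) (solve 3 (λ a k w → a :* (k :* w) := k :* (w :* a)) refl _ K (W e y))
                        (*-monoʳ-≤ (square-nonneg _) (degree≤ y))))
            (≤-trans (≤-reflexive (∑-*ˡ xs K _))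
            (≤-trans (*-monoʳ-≤ (<⇒≤ 0<K) row-e≤)
              (≤-reflexive (solve 2 (λ k x → k :* (:2 :* x) := :2 :* k :* x) refl K (Duu - Wuu)))))))
          0≤D-W-κD : 0# ≤ Duu - Wuu - κ * Duu
          0≤D-W-κD = ≤-resp refl (trans
              (solve 4 (λ k t d w → k :* (t :* (d :- w) :- d) := t :* k :* (d :- w) :- k :* d) refl κ ((1# + 1#) * K) Duu Wuu)
              (+-congʳ (trans (*-congʳ (recip-inverse _ 0<2K)) (*-identityˡ _))))
            (*-nonneg (<⇒≤ (recip-pos _ 0<2K)) (0≤y-x D≤))

  -- Weights of continuations.

  module _ {n : ℕ} (G : Greedoid n) (Q : WeightFunction ℝ G) where

    open Greedoid G
    open WeightFunction Q renaming (weight to q)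

    X : List (Fin n)
    X = allFin n

    -- L α r is the paper's L_{q,α}(r): as q vanishes outside the language, the sum need not be
    -- restricted to Contᵣ.
    L : Word n → ℕ → Carrier
    L α zero    = q α
    L α (suc r) = ∑ X (λ x → L (α ∷ʳ x) r)

    ∷ʳ-∷ʳ : ∀ (α : Word n) x y → α ∷ʳ x ∷ʳ y ≡ α ++ x ∷ y ∷ []
    ∷ʳ-∷ʳ α x y = ++-assoc α (x ∷ []) (y ∷ [])

    prefix : ∀ α x → Lang (α ∷ʳ x) → Lang α
    prefix α x = hereditary α (x ∷ [])

    length-∷ʳ : ∀ (w : Word n) x → length (w ∷ʳ x) ≡ suc (length w)
    length-∷ʳ w x = ≡.trans (length-++ w) (ℕ.+-comm _ 1)

    L-outside : ∀ {α} r → ¬ Lang α → L α r ≈ 0#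
    L-outside zero    α∉L = outside _ α∉L
    L-outside (suc r) α∉L = ∑-zero X (λ x → L-outside r (λ αx∈L → α∉L (prefix _ x αx∈L)))

    L-nonneg : ∀ α r → 0# ≤ L α r
    L-nonneg α zero with Lang? α
    ... | yes α∈L = <⇒≤ (positive α α∈L)
    ... | no  α∉L = ≤-reflexive (sym (outside α α∉L))
    L-nonneg α (suc r) = ∑-nonneg X (λ x → L-nonneg (α ∷ʳ x) r)

    ∑-words : ∀ r (f : Word n → Carrier) → ∑ (words n (suc r)) f ≈ ∑ X (λ x → ∑ (words n r) (λ β → f (x ∷ β)))
    ∑-words r f = trans (∑-concatMap _ X f) (∑-cong X (λ x → ∑-map (x ∷_) (words n r) f))

    L-+ : ∀ α i j → L α (i ℕ.+ j) ≈ ∑ (words n i) (λ β → L (α ++ β) j)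
    L-+ α zero    j = trans (reflexive (≡.cong (λ w → L w j) (≡.sym (++-identityʳ α)))) (sym (+-identityʳ _))
    L-+ α (suc i) j = begin
      ∑ X (λ x → L (α ∷ʳ x) (i ℕ.+ j))
        ≈⟨ ∑-cong X (λ x → L-+ (α ∷ʳ x) i j) ⟩
      ∑ X (λ x → ∑ (words n i) (λ β → L ((α ∷ʳ x) ++ β) j))
        ≈⟨ ∑-cong X (λ x → ∑-cong (words n i) (λ β → reflexive (≡.cong (λ w → L w j) (++-assoc α (x ∷ []) β)))) ⟩
      ∑ X (λ x → ∑ (words n i) (λ β → L (α ++ x ∷ β) j))
        ≈⟨ ∑-words i (λ β → L (α ++ β) j) ⟨
      ∑ (words n (suc i)) (λ β → L (α ++ β) j) ∎

    L-words : ∀ α r → L α r ≈ ∑ (words n r) (λ β → q (α ++ β))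
    L-words α r = trans (reflexive (≡.cong (L α) (≡.sym (ℕ.+-identityʳ r)))) (L-+ α r 0)

    Lqα≈L : ∀ α r → Lqα ℝ G Q α r ≈ L α r
    Lqα≈L α r = trans (∑-filter _ (words n r) _) (trans (∑-cong (words n r) bracket) (sym (L-words α r)))
      where
      bracket : ∀ β → 𝟙 (Lang? (α ++ β)) * q (α ++ β) ≈ q (α ++ β)
      bracket β with Lang? (α ++ β)
      ... | yes _ = *-identityˡ _
      ... | no αβ∉L = trans (zeroˡ _) (sym (outside _ αβ∉L))

    Lq≈L : ∀ r → Lq ℝ G Q r ≈ L [] r
    Lq≈L r = Lqα≈L [] r

    -- A word of the language shorter than the rank can be prolonged, by exchange with a word of
    -- maximal length.
    L-pos : ∀ {m} → IsRank G m → ∀ {α} r → Lang α → length α ℕ.+ r ℕ.≤ m → 0# < L α r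
    L-pos rank zero    α∈L _     = positive _ α∈L
    L-pos {m} rank@((γ , γ∈L , |γ|≡m) , _) {α} (suc r) α∈L |α|+r<m with exchange γ∈L α∈L |α|<|γ|
      where
      |α|<|γ| : length α ℕ.< length γ
      |α|<|γ| = ≡.subst (length α ℕ.<_) (≡.sym |γ|≡m)
        (ℕ.≤-trans (ℕ.≤-trans (ℕ.s≤s (ℕ.m≤m+n (length α) r)) (ℕ.≤-reflexive (≡.sym (ℕ.+-suc (length α) r)))) |α|+r<m)
    ... | x , _ , αx∈L = <-≤-trans (L-pos rank r αx∈L |αx|+r≤m)
        (term≤∑ (λ x → L-nonneg (α ∷ʳ x) r) (∈-allFin x))
      where
      |αx|+r≤m : length (α ∷ʳ x) ℕ.+ r ℕ.≤ m
      |αx|+r≤m = ≡.subst (ℕ._≤ m) (≡.trans (≡.sym (ℕ.+-assoc (length α) 1 r)) (≡.cong (ℕ._+ r) (≡.sym (length-++ α))))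
        |α|+r<m

    ∈-Cont : ∀ {α x} → Lang (α ∷ʳ x) → x ∈ Cont G α
    ∈-Cont αx∈L = ∈-filter⁺ _ (∈-allFin _) αx∈L

    χ : Word n → Fin n → Carrier
    χ α x = 𝟙 (Lang? (α ∷ʳ x))

    Commutes : Word n → Set ℓ₁
    Commutes α = ∀ {x y} r → Lang (α ∷ʳ x) → Lang (α ∷ʳ y) → L (α ∷ʳ x ∷ʳ y) r ≈ L (α ∷ʳ y ∷ʳ x) r

    swap-prefix : ∀ S {α} → ContInv ℝ G Q S α → ∀ {x y} → Lang (α ∷ʳ x) → Lang (α ∷ʳ y) →
      ∀ β r → L ((α ∷ʳ x ∷ʳ y) ++ β) r ≈ L ((α ∷ʳ y ∷ʳ x) ++ β) r
    swap-prefix S {α} contInv {x} {y} αx∈L αy∈L β r = begin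
      L ((α ∷ʳ x ∷ʳ y) ++ β) r                           ≈⟨ L-words _ r ⟩
      ∑ (words n r) (λ γ → q (((α ∷ʳ x ∷ʳ y) ++ β) ++ γ)) ≈⟨ ∑-cong (words n r) (λ γ → reflexive (≡.cong q (assoc x y γ))) ⟩
      ∑ (words n r) (λ γ → q (α ++ x ∷ y ∷ β ++ γ))      ≈⟨ ∑-cong (words n r) (λ γ → contInv (∈-Cont αx∈L) (∈-Cont αy∈L) (β ++ γ)) ⟩
      ∑ (words n r) (λ γ → q (α ++ y ∷ x ∷ β ++ γ))      ≈⟨ ∑-cong (words n r) (λ γ → reflexive (≡.cong q (assoc y x γ))) ⟨
      ∑ (words n r) (λ γ → q (((α ∷ʳ y ∷ʳ x) ++ β) ++ γ)) ≈⟨ L-words _ r ⟨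
      L ((α ∷ʳ y ∷ʳ x) ++ β) r                           ∎
      where
      assoc : ∀ x y γ → ((α ∷ʳ x ∷ʳ y) ++ β) ++ γ ≡ α ++ x ∷ y ∷ β ++ γ
      assoc x y γ = ≡.trans (++-assoc (α ∷ʳ x ∷ʳ y) β γ)
        (≡.trans (≡.cong (_++ (β ++ γ)) (∷ʳ-∷ʳ α x y)) (++-assoc α (x ∷ y ∷ []) (β ++ γ)))

    contInv⇒commutes : ∀ S {α} → ContInv ℝ G Q S α → Commutes α
    contInv⇒commutes S {α} contInv {x} {y} r αx∈L αy∈L =
      ≡.subst₂ (λ v w → L v r ≈ L w r) (++-identityʳ _) (++-identityʳ _)
        (swap-prefix S contInv αx∈L αy∈L [] r)

    -- Matrices of the atlas.

    -- The index set of the matrices: the letters (`just`) and the paper's null (`nothing`).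
    Point : Set
    Point = Maybe (Fin n)

    points : List Point
    points = nothing ∷ map just X

    ∈-points : ∀ z → z ∈ points
    ∈-points nothing  = here ≡.refl
    ∈-points (just x) = there (∈-map⁺ just (∈-allFin x))

    ∑-points : ∀ f → ∑ points f ≈ f nothing + ∑ X (λ x → f (just x))
    ∑-points f = +-congˡ (∑-map just X f)

    -- A letter z that can follow αx but not α would spoil the symmetry. The weights of such αxz are
    -- collected in the diagonal entry of `x`, so that the letter entries in the row of `x` still
    -- sum to `L (α ∷ʳ x) (suc r)`.
    A : Word n → ℕ → Point → Point → Carrier
    A α r nothing  nothing  = L α r
    A α r nothing  (just x) = L (α ∷ʳ x) r
    A α r (just x) nothing  = L (α ∷ʳ x) r
    A α r (just x) (just y) = χ α y * L (α ∷ʳ x ∷ʳ y) r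
      + 𝟙 (x ≟ y) * ∑ X (λ z → (1# - χ α z) * L (α ∷ʳ x ∷ʳ z) r)

    1-𝟙-nonneg : ∀ {p} {P : Set p} (P? : Dec P) → 0# ≤ 1# - 𝟙 P?
    1-𝟙-nonneg (yes _) = ≤-reflexive (sym (-‿inverseʳ 1#))
    1-𝟙-nonneg (no _)  = ≤-resp refl (solve 0 (:1 := :1 :- :0) refl) (<⇒≤ 0<1)

    A-nonneg : ∀ α r z w → 0# ≤ A α r z w
    A-nonneg α r nothing  nothing  = L-nonneg _ r
    A-nonneg α r nothing  (just x) = L-nonneg _ r
    A-nonneg α r (just x) nothing  = L-nonneg _ r
    A-nonneg α r (just x) (just y) = +-nonneg (*-nonneg (𝟙-nonneg (Lang? _)) (L-nonneg _ r))
      (*-nonneg (𝟙-nonneg (x ≟ y)) (∑-nonneg X (λ z → *-nonneg (1-𝟙-nonneg (Lang? _)) (L-nonneg _ r))))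

    χ-swap : ∀ {α x y ℓ₁ ℓ₂} → (¬ Lang (α ∷ʳ x) → ℓ₁ ≈ 0#) → (¬ Lang (α ∷ʳ y) → ℓ₂ ≈ 0#) →
      (Lang (α ∷ʳ x) → Lang (α ∷ʳ y) → ℓ₁ ≈ ℓ₂) → χ α y * ℓ₁ ≈ χ α x * ℓ₂
    χ-swap {α} {x} {y} ℓ₁≈0 ℓ₂≈0 ℓ₁≈ℓ₂ with Lang? (α ∷ʳ x) | Lang? (α ∷ʳ y)
    ... | yes αx∈L | yes αy∈L = *-congˡ (ℓ₁≈ℓ₂ αx∈L αy∈L)
    ... | yes αx∈L | no  αy∉L = trans (zeroˡ _) (sym (trans (*-congˡ (ℓ₂≈0 αy∉L)) (zeroʳ _)))
    ... | no  αx∉L | yes αy∈L = trans (*-congˡ (ℓ₁≈0 αx∉L)) (trans (zeroʳ _) (sym (zeroˡ _)))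
    ... | no  αx∉L | no  αy∉L = trans (zeroˡ _) (sym (zeroˡ _))

    χL-swap : ∀ {α} → Commutes α → ∀ r x y → χ α y * L (α ∷ʳ x ∷ʳ y) r ≈ χ α x * L (α ∷ʳ y ∷ʳ x) r
    χL-swap {α} comm r x y = χ-swap
      (λ αx∉L → L-outside r (λ αxy∈L → αx∉L (prefix _ y αxy∈L)))
      (λ αy∉L → L-outside r (λ αyx∈L → αy∉L (prefix _ x αyx∈L)))
      (comm r)

    A-sym : ∀ {α} → Commutes α → ∀ r z w → A α r z w ≈ A α r w z
    A-sym comm r nothing  nothing  = refl
    A-sym comm r nothing  (just x) = refl
    A-sym comm r (just x) nothing  = refl
    A-sym {α} comm r (just x) (just y) = +-cong (χL-swap comm r x y) diagonal
      where
      diagonal : 𝟙 (x ≟ y) * ∑ X (λ z → (1# - χ α z) * L (α ∷ʳ x ∷ʳ z) r) ≈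
                 𝟙 (y ≟ x) * ∑ X (λ z → (1# - χ α z) * L (α ∷ʳ y ∷ʳ z) r)
      diagonal with x ≟ y | y ≟ x
      ... | yes ≡.refl | yes _   = refl
      ... | no  _      | no  _   = trans (zeroˡ _) (sym (zeroˡ _))
      ... | yes ≡.refl | no  x≢x = ⊥-elim (x≢x ≡.refl)
      ... | no  x≢x    | yes ≡.refl = ⊥-elim (x≢x ≡.refl)

    -- The row of z in A α r, applied to v, is `row` of the child word of z, applied to the vector
    -- transferred to the child (A▹ below).
    row : Word n → ℕ → (Point → Carrier) → Carrier
    row w r v = L w r * v nothing + ∑ X (λ y → L (w ∷ʳ y) r * v (just y))

    child : Word n → Point → Word n
    child α nothing  = α
    child α (just x) = α ∷ʳ x

    -- A letter that is no continuation of α has its weight in the diagonal entry of `x`, and so it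
    -- is given the value of `v` at `x`.
    transfer : Word n → Point → (Point → Carrier) → Point → Carrier
    transfer α nothing  v z        = v z
    transfer α (just x) v nothing  = v nothing
    transfer α (just x) v (just y) = χ α y * v (just y) + (1# - χ α y) * v (just x)

    ∑-𝟙 : ∀ x (f : Fin n → Carrier) → ∑ X (λ y → 𝟙 (x ≟ y) * f y) ≈ f x
    ∑-𝟙 x f = ∑-indicator _≟_ f (Unique.allFin⁺ n) (∈-allFin x)

    A▹ : ∀ α r v z → (points ▹ A α r) v z ≈ row (child α z) r (transfer α z v)
    A▹ α r v nothing  = ∑-points _
    A▹ α r v (just x) = trans (∑-points _) (+-congˡ (begin
      ∑ X (λ y → (χ α y * ℓ y + 𝟙 (x ≟ y) * s) * v (just y))
        ≈⟨ ∑-cong X (λ y → distribʳ (v (just y)) (χ α y * ℓ y) (𝟙 (x ≟ y) * s)) ⟩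
      ∑ X (λ y → χ α y * ℓ y * v (just y) + 𝟙 (x ≟ y) * s * v (just y))
        ≈⟨ ∑-+ X _ _ ⟩
      ∑ X (λ y → χ α y * ℓ y * v (just y)) + ∑ X (λ y → 𝟙 (x ≟ y) * s * v (just y))
        ≈⟨ +-congˡ (trans (∑-cong X (λ y → *-assoc _ s _)) (trans (∑-𝟙 x (λ y → s * v (just y)))
             (sym (∑-*ʳ X (v (just x)) (λ y → (1# - χ α y) * ℓ y))))) ⟩
      ∑ X (λ y → χ α y * ℓ y * v (just y)) + ∑ X (λ y → (1# - χ α y) * ℓ y * v (just x))
        ≈⟨ ∑-+ X _ _ ⟨
      ∑ X (λ y → χ α y * ℓ y * v (just y) + (1# - χ α y) * ℓ y * v (just x))
        ≈⟨ ∑-cong X (λ y → solve 4 (λ c l a b → c :* l :* a :+ (:1 :- c) :* l :* b := l :* (c :* a :+ (:1 :- c) :* b))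
             refl (χ α y) (ℓ y) (v (just y)) (v (just x))) ⟩
      ∑ X (λ y → ℓ y * transfer α (just x) v (just y)) ∎))
      where
      ℓ = λ y → L (α ∷ʳ x ∷ʳ y) r
      s = ∑ X (λ z → (1# - χ α z) * L (α ∷ʳ x ∷ʳ z) r)

    null : Point → Carrier
    null nothing  = 1#
    null (just _) = 0#

    bilinear-null : ∀ M v → bilinear points M null v ≈ (points ▹ M) v nothing
    bilinear-null M v = trans (∑-points _) (trans
      (+-cong (*-identityˡ _) (∑-zero X (λ x → zeroˡ _))) (+-identityʳ _))

    ▹-null : ∀ M z → (points ▹ M) null z ≈ M z nothing
    ▹-null M z = trans (∑-points _) (trans
      (+-cong (*-identityʳ _) (∑-zero X (λ x → zeroʳ _))) (+-identityʳ _))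

    row-cong : ∀ w r {u v} → (∀ z → u z ≈ v z) → row w r u ≈ row w r v
    row-cong w r u≈v = +-cong (*-congˡ (u≈v nothing)) (∑-cong X (λ y → *-congˡ (u≈v (just y))))

    -- The vector 1_X + ε 1_null, which is the Perron eigenvector of the normalised matrix
    -- A α (r+1) + ε A α r.
    tilt : Carrier → Point → Carrier
    tilt ε nothing  = ε
    tilt ε (just _) = 1#

    transfer-tilt : ∀ α z ε w → transfer α z (tilt ε) w ≈ tilt ε w
    transfer-tilt α nothing  ε w        = refl
    transfer-tilt α (just x) ε nothing  = refl
    transfer-tilt α (just x) ε (just y) = solve 1 (λ c → c :* :1 :+ (:1 :- c) :* :1 := :1) refl (χ α y)

    row-tilt : ∀ w r ε → row w r (tilt ε) ≈ L w (suc r) + ε * L w r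
    row-tilt w r ε = trans (+-congˡ (∑-cong X (λ y → *-identityʳ _)))
      (trans (+-comm _ _) (+-congˡ (*-comm _ _)))

    A▹tilt : ∀ α r ε z → (points ▹ A α r) (tilt ε) z ≈ L (child α z) (suc r) + ε * L (child α z) r
    A▹tilt α r ε z = trans (A▹ α r (tilt ε) z)
      (trans (row-cong (child α z) r (transfer-tilt α z ε)) (row-tilt (child α z) r ε))

    -- The coefficient of `row w r` is the entry of `tilt ε` at the null point. For this reason the
    -- induction step perturbs `A α (suc r)` by exactly `ε` times `A α r`.
    bilinear-tilt : ∀ w r ε v → bilinear points (A w r) v (tilt ε) ≈ row w (suc r) v + ε * row w r v
    bilinear-tilt w r ε v = begin
      ∑ points (λ z → v z * (points ▹ A w r) (tilt ε) z)
        ≈⟨ ∑-cong points (λ z → trans (*-congˡ (A▹tilt w r ε z))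
             (solve 4 (λ v a e b → v :* (a :+ e :* b) := :1 :* (a :* v) :+ e :* (b :* v)) refl (v z) (L (child w z) (suc r)) ε (L (child w z) r))) ⟩
      ∑ points (λ z → 1# * (L (child w z) (suc r) * v z) + ε * (L (child w z) r * v z))
        ≈⟨ ∑-linear points 1# _ ε _ ⟩
      1# * ∑ points (λ z → L (child w z) (suc r) * v z) + ε * ∑ points (λ z → L (child w z) r * v z)
        ≈⟨ +-cong (trans (*-identityˡ _) (∑-points _)) (*-congˡ (∑-points _)) ⟩
      row w (suc r) v + ε * row w r v ∎

    bilinear-tilt-tilt : ∀ w r ε → bilinear points (A w r) (tilt ε) (tilt ε) ≈
      (L w (suc (suc r)) + ε * L w (suc r)) + ε * (L w (suc r) + ε * L w r)
    bilinear-tilt-tilt w r ε = trans (bilinear-tilt w r ε (tilt ε))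
      (+-cong (row-tilt w (suc r) ε) (*-congˡ (row-tilt w r ε)))

    B : Word n → ℕ → (Point → Carrier) → (Point → Carrier) → Carrier
    B α r = bilinear points (A α r)

    Hyperbolic : Word n → ℕ → Set (c ⊔ ℓ₂)
    Hyperbolic α r = ∀ v → B α r v v * L α r ≤ row α r v * row α r v

    B-null : ∀ {α} → Commutes α → ∀ r v → B α r v null ≈ row α r v
    B-null {α} comm r v = trans (symmetric (matrixForm points (A α r) (A-sym comm r)) v null)
      (trans (bilinear-null (A α r) v) (A▹ α r v nothing))

    B-null-null : ∀ α r → B α r null null ≈ L α r
    B-null-null α r = trans (bilinear-null (A α r) null) (▹-null (A α r) nothing)

    hyperbolicAt-null : ∀ {α r} (comm : Commutes α) → Hyperbolic α r →
      HyperbolicAt (matrixForm points (A α r) (A-sym comm r)) null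
    hyperbolicAt-null {α} {r} comm hyp v = ≤-resp (*-congˡ (sym (B-null-null α r)))
      (*-cong (sym (B-null comm r v)) (sym (B-null comm r v))) (hyp v)

    hyperbolicAt-tilt : ∀ {α r ε} (comm : Commutes α) → Hyperbolic α r → 0# < L α r → 0# < ε → ∀ v →
      B α r v v * B α r (tilt ε) (tilt ε) ≤ B α r v (tilt ε) * B α r v (tilt ε)
    hyperbolicAt-tilt {α} {r} {ε} comm hyp 0<L 0<ε = negative⇒hyperbolic F
      (hyperbolic⇒negative F (<-resp refl (sym (B-null-null α r)) 0<L) (hyperbolicAt-null comm hyp))
      (<-resp refl (sym (trans (B-null comm r (tilt ε)) (row-tilt α r ε)))
        (+-nonneg-pos (L-nonneg α (suc r)) (*-pos 0<ε 0<L)))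
      (≤-resp refl (sym (bilinear-tilt-tilt α r ε))
        (+-nonneg (+-nonneg (L-nonneg _ (suc (suc r))) (*-nonneg (<⇒≤ 0<ε) (L-nonneg _ (suc r))))
          (*-nonneg (<⇒≤ 0<ε) (+-nonneg (L-nonneg _ (suc r)) (*-nonneg (<⇒≤ 0<ε) (L-nonneg _ r))))))
      where F = matrixForm points (A α r) (A-sym comm r)

    -- Hyperbolicity from that of the children.

    Pull : Word n → ℕ → Set (c ⊔ ℓ₂)
    Pull α r = ∀ v → B α (suc r) v v ≤
      ∑ X (λ x → B (α ∷ʳ x) r (transfer α (just x) v) (transfer α (just x) v))

    -- The summand `1#` keeps the constant positive when `d` is zero.
    bounded-ratio : ∀ {a d} → 0# ≤ d → 0# < a → ∃[ K ] 0# < K × d ≤ K * a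
    bounded-ratio {a} {d} 0≤d 0<a = d * i + 1# , +-nonneg-pos (*-nonneg 0≤d (<⇒≤ 0<i)) 0<1 ,
      ≤-by (trans (solve 3 (λ d i a → (d :* i :+ :1) :* a :- d := d :* (a :* i) :- d :+ a) refl d i a)
             (trans (+-congʳ (trans (+-congʳ (trans (*-congˡ (recip-inverse a 0<a)) (*-identityʳ d))) (-‿inverseʳ d)))
               (+-identityˡ a)))
        (<⇒≤ 0<a)
      where
      i = recip a 0<a
      0<i = recip-pos a 0<a

    module Step {α : Word n} {r : ℕ} (α∈L : Lang α) (pull : Pull α r)
      (comm : ∀ z → Lang (child α z) → Commutes (child α z))
      (hyp  : ∀ z → Lang (child α z) → Hyperbolic (child α z) r)
      (pos  : ∀ z → Lang (child α z) → 0# < L (child α z) r)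
      where

      module Tilted {ε : Carrier} (0<ε : 0# < ε) where

        h : Point → Carrier
        h = tilt ε

        0<h : ∀ z → 0# < h z
        0<h nothing  = 0<ε
        0<h (just _) = 0<1

        M : Point → Point → Carrier
        M z w = A α (suc r) z w + ε * A α r z w

        M-sym : ∀ z w → M z w ≈ M w z
        M-sym z w = +-cong (A-sym (comm nothing α∈L) (suc r) z w) (*-congˡ (A-sym (comm nothing α∈L) r z w))

        M-nonneg : ∀ z w → 0# ≤ M z w
        M-nonneg z w = +-nonneg (A-nonneg α (suc r) z w) (*-nonneg (<⇒≤ 0<ε) (A-nonneg α r z w))

        ▹-split : ∀ v z → (points ▹ M) v z ≈ (points ▹ A α (suc r)) v z + ε * (points ▹ A α r) v z
        ▹-split v z = trans (∑-cong points (λ w →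
            solve 4 (λ a e b v → (a :+ e :* b) :* v := :1 :* (a :* v) :+ e :* (b :* v)) refl (A α (suc r) z w) ε (A α r z w) (v w)))
          (trans (∑-linear points 1# _ ε _) (+-congʳ (*-identityˡ _)))

        bilinear-split : ∀ u v → bilinear points M u v ≈ B α (suc r) u v + ε * B α r u v
        bilinear-split u v = trans (∑-cong points (λ z → trans (*-congˡ (▹-split v z))
            (solve 4 (λ u a e b → u :* (a :+ e :* b) := :1 :* (u :* a) :+ e :* (u :* b)) refl (u z) _ ε _)))
          (trans (∑-linear points 1# _ ε _) (+-congʳ (*-identityˡ _)))

        M▹ : ∀ v z → (points ▹ M) v z ≈ B (child α z) r (transfer α z v) h
        M▹ v z = trans (▹-split v z) (trans
          (+-cong (A▹ α (suc r) v z) (*-congˡ (A▹ α r v z)))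
          (sym (bilinear-tilt (child α z) r ε (transfer α z v))))

        Bh : Point → Carrier
        Bh z = B (child α z) r h h

        0<Bh : ∀ z → Lang (child α z) → 0# < Bh z
        0<Bh z z∈L = <-resp refl (sym (bilinear-tilt-tilt (child α z) r ε))
          (+-nonneg-pos (+-nonneg (L-nonneg _ (suc (suc r))) (*-nonneg (<⇒≤ 0<ε) (L-nonneg _ (suc r))))
            (*-pos 0<ε (+-nonneg-pos (L-nonneg _ (suc r)) (*-pos 0<ε (pos z z∈L)))))

        M▹h : ∀ z → (points ▹ M) h z ≈ Bh z
        M▹h z = trans (M▹ h z) (bilinear-cong points (A (child α z) r) (transfer-tilt α z ε) (λ _ → refl))

        B-outside : ∀ {w} → ¬ Lang w → ∀ u v → B w r u v ≈ 0#
        B-outside {w} w∉L u v = ∑-zero points (λ z → trans (*-congˡ (trans (A▹ w r v z)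
            (row-outside (λ z∈L → w∉L (child⇒parent z z∈L)) (transfer w z v)))) (zeroʳ _))
          where
          row-outside : ∀ {w} → ¬ Lang w → ∀ v → row w r v ≈ 0#
          row-outside w∉L v = trans (+-cong (trans (*-congʳ (L-outside r w∉L)) (zeroˡ _))
            (∑-zero X (λ y → trans (*-congʳ (L-outside r (λ wy∈L → w∉L (prefix _ y wy∈L)))) (zeroˡ _)))) (+-identityˡ 0#)
          child⇒parent : ∀ z → Lang (child w z) → Lang w
          child⇒parent nothing  w∈L  = w∈L
          child⇒parent (just y) wy∈L = prefix w y wy∈L

        -- Multiplying rows and columns by `h` moves the Perron vector from `h` to `𝟏`, the case
        -- treated by `negativeOn⊥𝟏`.
        W : Point → Point → Carrier
        W z w = h z * M z w * h w

        W-sym : ∀ z w → W z w ≈ W w z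
        W-sym z w = trans (*-congʳ (*-congˡ (M-sym z w)))
          (solve 3 (λ a m b → a :* m :* b := b :* m :* a) refl (h z) (M w z) (h w))

        W-nonneg : ∀ z w → 0# ≤ W z w
        W-nonneg z w = *-nonneg (*-nonneg (<⇒≤ (0<h z)) (M-nonneg z w)) (<⇒≤ (0<h w))

        scaled : (Point → Carrier) → Point → Carrier
        scaled u z = h z * u z

        W▹ : ∀ u z → (points ▹ W) u z ≈ h z * (points ▹ M) (scaled u) z
        W▹ u z = trans (∑-cong points (λ w →
            solve 4 (λ a m b u → a :* m :* b :* u := a :* (m :* (b :* u))) refl (h z) (M z w) (h w) (u w)))
          (∑-*ˡ points (h z) _)

        degree≈ : ∀ z → degree points W W-sym W-nonneg z ≈ h z * Bh z
        degree≈ z = trans (∑-cong points (λ w → *-assoc (h z) (M z w) (h w)))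
          (trans (∑-*ˡ points (h z) _) (*-congˡ (M▹h z)))

        W▹≈ : ∀ u z → (points ▹ W) u z ≈ h z * B (child α z) r (transfer α z (scaled u)) h
        W▹≈ u z = trans (W▹ u z) (*-congˡ (M▹ (scaled u) z))

        -- Off the language the degree and the whole row vanish, so that `P-spec` holds there with
        -- any value.
        degree⁻¹ : Point → Carrier
        degree⁻¹ z with Lang? (child α z)
        ... | yes z∈L = recip (h z * Bh z) (*-pos (0<h z) (0<Bh z z∈L))
        ... | no  _   = 0#

        P : (Point → Carrier) → Point → Carrier
        P u z = degree⁻¹ z * (points ▹ W) u z

        P-spec : ∀ u z → degree points W W-sym W-nonneg z * P u z ≈ (points ▹ W) u z
        P-spec u z with Lang? (child α z)
        ... | yes z∈L = trans (sym (*-assoc _ _ _)) (trans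
          (*-congʳ (trans (*-congʳ (degree≈ z)) (recip-inverse _ (*-pos (0<h z) (0<Bh z z∈L))))) (*-identityˡ _))
        ... | no  z∉L = trans (*-congˡ (zeroˡ _)) (trans (zeroʳ _)
          (sym (trans (W▹≈ u z) (trans (*-congˡ (B-outside z∉L _ _)) (zeroʳ _)))))

        -- On the language `P u z` is the quotient of B(t,h) by B(h,h), so the right side is `h z`
        -- times B(t,h)²/B(h,h), and the bound is the hyperbolicity of the child at `h`.
        child-bound : ∀ u z →
          h z * B (child α z) r (transfer α z (scaled u)) (transfer α z (scaled u)) ≤
          degree points W W-sym W-nonneg z * (P u z * P u z)
        child-bound u z = go (Lang? (child α z))
          where
          d = degree points W W-sym W-nonneg z
          t = transfer α z (scaled u)
          Bt = B (child α z) r t t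
          go : Dec (Lang (child α z)) → h z * Bt ≤ d * (P u z * P u z)
          go (no z∉L)  = ≤-trans (≤-reflexive (trans (*-congˡ (B-outside z∉L t t)) (zeroʳ _)))
            (*-nonneg (≤-resp refl (sym (degree≈ z)) (≤-reflexive (sym (trans (*-congˡ (B-outside z∉L h h)) (zeroʳ _)))))
              (square-nonneg _))
          go (yes z∈L) = *-cancelˡ-≤ 0<d (≤-resp left right
            (*-monoʳ-≤ (square-nonneg (h z)) (hyperbolicAt-tilt (comm z z∈L) (hyp z z∈L) (pos z z∈L) 0<ε t)))
            where
            0<d : 0# < d
            0<d = <-resp refl (sym (degree≈ z)) (*-pos (0<h z) (0<Bh z z∈L))
            left : h z * h z * (Bt * Bh z) ≈ d * (h z * Bt)
            left = trans (solve 3 (λ h a b → h :* h :* (a :* b) := h :* b :* (h :* a)) refl (h z) Bt (Bh z))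
              (*-congʳ (sym (degree≈ z)))
            right : h z * h z * (B (child α z) r t h * B (child α z) r t h) ≈ d * (d * (P u z * P u z))
            right = begin
              h z * h z * (B (child α z) r t h * B (child α z) r t h)
                ≈⟨ solve 2 (λ h b → h :* h :* (b :* b) := (h :* b) :* (h :* b)) refl (h z) _ ⟩
              (h z * B (child α z) r t h) * (h z * B (child α z) r t h)
                ≈⟨ *-cong step step ⟨
              (d * P u z) * (d * P u z)
                ≈⟨ solve 2 (λ d p → (d :* p) :* (d :* p) := d :* (d :* (p :* p))) refl d (P u z) ⟩
              d * (d * (P u z * P u z)) ∎
              where step = trans (P-spec u z) (W▹≈ u z)

        -- `Pull` bounds the part at level `suc r` by the children at the letters. The part with the
        -- factor `ε` is itself the term of the null point, whose child is α and where `h` equals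
        -- `ε`.
        pullᵂ : ∀ u → bilinear points W u u ≤ ∑ points (λ z → degree points W W-sym W-nonneg z * (P u z * P u z))
        pullᵂ u = ≤-trans (≤-reflexive W≈M) (≤-trans M≤ (∑-mono points (child-bound u)))
          where
          v = scaled u
          W≈M : bilinear points W u u ≈ B α (suc r) v v + ε * B α r v v
          W≈M = trans (∑-cong points (λ z → trans (*-congˡ (W▹ u z))
              (solve 3 (λ u h m → u :* (h :* m) := h :* u :* m) refl (u z) (h z) _)))
            (bilinear-split v v)
          M≤ : B α (suc r) v v + ε * B α r v v ≤
            ∑ points (λ z → h z * B (child α z) r (transfer α z v) (transfer α z v))
          M≤ = ≤-by
            (trans (+-congʳ (trans (∑-points _) (+-congˡ (∑-cong X (λ x → *-identityˡ _)))))
              (solve 3 (λ a b s → (a :+ s) :- (b :+ a) := s :- b) refl (ε * B α r v v) (B α (suc r) v v) _))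
            (0≤y-x (pull v))

        negative : ∀ v → bilinear points M v h ≈ 0# → bilinear points M v v ≤ 0#
        negative v v⊥h = ≤-resp (trans W≈M (bilinear-cong points M scaled-u scaled-u)) refl
          (negativeOn⊥𝟏 points W W-sym W-nonneg P P-spec pullᵂ (∈-points nothing) 0<K degree≤ u u⊥𝟏)
          where
          h⁻¹ : Point → Carrier
          h⁻¹ z = recip (h z) (0<h z)
          u : Point → Carrier
          u z = h⁻¹ z * v z
          scaled-u : ∀ z → scaled u z ≈ v z
          scaled-u z = trans (sym (*-assoc _ _ _)) (trans (*-congʳ (recip-inverse (h z) (0<h z))) (*-identityˡ _))
          W≈M : bilinear points W u u ≈ bilinear points M (scaled u) (scaled u)
          W≈M = ∑-cong points (λ z → trans (*-congˡ (W▹ u z))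
              (solve 3 (λ u h m → u :* (h :* m) := h :* u :* m) refl (u z) (h z) _))
          u⊥𝟏 : ∑ points (λ z → degree points W W-sym W-nonneg z * u z) ≈ 0#
          u⊥𝟏 = trans (∑-cong points (λ z → begin
              degree points W W-sym W-nonneg z * u z ≈⟨ *-congʳ (degree≈ z) ⟩
              h z * Bh z * u z                       ≈⟨ solve 3 (λ h b u → h :* b :* u := h :* u :* b) refl (h z) (Bh z) (u z) ⟩
              h z * u z * Bh z                       ≈⟨ *-cong (scaled-u z) (sym (M▹h z)) ⟩
              v z * (points ▹ M) h z                 ∎)) v⊥h
          ratio : ∀ z → ∃[ K ] 0# < K × degree points W W-sym W-nonneg z ≤ K * W nothing z
          ratio z with Lang? (child α z)
          ... | no  z∉L = 1# , 0<1 , ≤-trans (≤-reflexive (trans (degree≈ z) (trans (*-congˡ (B-outside z∉L h h)) (zeroʳ _))))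
            (*-nonneg (<⇒≤ 0<1) (W-nonneg nothing z))
          ... | yes z∈L = bounded-ratio (∑-nonneg points (W-nonneg z)) (*-pos (*-pos 0<ε (0<M z z∈L)) (0<h z))
            where
            0<M : ∀ z → Lang (child α z) → 0# < M nothing z
            0<M nothing  z∈L = +-nonneg-pos (L-nonneg _ (suc r)) (*-pos 0<ε (pos nothing z∈L))
            0<M (just x) z∈L = +-nonneg-pos (L-nonneg _ (suc r)) (*-pos 0<ε (pos (just x) z∈L))
          K = ∑ points (λ z → proj₁ (ratio z))
          0≤ratio : ∀ z → 0# ≤ proj₁ (ratio z)
          0≤ratio z = <⇒≤ (proj₁ (proj₂ (ratio z)))
          0<K : 0# < K
          0<K = <-≤-trans (proj₁ (proj₂ (ratio nothing))) (term≤∑ 0≤ratio (∈-points nothing))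
          degree≤ : ∀ z → degree points W W-sym W-nonneg z ≤ K * W nothing z
          degree≤ z = ≤-trans (proj₂ (proj₂ (ratio z)))
            (≤-resp (*-comm _ _) (*-comm _ _) (*-monoʳ-≤ (W-nonneg nothing z) (term≤∑ 0≤ratio (∈-points z))))

        0≤tilted : ∀ v → 0# ≤
          (row α (suc r) v + ε * row α r v) * (row α (suc r) v + ε * row α r v)
          - (B α (suc r) v v + ε * B α r v v) * (L α (suc r) + ε * L α r)
        0≤tilted v = ≤-resp refl
          (+-cong (*-cong Bv Bv) (-‿cong (*-cong (bilinear-split v v) Bnull)))
          (0≤y-x (negative⇒hyperbolic F negative 0<Bnh (≤-resp refl (sym Bnull) (<⇒≤ 0<Bnull)) v))
          where
          comm-α = comm nothing α∈L
          F = matrixForm points M M-sym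
          Bv : bilinear points M v null ≈ row α (suc r) v + ε * row α r v
          Bv = trans (bilinear-split v null) (+-cong (B-null comm-α (suc r) v) (*-congˡ (B-null comm-α r v)))
          Bnull : bilinear points M null null ≈ L α (suc r) + ε * L α r
          Bnull = trans (bilinear-split null null) (+-cong (B-null-null α (suc r)) (*-congˡ (B-null-null α r)))
          0<Bnull : 0# < L α (suc r) + ε * L α r
          0<Bnull = +-nonneg-pos (L-nonneg α (suc r)) (*-pos 0<ε (pos nothing α∈L))
          0<Bnh : 0# < bilinear points M null h
          0<Bnh = <-resp refl (sym (trans (bilinear-null M h) (M▹h nothing))) (0<Bh nothing α∈L)

      -- The inequality for M is quadratic in ε, and its constant term is the inequality for
      -- `A α (suc r)`.
      hyperbolic-suc : Hyperbolic α (suc r)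
      hyperbolic-suc v = ≤-by refl (nonneg-at-0 (λ ε 0<ε → ≤-resp refl
        (solve 7 (λ e a a′ b b′ l l′ →
          (a :+ e :* a′) :* (a :+ e :* a′) :- (b :+ e :* b′) :* (l :+ e :* l′) :=
          a :* a :- b :* l :+ e :* ((:2 :* a :* a′ :- b :* l′ :- b′ :* l) :+ e :* (a′ :* a′ :- b′ :* l′)))
          refl ε (row α (suc r) v) (row α r v) (B α (suc r) v v) (B α r v v) (L α (suc r)) (L α r))
        (Tilted.0≤tilted 0<ε v)))

    -- The inequality `Pull`.

    ∑³ : (Fin n → Fin n → Fin n → Carrier) → Carrier
    ∑³ f = ∑ X (λ x → ∑ X (λ y → ∑ X (λ z → f x y z)))

    ∑³-cong : ∀ {f g} → (∀ x y z → f x y z ≈ g x y z) → ∑³ f ≈ ∑³ g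
    ∑³-cong f≈g = ∑-cong X (λ x → ∑-cong X (λ y → ∑-cong X (f≈g x y)))

    ∑³-+ : ∀ f g → ∑³ (λ x y z → f x y z + g x y z) ≈ ∑³ f + ∑³ g
    ∑³-+ f g = trans (∑-cong X (λ x → trans (∑-cong X (λ y → ∑-+ X (f x y) (g x y))) (∑-+ X _ _))) (∑-+ X _ _)

    ∑³-minus : ∀ f g → ∑³ (λ x y z → f x y z - g x y z) ≈ ∑³ f - ∑³ g
    ∑³-minus f g = trans (∑-cong X (λ x → trans (∑-cong X (λ y → ∑-minus X (f x y) (g x y))) (∑-minus X _ _))) (∑-minus X _ _)

    ∑³-* : ∀ k f → ∑³ (λ x y z → k * f x y z) ≈ k * ∑³ f
    ∑³-* k f = trans (∑-cong X (λ x → trans (∑-cong X (λ y → ∑-*ˡ X k (f x y))) (∑-*ˡ X k _))) (∑-*ˡ X k _)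

    ∑³-swap₁₂ : ∀ f → ∑³ f ≈ ∑³ (λ x y z → f y x z)
    ∑³-swap₁₂ f = ∑-swap X X (λ x y → ∑ X (f x y))

    ∑³-swap₂₃ : ∀ f → ∑³ f ≈ ∑³ (λ x y z → f x z y)
    ∑³-swap₂₃ f = ∑-cong X (λ x → ∑-swap X X (f x))

    ∑³-swap₁₃ : ∀ f → ∑³ f ≈ ∑³ (λ x y z → f z y x)
    ∑³-swap₁₃ f = trans (∑³-swap₁₂ f) (trans (∑³-swap₂₃ _) (∑³-swap₁₂ _))

    x≈-x⇒x≈0 : ∀ {x} → x ≈ - x → x ≈ 0#
    x≈-x⇒x≈0 {x} x≈-x = *-cancelˡ-≈ 0<2 (begin
      (1# + 1#) * x   ≈⟨ solve 1 (λ x → :2 :* x := x :+ x) refl x ⟩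
      x + x           ≈⟨ +-congˡ x≈-x ⟩
      x - x           ≈⟨ solve 1 (λ x → x :- x := :2 :* :0) refl x ⟩
      (1# + 1#) * 0#  ∎)

    𝟙-¬ : ∀ {p} {P : Set p} (P? : Dec P) → 𝟙 (¬? P?) ≈ 1# - 𝟙 P?
    𝟙-¬ (yes _) = sym (-‿inverseʳ 1#)
    𝟙-¬ (no _)  = solve 0 (:1 := :1 :- :0) refl

    𝟙-× : ∀ {p q} {P : Set p} {Q : Set q} (P? : Dec P) (Q? : Dec Q) → 𝟙 (P? ×-dec Q?) ≈ 𝟙 P? * 𝟙 Q?
    𝟙-× (yes _) (yes _) = sym (*-identityˡ _)
    𝟙-× (yes _) (no _)  = sym (*-identityˡ _)
    𝟙-× (no _)  (yes _) = sym (zeroˡ _)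
    𝟙-× (no _)  (no _)  = sym (zeroˡ _)

    SwapsPrefix : Word n → ℕ → Set ℓ₁
    SwapsPrefix α r = ∀ {x y} z → Lang (α ∷ʳ x) → Lang (α ∷ʳ y) →
      L (α ∷ʳ x ∷ʳ y ∷ʳ z) r ≈ L (α ∷ʳ y ∷ʳ x ∷ʳ z) r

    ∷ʳ-∷ʳ-∷ʳ : ∀ (α : Word n) x y z → α ∷ʳ x ∷ʳ y ∷ʳ z ≡ α ++ x ∷ y ∷ z ∷ []
    ∷ʳ-∷ʳ-∷ʳ α x y z = ≡.trans (++-assoc (α ∷ʳ x) (y ∷ []) (z ∷ [])) (++-assoc α (x ∷ []) (y ∷ z ∷ []))

    interval-∷ʳ : IsInterval G → ∀ α x y z →
      Lang (α ∷ʳ z) → Lang (α ∷ʳ x ∷ʳ y ∷ʳ z) → Lang (α ∷ʳ x ∷ʳ z)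
    interval-∷ʳ interval α x y z αz∈L αxyz∈L = ≡.subst Lang (≡.sym (∷ʳ-∷ʳ α x z))
      (interval α (x ∷ []) (y ∷ []) z αz∈L (≡.subst Lang (∷ʳ-∷ʳ-∷ʳ α x y z) αxyz∈L))

    -- Over pairs of continuations of α, reading `v` at `y` or at `x` gives the same sum, since αxy
    -- and αyx have equal weights. On the other pairs `transfer` already reads `v` at `x`.
    ∑-transfer : ∀ {α} → Commutes α → ∀ r v →
      ∑ X (λ x → ∑ X (λ y → L (α ∷ʳ x ∷ʳ y) r * transfer α (just x) v (just y))) ≈
      ∑ X (λ x → L (α ∷ʳ x) (suc r) * v (just x))
    ∑-transfer {α} comm r v = begin
      ∑ X (λ x → ∑ X (λ y → ℓ x y * (χ α y * u y + (1# - χ α y) * u x)))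
        ≈⟨ ∑-cong X (λ x → trans (∑-cong X (λ y →
             solve 4 (λ l c a b → l :* (c :* a :+ (:1 :- c) :* b) := (c :* l :* a :- c :* l :* b) :+ l :* b)
               refl (ℓ x y) (χ α y) (u y) (u x)))
             (trans (∑-+ X _ _) (+-cong (∑-minus X _ _) (∑-*ʳ X (u x) (ℓ x))))) ⟩
      ∑ X (λ x → (∑ X (λ y → χ α y * ℓ x y * u y) - ∑ X (λ y → χ α y * ℓ x y * u x)) + L (α ∷ʳ x) (suc r) * u x)
        ≈⟨ trans (∑-+ X _ _) (+-congʳ (∑-minus X _ _)) ⟩
      (∑ X (λ x → ∑ X (λ y → χ α y * ℓ x y * u y)) - ∑ X (λ x → ∑ X (λ y → χ α y * ℓ x y * u x))) + S
        ≈⟨ +-congʳ (x≈y⇒x-y≈0 (trans (∑-swap X X (λ x y → χ α y * ℓ x y * u y))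
             (∑-cong X (λ y → ∑-cong X (λ x → *-congʳ (χL-swap comm r x y)))))) ⟩
      0# + S ≈⟨ +-identityˡ S ⟩
      S ∎
      where
      u = λ x → v (just x)
      ℓ = λ x y → L (α ∷ʳ x ∷ʳ y) r
      S = ∑ X (λ x → L (α ∷ʳ x) (suc r) * u x)

    repeated∉L : ∀ α x → ¬ Lang (α ∷ʳ x ∷ʳ x)
    repeated∉L α x αxx∈L = go α (≡.subst Unique (∷ʳ-∷ʳ α x x) (simple αxx∈L))
      where
      go : ∀ α → ¬ Unique (α ++ x ∷ x ∷ [])
      go []      ((x≢x ∷ []) ∷ _) = x≢x ≡.refl
      go (_ ∷ α) (_ ∷ unique)     = go α unique

    module PullProof (interval : IsInterval G) {α : Word n} {r : ℕ}
      (comm  : Commutes α)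
      (comm′ : ∀ x → Lang (α ∷ʳ x) → Commutes (α ∷ʳ x))
      (swaps : SwapsPrefix α r)
      (scales : ScaleSequence ℝ G) (paMon : PAMon ℝ G Q scales α)
      where

      ℓ : Fin n → Fin n → Fin n → Carrier
      ℓ x y z = L (α ∷ʳ x ∷ʳ y ∷ʳ z) r

      ℓ-outside₁ : ∀ {x y z} → ¬ Lang (α ∷ʳ x) → ℓ x y z ≈ 0#
      ℓ-outside₁ αx∉L = L-outside r (λ αxyz∈L → αx∉L (prefix _ _ (prefix _ _ αxyz∈L)))

      ℓ-outside₂ : ∀ {x y z} → ¬ Lang (α ∷ʳ x ∷ʳ y) → ℓ x y z ≈ 0#
      ℓ-outside₂ αxy∉L = L-outside r (λ αxyz∈L → αxy∉L (prefix _ _ αxyz∈L))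

      ℓ-interval : ∀ {x y z} → Lang (α ∷ʳ z) → ¬ Lang (α ∷ʳ x ∷ʳ z) → ℓ x y z ≈ 0#
      ℓ-interval αz∈L αxz∉L = L-outside r (λ αxyz∈L → αxz∉L (interval-∷ʳ interval α _ _ _ αz∈L αxyz∈L))

      ℓ-swap₁₂ : ∀ x y z → χ α y * ℓ x y z ≈ χ α x * ℓ y x z
      ℓ-swap₁₂ x y z = χ-swap ℓ-outside₁ ℓ-outside₁ (swaps z)

      χ₁ : Fin n → Carrier
      χ₁ = χ α

      i : Fin n → Fin n → Carrier
      i x z = χ (α ∷ʳ x) z

      -- Only `y` is known to be a continuation of α. If αxzy is in the language, then so is αxy by
      -- the interval property, and `y` and `z` commute after αx. The factor `i x z` removes the
      -- words αxyz for which αxz is not in the language.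
      ℓ-swap₂₃ : ∀ x y z → Lang (α ∷ʳ y) → ℓ x z y ≈ i x z * ℓ x y z
      ℓ-swap₂₃ x y z αy∈L with Lang? (α ∷ʳ x ∷ʳ z) | Lang? (α ∷ʳ x ∷ʳ y)
      ... | no αxz∉L | _ = trans (ℓ-outside₂ αxz∉L) (sym (zeroˡ _))
      ... | yes αxz∈L | yes αxy∈L = trans (comm′ x (prefix _ z αxz∈L) r αxz∈L αxy∈L) (sym (*-identityˡ _))
      ... | yes αxz∈L | no  αxy∉L = trans (ℓ-interval αy∈L αxy∉L)
        (sym (trans (*-congˡ (ℓ-outside₂ αxy∉L)) (zeroʳ _)))

      ℓ-swap₂₃′ : ∀ x y z → Lang (α ∷ʳ y) → Lang (α ∷ʳ z) → ℓ x z y ≈ ℓ x y z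
      ℓ-swap₂₃′ x y z αy∈L αz∈L = trans (ℓ-swap₂₃ x y z αy∈L) (absorb (Lang? (α ∷ʳ x ∷ʳ z)))
        where
        absorb : (αxz? : Dec (Lang (α ∷ʳ x ∷ʳ z))) → 𝟙 αxz? * ℓ x y z ≈ ℓ x y z
        absorb (yes _)    = *-identityˡ _
        absorb (no αxz∉L) = trans (zeroˡ _) (sym (ℓ-interval αz∈L αxz∉L))

      -- Exchanging the outer letters takes three adjacent exchanges, all of them allowed when the
      -- three letters are continuations of α.
      ℓ-swap₁₃ : ∀ x y z → χ₁ y * (χ₁ z * ℓ x y z) ≈ χ₁ y * (χ₁ x * ℓ z y x)
      ℓ-swap₁₃ x y z = 𝟙*-cong (Lang? (α ∷ʳ y)) (λ αy∈L → χ-swap ℓ-outside₁ ℓ-outside₁ (λ αx∈L αz∈L →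
        trans (swaps z αx∈L αy∈L) (trans (ℓ-swap₂₃′ y z x αz∈L αx∈L) (swaps x αy∈L αz∈L))))

      -- For 0/1 values i and j the difference (1-i)(1-j) - ij of the indicators in Pas and Act is
      -- 1-i-j, so for distinct continuations this is `PAMon`. In the remaining cases `χ₁ y` or
      -- every `ℓ x y z` is zero.
      0≤∑weight : ∀ x y → 0# ≤ ∑ X (λ z → χ₁ y * ℓ x y z * ((1# - χ₁ z) * (1# - i x z - i y z)))
      0≤∑weight x y with Lang? (α ∷ʳ x) | Lang? (α ∷ʳ y) | x ≟ y
      ... | no αx∉L | _ | _ = ≤-reflexive (sym (∑-zero X (λ z →
        trans (*-congʳ (trans (*-congˡ (ℓ-outside₁ αx∉L)) (zeroʳ _))) (zeroˡ _))))
      ... | yes _ | no _ | _ = ≤-reflexive (sym (∑-zero X (λ z → trans (*-congʳ (zeroˡ _)) (zeroˡ _))))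
      ... | yes _ | yes _ | yes ≡.refl = ≤-reflexive (sym (∑-zero X (λ z →
        trans (*-congʳ (trans (*-congˡ (ℓ-outside₂ (repeated∉L α x))) (zeroʳ _))) (zeroˡ _))))
      ... | yes αx∈L | yes αy∈L | no x≢y = ≤-resp refl (sym (begin
          ∑ X (λ z → 1# * ℓ x y z * ((1# - χ₁ z) * (1# - i x z - i y z)))
            ≈⟨ ∑-cong X (λ z → solve 4 (λ l c i j → :1 :* l :* ((:1 :- c) :* (:1 :- i :- j)) :=
                 (:1 :- c) :* ((:1 :- i) :* ((:1 :- j) :* l)) :- (:1 :- c) :* (i :* (j :* l))) refl (ℓ x y z) (χ₁ z) (i x z) (i y z)) ⟩
          ∑ X (λ z → (1# - χ₁ z) * ((1# - i x z) * ((1# - i y z) * ℓ x y z)) - (1# - χ₁ z) * (i x z * (i y z * ℓ x y z)))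
            ≈⟨ ∑-minus X _ _ ⟩
          ∑ X (λ z → (1# - χ₁ z) * ((1# - i x z) * ((1# - i y z) * ℓ x y z))) - ∑ X (λ z → (1# - χ₁ z) * (i x z * (i y z * ℓ x y z)))
            ≈⟨ +-cong (sym Pas≈) (-‿cong (sym Act≈)) ⟩
          ∑ (Pas G α x y) Λ - ∑ (Act G α x y) Λ ∎))
        (0≤y-x (paMon (∈-Cont αx∈L) (∈-Cont αy∈L) x≢y r))
        where
        Λ = λ z → Lqα ℝ G Q (α ++ x ∷ y ∷ z ∷ []) r
        Λ≈ : ∀ z → 𝟙 (Lang? (α ++ x ∷ y ∷ z ∷ [])) * Λ z ≈ ℓ x y z
        Λ≈ z with Lang? (α ++ x ∷ y ∷ z ∷ [])
        ... | yes _ = trans (*-identityˡ _) (trans (Lqα≈L _ r) (reflexive (≡.cong (λ w → L w r) (≡.sym (∷ʳ-∷ʳ-∷ʳ α x y z)))))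
        ... | no αxyz∉L = trans (zeroˡ _) (sym (L-outside r (λ w∈L → αxyz∉L (≡.subst Lang (∷ʳ-∷ʳ-∷ʳ α x y z) w∈L))))
        i≈ : ∀ x z → 𝟙 (Lang? (α ++ x ∷ z ∷ [])) ≈ i x z
        i≈ x z = 𝟙-cong (Lang? _) (Lang? _) (≡.subst Lang (≡.sym (∷ʳ-∷ʳ α x z))) (≡.subst Lang (∷ʳ-∷ʳ α x z))
        i¬≈ : ∀ x z → 𝟙 (¬? (Lang? (α ++ x ∷ z ∷ []))) ≈ 1# - i x z
        i¬≈ x z = trans (𝟙-¬ (Lang? _)) (+-congˡ (-‿cong (i≈ x z)))
        peel : ∀ {p q} {P : Set p} {Q : Set q} (P? : Dec P) (Q? : Dec Q) {a b f} →
          𝟙 P? ≈ a → 𝟙 Q? * f ≈ b → 𝟙 (P? ×-dec Q?) * f ≈ a * b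
        peel P? Q? P≈ Q≈ = trans (*-congʳ (𝟙-× P? Q?)) (trans (*-assoc _ _ _) (*-cong P≈ Q≈))
        Pas≈ : ∑ (Pas G α x y) Λ ≈ ∑ X (λ z → (1# - χ₁ z) * ((1# - i x z) * ((1# - i y z) * ℓ x y z)))
        Pas≈ = trans (∑-filter _ X Λ) (∑-cong X (λ z →
          peel (¬? (Lang? (α ∷ʳ z))) _ (𝟙-¬ (Lang? (α ∷ʳ z)))
            (peel (¬? (Lang? (α ++ x ∷ z ∷ []))) _ (i¬≈ x z) (peel (¬? (Lang? (α ++ y ∷ z ∷ []))) _ (i¬≈ y z) (Λ≈ z)))))
        Act≈ : ∑ (Act G α x y) Λ ≈ ∑ X (λ z → (1# - χ₁ z) * (i x z * (i y z * ℓ x y z)))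
        Act≈ = trans (∑-filter _ X Λ) (∑-cong X (λ z →
          peel (¬? (Lang? (α ∷ʳ z))) _ (𝟙-¬ (Lang? (α ∷ʳ z)))
            (peel (Lang? (α ++ x ∷ z ∷ [])) _ (i≈ x z) (peel (Lang? (α ++ y ∷ z ∷ [])) _ (i≈ y z) (Λ≈ z)))))

      module _ (v : Point → Carrier) where

        u : Fin n → Carrier
        u x = v (just x)

        T : Fin n → Fin n → Carrier
        T x y = transfer α (just x) v (just y)

        T₂ : Fin n → Fin n → Fin n → Carrier
        T₂ x y z = transfer (α ∷ʳ x) (just y) (transfer α (just x) v) (just z)

        -- The difference of the two sides of `Pull` is ∑³ F.  The part Fᵃ is antisymmetric in x and z,
        -- Fᶜ becomes Fᶜ′ on exchanging y and z, and symmetrising Fᵇ + Fᶜ′ in x and y leaves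
        -- (u x - u y)² times the difference of the sums over Pas and Act.
        F Fᵃ Fᵇ Fᶜ Fᶜ′ E : Fin n → Fin n → Fin n → Carrier
        F   x y z = T x y * (ℓ x y z * T₂ x y z) - u x * (ℓ x y z * T x y)
        Fᵃ  x y z = χ₁ y * (χ₁ z * ℓ x y z) * (u y * (u z - u x))
        Fᵇ  x y z = χ₁ y * ℓ x y z * ((1# - χ₁ z) * (1# - i x z) * (u y * (u y - u x)))
        Fᶜ  x y z = (1# - χ₁ y) * (χ₁ z * ℓ x y z) * (u x * (u z - u x))
        Fᶜ′ x y z = χ₁ y * ℓ x y z * ((1# - χ₁ z) * i x z * (u x * (u y - u x)))
        E   x y z = Fᵇ x y z + Fᶜ′ x y z

        -- Expansion leaves two remainders. One contains `χ₁ z * ((1# - i x z) * ℓ x y z)`, which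
        -- the interval property makes zero; the other contains `χ₁ y * χ₁ y - χ₁ y`, zero for an
        -- indicator.
        F-split : ∀ x y z → F x y z ≈ Fᵃ x y z + (Fᵇ x y z + Fᶜ x y z)
        F-split x y z = trans
          (solve 7 (λ l y z i a b d →
            (y :* b :+ (:1 :- y) :* a) :* (l :* (i :* (z :* d :+ (:1 :- z) :* a) :+ (:1 :- i) :* (y :* b :+ (:1 :- y) :* a)))
              :- a :* (l :* (y :* b :+ (:1 :- y) :* a)) :=
            (y :* (z :* l) :* (b :* (d :- a)) :+ (y :* l :* ((:1 :- z) :* (:1 :- i) :* (b :* (b :- a)))
              :+ (:1 :- y) :* (z :* l) :* (a :* (d :- a))))
            :+ (z :* ((:1 :- i) :* l) :* (y :* b :* (b :- a) :- (d :- a) :* (y :* b :+ (:1 :- y) :* a))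
              :+ (y :* y :- y) :* (l :* (:1 :- i) :* (b :- a) :* (b :- a))))
            refl (ℓ x y z) (χ₁ y) (χ₁ z) (i x z) (u x) (u y) (u z))
          (trans (+-congˡ (trans (+-cong
              (trans (*-congʳ interval-zero) (zeroˡ _))
              (trans (*-congʳ (x≈y⇒x-y≈0 (𝟙-idem (Lang? (α ∷ʳ y))))) (zeroˡ _)))
            (+-identityˡ 0#))) (+-identityʳ _))
          where
          𝟙-idem : ∀ {p} {P : Set p} (P? : Dec P) → 𝟙 P? * 𝟙 P? ≈ 𝟙 P?
          𝟙-idem (yes _) = *-identityˡ _
          𝟙-idem (no _)  = zeroˡ _
          interval-zero : χ₁ z * ((1# - i x z) * ℓ x y z) ≈ 0#
          interval-zero with Lang? (α ∷ʳ z) | Lang? (α ∷ʳ x ∷ʳ z)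
          ... | no  _    | _        = zeroˡ _
          ... | yes _    | yes _    = trans (*-congˡ (trans (*-congʳ (-‿inverseʳ 1#)) (zeroˡ _))) (zeroʳ _)
          ... | yes αz∈L | no αxz∉L = trans (*-congˡ (trans (*-congˡ (ℓ-interval αz∈L αxz∉L)) (zeroʳ _))) (zeroʳ _)

        ∑Fᵃ≈0 : ∑³ Fᵃ ≈ 0#
        ∑Fᵃ≈0 = x≈-x⇒x≈0 (begin
          ∑³ Fᵃ                       ≈⟨ ∑³-swap₁₃ Fᵃ ⟩
          ∑³ (λ x y z → Fᵃ z y x)     ≈⟨ ∑³-cong (λ x y z → trans (*-congʳ (sym (ℓ-swap₁₃ x y z)))
              (solve 4 (λ m a b d → m :* (b :* (a :- d)) := (:- :1) :* (m :* (b :* (d :- a)))) refl (χ₁ y * (χ₁ z * ℓ x y z)) (u x) (u y) (u z))) ⟩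
          ∑³ (λ x y z → - 1# * Fᵃ x y z) ≈⟨ ∑³-* (- 1#) Fᵃ ⟩
          - 1# * ∑³ Fᵃ                ≈⟨ solve 1 (λ s → (:- :1) :* s := :- s) refl _ ⟩
          - ∑³ Fᵃ                     ∎)

        ∑Fᶜ : ∑³ Fᶜ ≈ ∑³ Fᶜ′
        ∑Fᶜ = trans (∑³-swap₂₃ Fᶜ) (∑³-cong (λ x y z → trans
          (solve 4 (λ z y l w → (:1 :- z) :* (y :* l) :* w := (:1 :- z) :* w :* (y :* l)) refl (χ₁ z) (χ₁ y) (ℓ x z y) (u x * (u y - u x)))
          (trans (*-congˡ (𝟙*-cong (Lang? (α ∷ʳ y)) (ℓ-swap₂₃ x y z)))
          (solve 5 (λ z y l w i → (:1 :- z) :* w :* (y :* (i :* l)) := y :* l :* ((:1 :- z) :* i :* w)) refl (χ₁ z) (χ₁ y) (ℓ x y z) (u x * (u y - u x)) (i x z)))))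

        weight : Fin n → Fin n → Fin n → Carrier
        weight x y z = χ₁ y * ℓ x y z * ((1# - χ₁ z) * (1# - i x z - i y z))

        E-symmetrized : ∑³ E + ∑³ E ≈ ∑ X (λ x → ∑ X (λ y → (u x - u y) * (u x - u y) * ∑ X (weight x y)))
        E-symmetrized = begin
          ∑³ E + ∑³ E                              ≈⟨ +-congˡ (∑³-swap₁₂ E) ⟩
          ∑³ E + ∑³ (λ x y z → E y x z)            ≈⟨ ∑³-+ E (λ x y z → E y x z) ⟨
          ∑³ (λ x y z → E x y z + E y x z)         ≈⟨ ∑³-cong (λ x y z → trans
            (+-congˡ (+-cong (*-congʳ (sym (ℓ-swap₁₂ x y z))) (*-congʳ (sym (ℓ-swap₁₂ x y z)))))
            (solve 6 (λ m z i j a b →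
              (m :* ((:1 :- z) :* (:1 :- i) :* (b :* (b :- a))) :+ m :* ((:1 :- z) :* i :* (a :* (b :- a)))) :+
              (m :* ((:1 :- z) :* (:1 :- j) :* (a :* (a :- b))) :+ m :* ((:1 :- z) :* j :* (b :* (a :- b)))) :=
              (a :- b) :* (a :- b) :* (m :* ((:1 :- z) :* (:1 :- i :- j))))
              refl (χ₁ y * ℓ x y z) (χ₁ z) (i x z) (i y z) (u x) (u y))) ⟩
          ∑³ (λ x y z → (u x - u y) * (u x - u y) * weight x y z)
            ≈⟨ ∑-cong X (λ x → ∑-cong X (λ y → ∑-*ˡ X _ (weight x y))) ⟩
          _ ∎

        0≤∑³F : 0# ≤ ∑³ F
        0≤∑³F = ≤-resp refl (sym F≈E) (*-cancel-nonneg 0<2 (≤-resp refl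
          (trans (sym E-symmetrized) (solve 1 (λ e → e :+ e := :2 :* e) refl (∑³ E)))
          (∑-nonneg X (λ x → ∑-nonneg X (λ y → *-nonneg (square-nonneg (u x - u y)) (0≤∑weight x y))))))
          where
          F≈E : ∑³ F ≈ ∑³ E
          F≈E = begin
            ∑³ F                              ≈⟨ ∑³-cong F-split ⟩
            _                                 ≈⟨ trans (∑³-+ Fᵃ _) (+-congˡ (∑³-+ Fᵇ Fᶜ)) ⟩
            ∑³ Fᵃ + (∑³ Fᵇ + ∑³ Fᶜ)           ≈⟨ +-cong ∑Fᵃ≈0 (+-congˡ ∑Fᶜ) ⟩
            0# + (∑³ Fᵇ + ∑³ Fᶜ′)             ≈⟨ +-identityˡ _ ⟩
            ∑³ Fᵇ + ∑³ Fᶜ′                    ≈⟨ ∑³-+ Fᵇ Fᶜ′ ⟨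
            ∑³ E                              ∎

        -- By `∑-transfer` the terms with `v nothing` agree on both sides, and what remains of the
        -- difference is `∑³ F`.
        pull : B α (suc r) v v ≤ ∑ X (λ x → B (α ∷ʳ x) r (transfer α (just x) v) (transfer α (just x) v))
        pull = ≤-by (begin
          RHS - LHS
            ≈⟨ +-cong RHS≈ (-‿cong LHS≈) ⟩
          (v₀ * (v₀ * L α (suc r) + S) + (v₀ * S + ∑³ G₂)) - (v₀ * (L α (suc r) * v₀ + S) + (v₀ * S + ∑³ G₁))
            ≈⟨ solve 5 (λ a l s g g′ → (a :* (a :* l :+ s) :+ (a :* s :+ g)) :- (a :* (l :* a :+ s) :+ (a :* s :+ g′)) := g :- g′)
                 refl v₀ (L α (suc r)) S (∑³ G₂) (∑³ G₁) ⟩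
          ∑³ G₂ - ∑³ G₁
            ≈⟨ ∑³-minus G₂ G₁ ⟨
          ∑³ F ∎) 0≤∑³F
          where
          v₀ = v nothing
          LHS = B α (suc r) v v
          RHS = ∑ X (λ x → B (α ∷ʳ x) r (transfer α (just x) v) (transfer α (just x) v))
          S = ∑ X (λ x → L (α ∷ʳ x) (suc r) * u x)
          G₁ G₂ : Fin n → Fin n → Fin n → Carrier
          G₁ x y z = u x * (ℓ x y z * T x y)
          G₂ x y z = T x y * (ℓ x y z * T₂ x y z)
          LHS≈ : LHS ≈ v₀ * (L α (suc r) * v₀ + S) + (v₀ * S + ∑³ G₁)
          LHS≈ = trans (∑-points _) (+-cong (*-congˡ (A▹ α (suc r) v nothing)) (trans
            (∑-cong X (λ x → trans (*-congˡ (A▹ α (suc r) v (just x)))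
              (trans (solve 4 (λ a l b s → a :* (l :* b :+ s) := b :* (l :* a) :+ a :* s) refl (u x) (L (α ∷ʳ x) (suc r)) v₀ _)
              (+-congˡ (trans (sym (∑-*ˡ X (u x) _)) (∑-cong X (λ y →
                 trans (*-congˡ (sym (∑-*ʳ X (T x y) (λ z → ℓ x y z)))) (sym (∑-*ˡ X (u x) _)))))))))
            (trans (∑-+ X _ _) (+-congʳ (∑-*ˡ X v₀ _)))))
          RHS≈ : RHS ≈ v₀ * (v₀ * L α (suc r) + S) + (v₀ * S + ∑³ G₂)
          RHS≈ = begin
            RHS
              ≈⟨ ∑-cong X (λ x → trans (∑-points _) (+-cong (*-congˡ (A▹ (α ∷ʳ x) r _ nothing))
                   (∑-cong X (λ y → trans (*-congˡ (A▹ (α ∷ʳ x) r _ (just y)))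
                     (trans (solve 4 (λ t l a s → t :* (l :* a :+ s) := a :* (l :* t) :+ t :* s) refl (T x y) (L (α ∷ʳ x ∷ʳ y) r) v₀ _)
                       (+-congˡ (sym (∑-*ˡ X (T x y) _)))))))) ⟩
            ∑ X (λ x → v₀ * (L (α ∷ʳ x) r * v₀ + ∑ X (λ y → L (α ∷ʳ x ∷ʳ y) r * T x y))
              + ∑ X (λ y → v₀ * (L (α ∷ʳ x ∷ʳ y) r * T x y) + ∑ X (G₂ x y)))
              ≈⟨ ∑-cong X (λ x → +-cong (*-congˡ (+-congʳ (*-comm _ _))) (trans (∑-+ X _ _) (+-congʳ (∑-*ˡ X v₀ _)))) ⟩
            ∑ X (λ x → v₀ * (v₀ * L (α ∷ʳ x) r + S′ x) + (v₀ * S′ x + ∑ X (λ y → ∑ X (G₂ x y))))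
              ≈⟨ trans (∑-+ X _ _) (+-cong
                   (trans (∑-*ˡ X v₀ _) (*-congˡ (trans (∑-+ X _ _) (+-cong (∑-*ˡ X v₀ _) (∑-transfer comm r v)))))
                   (trans (∑-+ X _ _) (+-congʳ (trans (∑-*ˡ X v₀ _) (*-congˡ (∑-transfer comm r v)))))) ⟩
            v₀ * (v₀ * L α (suc r) + S) + (v₀ * S + ∑³ G₂) ∎
            where
            S′ : Fin n → Carrier
            S′ x = ∑ X (λ y → L (α ∷ʳ x ∷ʳ y) r * T x y)

    -- Hyperbolicity at level zero.

    -- Titu's inequality before optimising in t, which spares a division by Σ 1/(1 - b).
    ∑-titu : ∀ {a} {I : Set a} (b s : I → Carrier) t {xs : List I} (b<1 : All (λ x → b x < 1#) xs) →
      0# ≤ ∑ xs (λ x → (1# - b x) * (s x * s x)) - (1# + 1#) * t * ∑ xs s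
        + t * t * sum (All.reduce (λ {x} bx<1 → recip (1# - b x) (x<y⇒0<y-x bx<1)) b<1)
    ∑-titu b s t [] = ≤-reflexive (solve 1 (λ t → :0 := :0 :- :2 :* t :* :0 :+ t :* t :* :0) refl t)
    ∑-titu b s t {x ∷ xs} (bx<1 ∷ b<1) = ≤-resp refl
      (begin
        (1# - b x) * ((s x - t * i) * (s x - t * i)) + rest
          ≈⟨ solve 8 (λ a s t i S Σs Σi k →
               a :* ((s :- t :* i) :* (s :- t :* i)) :+ (S :- :2 :* t :* Σs :+ t :* t :* Σi) :=
               (a :* (s :* s) :+ S) :- :2 :* t :* (a :* i :* s :+ Σs) :+ t :* t :* (a :* i :* i :+ Σi))
               refl (1# - b x) (s x) t i _ _ _ 0# ⟩
        ((1# - b x) * (s x * s x) + Sxs) - (1# + 1#) * t * ((1# - b x) * i * s x + ∑ xs s)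
          + t * t * ((1# - b x) * i * i + Ixs)
          ≈⟨ +-cong (+-congˡ (-‿cong (*-congˡ (+-congʳ (ai*≈ (s x)))))) (*-congˡ (+-congʳ (ai*≈ i))) ⟩
        _ ∎)
      (+-nonneg (*-nonneg (<⇒≤ 0<a) (square-nonneg _)) (∑-titu b s t b<1))
      where
      0<a = x<y⇒0<y-x bx<1
      i = recip (1# - b x) 0<a
      Sxs = ∑ xs (λ x → (1# - b x) * (s x * s x))
      Ixs = sum (All.reduce (λ {x} bx<1 → recip (1# - b x) (x<y⇒0<y-x bx<1)) b<1)
      rest = Sxs - (1# + 1#) * t * ∑ xs s + t * t * Ixs
      ai*≈ : ∀ y → (1# - b x) * i * y ≈ y
      ai*≈ y = trans (*-congʳ (recip-inverse _ 0<a)) (*-identityˡ y)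

    -- With θ = 1 - C₁₁/C₀₂ the claim is N ≥ θS², which is clear for θ ≤ 0. The sign of θ cannot be
    -- decided, but the claim is a negation, so it suffices to refute both cases.
    scaleMon-bound : ∀ {a} {I : Set a} (b s : I → Carrier) {xs : List I} {C₀₂ C₁₁} (0<C₀₂ : 0# < C₀₂) →
      0# ≤ ∑ xs (λ x → (1# - b x) * (s x * s x)) →
      (C₁₁ < C₀₂ → Σ[ b<1 ∈ All (λ x → b x < 1#) xs ]
        (1# - C₁₁ * recip C₀₂ 0<C₀₂) * sum (All.reduce (λ {x} bx<1 → recip (1# - b x) (x<y⇒0<y-x bx<1)) b<1) ≤ 1#) →
      C₀₂ * (∑ xs s * ∑ xs s - ∑ xs (λ x → (1# - b x) * (s x * s x))) ≤ C₁₁ * (∑ xs s * ∑ xs s)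
    scaleMon-bound b s {xs} {C₀₂} {C₁₁} 0<C₀₂ 0≤N scaleMon bad = small large
      where
      S = ∑ xs s
      N = ∑ xs (λ x → (1# - b x) * (s x * s x))
      small : ¬ ¬ (C₁₁ < C₀₂)
      small C₀₂≤C₁₁ = ≤-by (solve 4 (λ C D S N → D :* (S :* S) :- C :* (S :* S :- N) := (D :- C) :* (S :* S) :+ C :* N)
          refl C₀₂ C₁₁ S N)
        (+-nonneg (*-nonneg (0≤y-x C₀₂≤C₁₁) (square-nonneg S)) (*-nonneg (<⇒≤ 0<C₀₂) 0≤N)) bad
      large : ¬ (C₁₁ < C₀₂)
      large C₁₁<C₀₂ with scaleMon C₁₁<C₀₂
      -- Titu's inequality at t = θS gives N ≥ θS²(2 - θH), and θH ≤ 1.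
      ... | b<1 , θH≤1 = ≤-by certificate
          (*-nonneg (<⇒≤ 0<C₀₂) (+-nonneg (∑-titu b s (θ * S) b<1)
            (*-nonneg (*-nonneg 0≤θ (square-nonneg S)) (0≤y-x θH≤1)))) bad
        where
        H = sum (All.reduce (λ {x} bx<1 → recip (1# - b x) (x<y⇒0<y-x bx<1)) b<1)
        ρ = recip C₀₂ 0<C₀₂
        θ = 1# - C₁₁ * ρ
        C₀₂θ : C₀₂ * θ ≈ C₀₂ - C₁₁
        C₀₂θ = trans (solve 3 (λ C D r → C :* (:1 :- D :* r) := C :- D :* (C :* r)) refl C₀₂ C₁₁ ρ)
          (+-congˡ (-‿cong (trans (*-congˡ (recip-inverse C₀₂ 0<C₀₂)) (*-identityʳ C₁₁))))
        0≤θ : 0# ≤ θ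
        0≤θ = *-cancel-nonneg 0<C₀₂ (≤-resp refl (sym C₀₂θ) (0≤y-x (<⇒≤ C₁₁<C₀₂)))
        certificate : C₁₁ * (S * S) - C₀₂ * (S * S - N) ≈
          C₀₂ * ((N - (1# + 1#) * (θ * S) * S + θ * S * (θ * S) * H) + θ * (S * S) * (1# - θ * H))
        certificate = begin
          C₁₁ * (S * S) - C₀₂ * (S * S - N)
            ≈⟨ solve 4 (λ C D S N → D :* (S :* S) :- C :* (S :* S :- N) := C :* N :- (C :- D) :* (S :* S)) refl C₀₂ C₁₁ S N ⟩
          C₀₂ * N - (C₀₂ - C₁₁) * (S * S)
            ≈⟨ +-congˡ (-‿cong (*-congʳ C₀₂θ)) ⟨
          C₀₂ * N - C₀₂ * θ * (S * S)
            ≈⟨ solve 5 (λ C θ S N H → C :* N :- C :* θ :* (S :* S) :=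
                 C :* ((N :- :2 :* (θ :* S) :* S :+ θ :* S :* (θ :* S) :* H) :+ θ :* (S :* S) :* (:1 :- θ :* H)))
                 refl C₀₂ θ S N H ⟩
          _ ∎

    unique-++⇒disjoint : ∀ {a} {I : Set a} (α : List I) {β x} → Unique (α ++ β) → x ∈ α → ¬ x ∈ β
    unique-++⇒disjoint (x ∷ α) (x≢ ∷ _) (here ≡.refl) x∈β = All.lookup x≢ (∈-++⁺ʳ α x∈β) ≡.refl
    unique-++⇒disjoint (_ ∷ α) (_ ∷ unique) (there x∈α) x∈β = unique-++⇒disjoint α unique x∈α x∈β

    filter-cong∈ : ∀ {a p r} {I : Set a} {P : U.Pred I p} {R : U.Pred I r} (P? : U.Decidable P) (R? : U.Decidable R)
      (xs : List I) → (∀ {x} → x ∈ xs → (P x → R x) × (R x → P x)) → filter P? xs ≡ filter R? xs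
    filter-cong∈ P? R? []       P⇔R = ≡.refl
    filter-cong∈ P? R? (x ∷ xs) P⇔R with P? x | R? x
    ... | yes _ | yes _ = ≡.cong (x ∷_) (filter-cong∈ P? R? xs (λ x∈xs → P⇔R (there x∈xs)))
    ... | no _  | no _  = filter-cong∈ P? R? xs (λ x∈xs → P⇔R (there x∈xs))
    ... | yes p | no ¬r = ⊥-elim (¬r (proj₁ (P⇔R (here ≡.refl)) p))
    ... | no ¬p | yes r = ⊥-elim (¬p (proj₂ (P⇔R (here ≡.refl)) r))

    module Base (S : ScaleSequence ℝ G) {α : Word n} (α∈L : Lang α) (comm : Commutes α)
      (logMod : LogMod ℝ G Q S α) (fewDes : FewDes ℝ G Q S α)
      (synMon : SynMon ℝ G Q S α) (scaleMon : ScaleMon ℝ G Q S α)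
      where

      open ScaleSequence S

      ϖ : Word n → Carrier
      ϖ = ω ℝ G Q S

      Cα : List (Fin n)
      Cα = Cont G α

      Cα-∈ : ∀ {x} → x ∈ Cα → Lang (α ∷ʳ x)
      Cα-∈ x∈Cα = proj₂ (∈-filter⁻ _ {xs = X} x∈Cα)

      -- Commutation at level 0 equates the positive weight of αxy with that of αyx, which would be
      -- zero off the language.
      Lang-swap : ∀ {x y} → Lang (α ∷ʳ x) → Lang (α ∷ʳ y) → Lang (α ∷ʳ x ∷ʳ y) → Lang (α ∷ʳ y ∷ʳ x)
      Lang-swap {x} {y} αx∈L αy∈L αxy∈L with Lang? (α ∷ʳ y ∷ʳ x)
      ... | yes αyx∈L = αyx∈L
      ... | no  αyx∉L = ⊥-elim (<-irrefl (<-resp refl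
        (trans (comm 0 αx∈L αy∈L) (outside _ αyx∉L)) (positive _ αxy∈L)))

      -- Transitivity of parallelism. Exchange appends to αy a letter of αxz. This letter is not in
      -- α, because words are simple, and it is not `x`, because `x` and `y` are parallel; so it is
      -- `z`.
      Lang-trans : ∀ {x y z} → Lang (α ∷ʳ x) → Lang (α ∷ʳ y) → Lang (α ∷ʳ z) →
        ¬ Lang (α ∷ʳ x ∷ʳ y) → Lang (α ∷ʳ x ∷ʳ z) → Lang (α ∷ʳ y ∷ʳ z)
      Lang-trans {x} {y} {z} αx∈L αy∈L αz∈L αxy∉L αxz∈L with exchange αxz∈L αy∈L shorter
        where
        shorter : length (α ∷ʳ y) ℕ.< length (α ∷ʳ x ∷ʳ z)
        shorter = ℕ.≤-reflexive (≡.trans (≡.cong suc (≡.trans (length-++ α) (≡.sym (length-++ α))))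
          (≡.trans (ℕ.+-comm 1 _) (≡.sym (length-++ (α ∷ʳ x)))))
      ... | w , w∈αxz , αyw∈L with ∈-++⁻ (α ∷ʳ x) w∈αxz
      ... | inj₂ (here ≡.refl) = αyw∈L
      ... | inj₁ w∈αx with ∈-++⁻ α w∈αx
      ... | inj₂ (here ≡.refl) = ⊥-elim (αxy∉L (Lang-swap αy∈L αx∈L αyw∈L))
      ... | inj₁ w∈α = ⊥-elim (unique-++⇒disjoint α
        (≡.subst Unique (∷ʳ-∷ʳ α y w) (simple αyw∈L)) w∈α (there (here ≡.refl)))

      key : Fin n → List (Fin n)
      key = Class G α

      _≟ᴸ_ : (u v : List (Fin n)) → Dec (u ≡ v)
      _≟ᴸ_ = ≡-dec _≟_

      to-∷ʳ : ∀ {x y} → Lang (α ++ x ∷ y ∷ []) → Lang (α ∷ʳ x ∷ʳ y)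
      to-∷ʳ {x} {y} = ≡.subst Lang (≡.sym (∷ʳ-∷ʳ α x y))

      from-∷ʳ : ∀ {x y} → Lang (α ∷ʳ x ∷ʳ y) → Lang (α ++ x ∷ y ∷ [])
      from-∷ʳ {x} {y} = ≡.subst Lang (∷ʳ-∷ʳ α x y)

      ∈-own-class : ∀ {x} → x ∈ Cα → x ∈ key x
      ∈-own-class {x} x∈Cα = ∈-filter⁺ _ x∈Cα (λ αxx∈L → repeated∉L α x (to-∷ʳ αxx∈L))

      parallel⇒same-class : ∀ {x y} → x ∈ Cα → y ∈ Cα → ¬ Lang (α ∷ʳ x ∷ʳ y) → key x ≡ key y
      parallel⇒same-class {x} {y} x∈Cα y∈Cα αxy∉L = filter-cong∈ _ _ Cα λ z∈Cα →
          (λ αxz∉L αyz∈L → αxz∉L (from-∷ʳ (Lang-trans αy∈L αx∈L (Cα-∈ z∈Cα) αyx∉L (to-∷ʳ αyz∈L))))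
        , (λ αyz∉L αxz∈L → αyz∉L (from-∷ʳ (Lang-trans αx∈L αy∈L (Cα-∈ z∈Cα) αxy∉L (to-∷ʳ αxz∈L))))
        where
        αx∈L = Cα-∈ x∈Cα
        αy∈L = Cα-∈ y∈Cα
        αyx∉L : ¬ Lang (α ∷ʳ y ∷ʳ x)
        αyx∉L αyx∈L = αxy∉L (Lang-swap αy∈L αx∈L αyx∈L)

      same-class⇒parallel : ∀ {x y} → y ∈ Cα → key x ≡ key y → ¬ Lang (α ∷ʳ x ∷ʳ y)
      same-class⇒parallel {x} {y} y∈Cα kx≡ky αxy∈L =
        proj₂ (∈-filter⁻ _ {xs = Cα} (≡.subst (y ∈_) (≡.sym kx≡ky) (∈-own-class y∈Cα))) (from-∷ʳ αxy∈L)

      key∈Par : ∀ {x} → x ∈ Cα → key x ∈ Par G α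
      key∈Par x∈Cα = ∈-deduplicate⁺ _≟ᴸ_ (∈-map⁺ key x∈Cα)

      Par⇒key : ∀ {C} → C ∈ Par G α → ∃[ x ] x ∈ Cα × C ≡ key x
      Par⇒key C∈Par = ∈-map⁻ key (∈-deduplicate⁻ _≟ᴸ_ (map key Cα) C∈Par)

      ∑-Par : ∀ (f : Fin n → Carrier) → ∑ Cα f ≈ ∑ (Par G α) (λ C → ∑ Cα (λ x → 𝟙 (key x ≟ᴸ C) * f x))
      ∑-Par = ∑-fibres _≟ᴸ_ key {xs = Cα} (UniqueDec.deduplicate-! _≟ᴸ_ (map key Cα)) key∈Par

      ω-outside : ∀ {w} → ¬ Lang w → ϖ w ≈ 0#
      ω-outside w∉L = trans (*-congʳ (outside _ w∉L)) (zeroˡ _)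

      ∑-Cα : ∀ {f} → (∀ x → ¬ Lang (α ∷ʳ x) → f x ≈ 0#) → ∑ X f ≈ ∑ Cα f
      ∑-Cα {f} f≈0 = trans (∑-cong X bracket) (sym (∑-filter _ X f))
        where
        bracket : ∀ x → f x ≈ 𝟙 (Lang? (α ∷ʳ x)) * f x
        bracket x with Lang? (α ∷ʳ x)
        ... | yes _    = sym (*-identityˡ _)
        ... | no αx∉L = trans (f≈0 x αx∉L) (sym (zeroˡ _))

      q≈scale*ω : ∀ w {j} → length w ≡ j → q w ≈ scale j * ϖ w
      q≈scale*ω w ≡.refl = sym (trans
        (solve 3 (λ s q r → s :* (q :* r) := q :* (s :* r)) refl (scale (length w)) (q w) _)
        (trans (*-congˡ (recip-inverse _ (scale-pos (length w)))) (*-identityʳ _)))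

      ϖ⁻¹ : Fin n → Carrier
      ϖ⁻¹ x = ω⁻¹ ℝ G Q S (α ∷ʳ x)

      ω*ω⁻¹ : ∀ {x} → Lang (α ∷ʳ x) → ϖ (α ∷ʳ x) * ϖ⁻¹ x ≈ 1#
      ω*ω⁻¹ {x} αx∈L with Lang? (α ∷ʳ x)
      ... | yes αx∈L′ = recip-inverse _ _
      ... | no  αx∉L  = ⊥-elim (αx∉L αx∈L)

      bᶜ : List (Fin n) → Carrier
      bᶜ = b ℝ G Q S α

      χ₂ : Fin n → Fin n → Carrier
      χ₂ x y = χ (α ∷ʳ x) y

      desSum : Fin n → Carrier
      desSum x = ∑ (Des G α x) (λ y → ϖ α * ϖ (α ++ x ∷ y ∷ []))

      desSum≈ : ∀ x → desSum x ≈ ∑ X (λ y → (1# - χ α y) * (ϖ α * ϖ (α ∷ʳ x ∷ʳ y)))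
      desSum≈ x = trans (∑-filter _ X _) (∑-cong X term)
        where
        term : ∀ y → 𝟙 (Lang? (α ++ x ∷ y ∷ []) ×-dec ¬? (Lang? (α ∷ʳ y))) * (ϖ α * ϖ (α ++ x ∷ y ∷ [])) ≈
          (1# - χ α y) * (ϖ α * ϖ (α ∷ʳ x ∷ʳ y))
        term y = trans (*-congʳ (trans (𝟙-× (Lang? _) (¬? (Lang? (α ∷ʳ y)))) (*-congˡ (𝟙-¬ (Lang? (α ∷ʳ y))))))
          (trans (solve 4 (λ i c o w → i :* c :* (o :* w) := c :* (o :* (i :* w))) refl _ _ _ _)
          (*-congˡ (*-congˡ (trans (absorb (Lang? _)) (reflexive (≡.cong ϖ (≡.sym (∷ʳ-∷ʳ α x y))))))))
          where
          absorb : ∀ {w} (w? : Dec (Lang w)) → 𝟙 w? * ϖ w ≈ ϖ w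
          absorb (yes _)   = *-identityˡ _
          absorb (no w∉L) = trans (zeroˡ _) (sym (ω-outside w∉L))

      b-singleton : ∀ x → bᶜ [ x ] ≈ desSum x * (ϖ⁻¹ x * ϖ⁻¹ x)
      b-singleton x = ∑-*ʳ (Des G α x) _ _

      b*ω² : ∀ {x} → Lang (α ∷ʳ x) → bᶜ [ x ] * (ϖ (α ∷ʳ x) * ϖ (α ∷ʳ x)) ≈ desSum x
      b*ω² {x} αx∈L = trans (*-congʳ (b-singleton x)) (trans
        (solve 3 (λ d i w → d :* (i :* i) :* (w :* w) := d :* ((w :* i) :* (w :* i))) refl (desSum x) (ϖ⁻¹ x) (ϖ (α ∷ʳ x)))
        (trans (*-congˡ (trans (*-cong (ω*ω⁻¹ αx∈L) (ω*ω⁻¹ αx∈L)) (*-identityˡ 1#))) (*-identityʳ _)))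

      b≤1 : ∀ {C} → C ∈ Par G α → bᶜ C ≤ 1#
      b≤1 {[]}        _ = <⇒≤ 0<1
      b≤1 {_ ∷ _ ∷ _} _ = <⇒≤ 0<1
      b≤1 {x ∷ []} C∈Par with Par⇒key C∈Par
      ... | x₀ , x₀∈Cα , C≡ = *-cancelˡ-≤ (*-pos 0<ω 0<ω) (≤-resp
          (trans (sym (b*ω² αx∈L)) (*-comm _ _)) (sym (*-identityʳ _)) (synMon (∈-Cont αx∈L)))
        where
        αx∈L : Lang (α ∷ʳ x)
        αx∈L = Cα-∈ (proj₁ (∈-filter⁻ _ {xs = Cα} (≡.subst (x ∈_) C≡ (here ≡.refl))))
        0<ω = ω-pos ℝ G Q S (α ∷ʳ x) αx∈L

      module _ (v : Point → Carrier) where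

        -- In these coordinates `LogMod` turns the entries of non-parallel pairs into products
        -- `u x * u y`.
        u : Fin n → Carrier
        u x = ϖ (α ∷ʳ x) * v (just x)

        u-outside : ∀ x → ¬ Lang (α ∷ʳ x) → u x ≈ 0#
        u-outside x αx∉L = trans (*-congʳ (ω-outside αx∉L)) (zeroˡ _)

        classSum : List (Fin n) → Carrier
        classSum C = ∑ Cα (λ x → 𝟙 (key x ≟ᴸ C) * u x)

        T : Fin n → Fin n → Carrier
        T x y = transfer α (just x) v (just y)

        U = ∑ Cα u
        V = ∑ X (λ x → ∑ X (λ y → v (just x) * (ϖ (α ∷ʳ x ∷ʳ y) * T x y)))
        N = ∑ (Par G α) (λ C → (1# - bᶜ C) * (classSum C * classSum C))

        U≈ : U ≈ ∑ (Par G α) classSum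
        U≈ = ∑-Par u

        parallel-pairs : ∑ Cα (λ x → ∑ Cα (λ y → (1# - χ₂ x y) * (u x * u y))) ≈
          ∑ (Par G α) (λ C → classSum C * classSum C)
        parallel-pairs = begin
          ∑ Cα (λ x → ∑ Cα (λ y → (1# - χ₂ x y) * (u x * u y)))
            ≈⟨ ∑-cong∈ Cα (λ {x} x∈Cα → trans (∑-cong∈ Cα (λ {y} y∈Cα → trans (*-congʳ (same x∈Cα y∈Cα))
                 (solve 3 (λ i a b → i :* (a :* b) := a :* (i :* b)) refl (𝟙 (key y ≟ᴸ key x)) (u x) (u y)))) (∑-*ˡ Cα (u x) _)) ⟩
          ∑ Cα (λ x → u x * classSum (key x))
            ≈⟨ ∑-Par _ ⟩
          ∑ (Par G α) (λ C → ∑ Cα (λ x → 𝟙 (key x ≟ᴸ C) * (u x * classSum (key x))))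
            ≈⟨ ∑-cong (Par G α) (λ C → trans (∑-cong Cα (λ x → trans
                 (𝟙*-cong (key x ≟ᴸ C) (λ kx≡C → *-congˡ (reflexive (≡.cong classSum kx≡C)))) (sym (*-assoc _ _ _))))
                 (∑-*ʳ Cα (classSum C) _)) ⟩
          ∑ (Par G α) (λ C → classSum C * classSum C) ∎
          where
          same : ∀ {x y} → x ∈ Cα → y ∈ Cα → 1# - χ₂ x y ≈ 𝟙 (key y ≟ᴸ key x)
          same {x} {y} x∈Cα y∈Cα = trans (sym (𝟙-¬ (Lang? (α ∷ʳ x ∷ʳ y)))) (𝟙-cong (¬? (Lang? (α ∷ʳ x ∷ʳ y))) (key y ≟ᴸ key x)
            (λ αxy∉L → ≡.sym (parallel⇒same-class x∈Cα y∈Cα αxy∉L)) (λ ky≡kx → same-class⇒parallel y∈Cα (≡.sym ky≡kx)))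

        -- On a class of at least two letters `FewDes` makes both sides zero. On a singleton the
        -- class sum is the value of `u` at its only element.
        class-diagonal : ∀ {C} → C ∈ Par G α →
          ∑ Cα (λ x → 𝟙 (key x ≟ᴸ C) * (bᶜ [ x ] * (u x * u x))) ≈ bᶜ C * (classSum C * classSum C)
        class-diagonal {C} C∈Par with Par⇒key C∈Par
        class-diagonal {[]} C∈Par | x₀ , x₀∈Cα , C≡ with ≡.subst (x₀ ∈_) (≡.sym C≡) (∈-own-class x₀∈Cα)
        ... | ()
        class-diagonal {x ∷ []} C∈Par | x₀ , x₀∈Cα , C≡ =
          trans (at-x (λ y → bᶜ [ y ] * (u y * u y))) (*-congˡ (*-cong (sym (at-x u)) (sym (at-x u))))
          where
          singleton : ∀ {y} → y ∈ [ x ] → y ≡ x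
          singleton (here y≡x) = y≡x
          x₀≡x : x₀ ≡ x
          x₀≡x = singleton (≡.subst (x₀ ∈_) (≡.sym C≡) (∈-own-class x₀∈Cα))
          at-x : ∀ f → ∑ Cα (λ y → 𝟙 (key y ≟ᴸ [ x ]) * f y) ≈ f x
          at-x f = trans (∑-cong∈ Cα (λ {y} y∈Cα → *-congʳ (𝟙-cong (key y ≟ᴸ [ x ]) (x ≟ y)
              (λ ky≡C → ≡.sym (singleton (≡.subst (y ∈_) ky≡C (∈-own-class y∈Cα))))
              (λ { ≡.refl → ≡.trans (≡.cong key (≡.sym x₀≡x)) (≡.sym C≡) }))))
            (∑-indicator _≟_ f (Unique.filter⁺ _ (Unique.allFin⁺ n)) (≡.subst (_∈ Cα) x₀≡x x₀∈Cα))
        class-diagonal {C@(_ ∷ _ ∷ _)} C∈Par | _ = trans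
          (∑-zero∈ Cα (λ {x} x∈Cα → trans (𝟙*-cong (key x ≟ᴸ C) {y = 0#} (λ kx≡C → trans (*-congʳ (b≈0
            (fewDes C∈Par (ℕ.s≤s (ℕ.s≤s ℕ.z≤n)) (≡.subst (x ∈_) kx≡C (∈-own-class x∈Cα))))) (zeroˡ _))) (zeroʳ _)))
          (sym (zeroˡ _))
          where
          b≈0 : ∀ {x} → Des G α x ≡ [] → bᶜ [ x ] ≈ 0#
          b≈0 {x} Des≡[] = trans (b-singleton x) (trans (*-congʳ (reflexive
            (≡.cong (λ D → ∑ D (λ y → ϖ α * ϖ (α ++ x ∷ y ∷ []))) Des≡[]))) (zeroˡ _))

        pairs : ϖ α * V ≈ ∑ Cα (λ x → ∑ Cα (λ y → χ₂ x y * (u x * u y))) + ∑ Cα (λ x → bᶜ [ x ] * (u x * u x))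
        pairs = begin
          ϖ α * V
            ≈⟨ trans (sym (∑-*ˡ X (ϖ α) _)) (∑-cong X (λ x → sym (∑-*ˡ X (ϖ α) _))) ⟩
          ∑ X (λ x → ∑ X (λ y → ϖ α * (v (just x) * (ϖ (α ∷ʳ x ∷ʳ y) * T x y))))
            ≈⟨ ∑-cong X (λ x → trans (∑-cong X (λ y → term x y)) (trans (∑-+ X _ _)
                 (+-congˡ (trans (∑-*ʳ X _ _) (*-congʳ (sym (desSum≈ x))))))) ⟩
          ∑ X (λ x → ∑ X (λ y → χ₂ x y * (u x * u y)) + desSum x * (v (just x) * v (just x)))
            ≈⟨ ∑-+ X _ _ ⟩
          ∑ X (λ x → ∑ X (λ y → χ₂ x y * (u x * u y))) + ∑ X (λ x → desSum x * (v (just x) * v (just x)))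
            ≈⟨ +-cong (trans (∑-cong X (λ x → ∑-Cα (λ y αy∉L →
                   trans (*-congˡ (trans (*-congˡ (u-outside y αy∉L)) (zeroʳ _))) (zeroʳ _))))
                 (∑-Cα (λ x αx∉L → ∑-zero Cα (λ y → trans (*-congˡ (trans (*-congʳ (u-outside x αx∉L)) (zeroˡ _))) (zeroʳ _)))))
                 (trans (∑-Cα (λ x αx∉L → trans (*-congʳ (desSum-outside x αx∉L)) (zeroˡ _)))
                   (∑-cong∈ Cα (λ {x} x∈Cα → trans (*-congʳ (sym (b*ω² (Cα-∈ x∈Cα))))
                     (solve 3 (λ b w v → b :* (w :* w) :* (v :* v) := b :* ((w :* v) :* (w :* v))) refl (bᶜ [ x ]) _ _)))) ⟩
          _ ∎
          where
          desSum-outside : ∀ x → ¬ Lang (α ∷ʳ x) → desSum x ≈ 0#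
          desSum-outside x αx∉L = trans (desSum≈ x) (∑-zero X (λ y →
            trans (*-congˡ (trans (*-congˡ (ω-outside (λ αxy∈L → αx∉L (prefix _ y αxy∈L)))) (zeroʳ _))) (zeroʳ _)))
          modular : ∀ x y → χ α y * (ϖ α * ϖ (α ∷ʳ x ∷ʳ y)) ≈ χ₂ x y * (ϖ (α ∷ʳ x) * ϖ (α ∷ʳ y))
          modular x y with Lang? (α ∷ʳ y) | Lang? (α ∷ʳ x ∷ʳ y)
          ... | no αy∉L  | _ = trans (zeroˡ _) (sym (trans (*-congˡ (trans (*-congˡ (ω-outside αy∉L)) (zeroʳ _))) (zeroʳ _)))
          ... | yes αy∈L | yes αxy∈L = *-congˡ (sym (trans (logMod (∈-Cont (prefix _ y αxy∈L)) (∈-Cont αy∈L) (from-∷ʳ αxy∈L))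
            (*-congˡ (reflexive (≡.cong ϖ (≡.sym (∷ʳ-∷ʳ α x y)))))))
          ... | yes αy∈L | no  αxy∉L = trans (*-congˡ (trans (*-congˡ (ω-outside αxy∉L)) (zeroʳ _))) (trans (zeroʳ _) (sym (zeroˡ _)))
          term : ∀ x y → ϖ α * (v (just x) * (ϖ (α ∷ʳ x ∷ʳ y) * T x y)) ≈
            χ₂ x y * (u x * u y) + (1# - χ α y) * (ϖ α * ϖ (α ∷ʳ x ∷ʳ y)) * (v (just x) * v (just x))
          term x y = trans
            (solve 5 (λ o w c a d → o :* (a :* (w :* (c :* d :+ (:1 :- c) :* a))) :=
              c :* (o :* w) :* (a :* d) :+ (:1 :- c) :* (o :* w) :* (a :* a)) refl (ϖ α) (ϖ (α ∷ʳ x ∷ʳ y)) (χ α y) (v (just x)) (v (just y)))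
            (+-congʳ (trans (*-congʳ (modular x y))
              (solve 5 (λ i w z a d → i :* (w :* z) :* (a :* d) := i :* ((w :* a) :* (z :* d))) refl
                (χ₂ x y) (ϖ (α ∷ʳ x)) (ϖ (α ∷ʳ y)) (v (just x)) (v (just y)))))

        -- In the coordinates u, the letter block of A α 0 is, up to a factor, the square of Σ u minus
        -- a combination of the squares of the sums of u over the parallel classes.
        ωV≈ : ϖ α * V ≈ U * U - N
        ωV≈ = begin
          ϖ α * V
            ≈⟨ pairs ⟩
          ∑ Cα (λ x → ∑ Cα (λ y → χ₂ x y * (u x * u y))) + ∑ Cα (λ x → bᶜ [ x ] * (u x * u x))
            ≈⟨ +-cong non-parallel diagonal ⟩
          (U * U - ∑ (Par G α) (λ C → classSum C * classSum C)) + ∑ (Par G α) (λ C → bᶜ C * (classSum C * classSum C))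
            ≈⟨ solve 3 (λ u s t → (u :- s) :+ t := u :- (s :- t)) refl (U * U) _ _ ⟩
          U * U - (∑ (Par G α) (λ C → classSum C * classSum C) - ∑ (Par G α) (λ C → bᶜ C * (classSum C * classSum C)))
            ≈⟨ +-congˡ (-‿cong (trans (sym (∑-minus (Par G α) _ _)) (∑-cong (Par G α) (λ C →
                 solve 2 (λ b s → s :- b :* s := (:1 :- b) :* s) refl (bᶜ C) (classSum C * classSum C))))) ⟩
          U * U - N ∎
          where
          non-parallel : ∑ Cα (λ x → ∑ Cα (λ y → χ₂ x y * (u x * u y))) ≈
            U * U - ∑ (Par G α) (λ C → classSum C * classSum C)
          non-parallel = begin
            ∑ Cα (λ x → ∑ Cα (λ y → χ₂ x y * (u x * u y)))
              ≈⟨ ∑-cong Cα (λ x → trans (∑-cong Cα (λ y →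
                   solve 3 (λ i a b → i :* (a :* b) := a :* b :- (:1 :- i) :* (a :* b)) refl (χ₂ x y) (u x) (u y)))
                   (∑-minus Cα _ _)) ⟩
            ∑ Cα (λ x → ∑ Cα (λ y → u x * u y) - ∑ Cα (λ y → (1# - χ₂ x y) * (u x * u y)))
              ≈⟨ ∑-minus Cα _ _ ⟩
            ∑ Cα (λ x → ∑ Cα (λ y → u x * u y)) - ∑ Cα (λ x → ∑ Cα (λ y → (1# - χ₂ x y) * (u x * u y)))
              ≈⟨ +-cong (trans (∑-cong Cα (λ x → ∑-*ˡ Cα (u x) u)) (∑-*ʳ Cα U u)) (-‿cong parallel-pairs) ⟩
            U * U - ∑ (Par G α) (λ C → classSum C * classSum C) ∎
          diagonal : ∑ Cα (λ x → bᶜ [ x ] * (u x * u x)) ≈ ∑ (Par G α) (λ C → bᶜ C * (classSum C * classSum C))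
          diagonal = trans (∑-Par _) (∑-cong∈ (Par G α) class-diagonal)

        0≤N : 0# ≤ N
        0≤N = ∑-nonneg∈ (Par G α) (λ C∈Par → *-nonneg (0≤y-x (b≤1 C∈Par)) (square-nonneg _))

        -- In the difference of the two sides `v nothing` cancels, and c₁²U² - c₀c₂ω(α)V is left. By
        -- `ωV≈` its nonnegativity is `scaleMon-bound`, with the class sums as variables.
        hyperbolic-zero : B α 0 v v * q α ≤ row α 0 v * row α 0 v
        hyperbolic-zero = ≤-by
          (begin
            row α 0 v * row α 0 v - B α 0 v v * q α
              ≈⟨ +-cong (*-cong row≈ row≈) (-‿cong (*-cong B≈ q≈)) ⟩
            (c₀ * o * v₀ + c₁ * U) * (c₀ * o * v₀ + c₁ * U)
              - (v₀ * (c₀ * o * v₀ + c₁ * U) + (v₀ * (c₁ * U) + c₂ * V)) * (c₀ * o)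
              ≈⟨ solve 7 (λ c₀ c₁ c₂ o v U V →
                   (c₀ :* o :* v :+ c₁ :* U) :* (c₀ :* o :* v :+ c₁ :* U)
                   :- (v :* (c₀ :* o :* v :+ c₁ :* U) :+ (v :* (c₁ :* U) :+ c₂ :* V)) :* (c₀ :* o) :=
                   c₁ :* c₁ :* (U :* U) :- c₀ :* c₂ :* (o :* V)) refl c₀ c₁ c₂ o v₀ U V ⟩
            c₁ * c₁ * (U * U) - c₀ * c₂ * (o * V) ∎)
          (0≤y-x (≤-resp (*-congˡ (sym (trans ωV≈ (+-congʳ (*-cong U≈ U≈))))) (*-congˡ (sym (*-cong U≈ U≈)))
            (scaleMon-bound bᶜ classSum (*-pos (scale-pos _) (scale-pos _)) 0≤N scaleMon)))
          where
          c₀ = scale (length α)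
          c₁ = scale (1 ℕ.+ length α)
          c₂ = scale (2 ℕ.+ length α)
          o = ϖ α
          v₀ = v nothing
          q≈ : q α ≈ c₀ * o
          q≈ = q≈scale*ω α ≡.refl
          qx≈ : ∀ x → q (α ∷ʳ x) ≈ c₁ * ϖ (α ∷ʳ x)
          qx≈ x = q≈scale*ω _ (length-∷ʳ α x)
          qxy≈ : ∀ x y → q (α ∷ʳ x ∷ʳ y) ≈ c₂ * ϖ (α ∷ʳ x ∷ʳ y)
          qxy≈ x y = q≈scale*ω _ (≡.trans (length-∷ʳ (α ∷ʳ x) y) (≡.cong suc (length-∷ʳ α x)))
          R≈ : ∑ X (λ x → q (α ∷ʳ x) * v (just x)) ≈ c₁ * U
          R≈ = trans (∑-cong X (λ x → trans (*-congʳ (qx≈ x)) (*-assoc _ _ _)))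
            (trans (∑-*ˡ X c₁ _) (*-congˡ (∑-Cα u-outside)))
          row≈ : row α 0 v ≈ c₀ * o * v₀ + c₁ * U
          row≈ = +-cong (*-congʳ q≈) R≈
          B≈ : B α 0 v v ≈ v₀ * (c₀ * o * v₀ + c₁ * U) + (v₀ * (c₁ * U) + c₂ * V)
          B≈ = trans (∑-points _) (+-cong (*-congˡ (trans (A▹ α 0 v nothing) row≈)) (begin
            ∑ X (λ x → v (just x) * (points ▹ A α 0) v (just x))
              ≈⟨ ∑-cong X (λ x → trans (*-congˡ (trans (A▹ α 0 v (just x))
                   (+-congˡ (trans (∑-cong X (λ y → trans (*-congʳ (qxy≈ x y)) (*-assoc _ _ _))) (∑-*ˡ X c₂ _)))))
                   (trans (solve 5 (λ a q b c s → a :* (q :* b :+ c :* s) := b :* (q :* a) :+ c :* (a :* s)) refl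
                     (v (just x)) (q (α ∷ʳ x)) v₀ c₂ _) (+-congˡ (*-congˡ (sym (∑-*ˡ X (v (just x)) _)))))) ⟩
            ∑ X (λ x → v₀ * (q (α ∷ʳ x) * v (just x)) + c₂ * ∑ X (λ y → v (just x) * (ϖ (α ∷ʳ x ∷ʳ y) * T x y)))
              ≈⟨ trans (∑-linear X v₀ _ c₂ _) (+-congʳ (*-congˡ R≈)) ⟩
            v₀ * (c₁ * U) + c₂ * V ∎))

    -- Log-concavity and the case of equality.

    Geometric : Carrier → Word n → ℕ → Set ℓ₁
    Geometric s α r = ∀ z → L (child α z) (suc r) ≈ s * L (child α z) r

    neg-tilt≈0 : ∀ {s a a′} → a′ ≈ s * a → a′ + - s * a ≈ 0#
    neg-tilt≈0 {s} {a} {a′} a′≈sa = trans (+-congʳ a′≈sa) (solve 2 (λ s a → s :* a :+ (:- s) :* a := :0) refl s a)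

    -- Hyperbolicity is applied to 1_X, which is `tilt 0#`.
    log-concave : ∀ {α r} → Hyperbolic α r → L α (suc (suc r)) * L α r ≤ L α (suc r) * L α (suc r)
    log-concave {α} {r} hyp = ≤-resp
      (*-congʳ (trans (bilinear-tilt-tilt α r 0#)
        (solve 3 (λ a b d → (a :+ :0 :* b) :+ :0 :* (b :+ :0 :* d) := a) refl _ (L α (suc r)) (L α r))))
      (*-cong row₀ row₀) (hyp (tilt 0#))
      where
      row₀ : row α r (tilt 0#) ≈ L α (suc r)
      row₀ = trans (row-tilt α r 0#) (solve 2 (λ a b → a :+ :0 :* b := a) refl _ (L α r))

    -- Equality in the log-concavity puts the vector 1_X - s 1_null in the kernel of A α r.
    geometric : ∀ {s α r} → Commutes α → Hyperbolic α r → 0# < L α r →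
      L α (suc r) ≈ s * L α r → L α (suc (suc r)) ≈ s * L α (suc r) → Geometric s α r
    geometric {s} {α} {r} comm hyp 0<L e₁ e₂ z = x-y≈0⇒x≈y (trans
        (solve 3 (λ a s b → a :- s :* b := a :+ (:- s) :* b) refl _ s _)
        (trans (sym (A▹tilt α r (- s) z)) (square≈0⇒≈0
          (∑≈0⇒term≈0 {f = λ z → Aw z * Aw z} (λ z → square-nonneg (Aw z)) kernel (∈-points z)))))
      where
      w = tilt (- s)
      Aw = (points ▹ A α r) w
      F = matrixForm points (A α r) (A-sym comm r)
      -- Tested against its own image `Aw`, the radical vector `w` gives the sum of the squares of
      -- the entries of `Aw`; hence every entry is zero.
      kernel : B α r Aw w ≈ 0#
      kernel = trans (symmetric F Aw w) (isotropic⇒radical F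
        (<-resp refl (sym (B-null-null α r)) 0<L) (hyperbolicAt-null comm hyp)
        (trans (B-null comm r w) (trans (row-tilt α r (- s)) (neg-tilt≈0 e₁)))
        (trans (bilinear-tilt-tilt α r (- s)) (trans
          (+-cong (neg-tilt≈0 e₂) (trans (*-congˡ (neg-tilt≈0 e₁)) (zeroʳ _))) (+-identityˡ 0#)))
        Aw)

    ∑-words-cong : ∀ r {f g : Word n → Carrier} → (∀ β → length β ≡ r → f β ≈ g β) → ∑ (words n r) f ≈ ∑ (words n r) g
    ∑-words-cong zero    f≈g = +-congʳ (f≈g [] ≡.refl)
    ∑-words-cong (suc r) {f} {g} f≈g = trans (∑-words r f) (trans
      (∑-cong X (λ x → ∑-words-cong r (λ β |β|≡r → f≈g (x ∷ β) (≡.cong suc |β|≡r))))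
      (sym (∑-words r g)))

    -- Induction on the level, and descent of equality to longer words.

    module Assembly (interval : IsInterval G) {m : ℕ} (rank : IsRank G m) {k : ℕ} (k<m : k ℕ.< m) (adm : Admissible ℝ G Q k) where

      open Admissible adm

      commutes : ∀ {α} → Lang α → length α ℕ.< k → Commutes α
      commutes {α} α∈L |α|<k = contInv⇒commutes scaleSequence (contInv α α∈L |α|<k)

      length-child : ∀ α z r → length (child α z) ℕ.+ r ℕ.≤ length α ℕ.+ suc r
      length-child α nothing  r = ℕ.+-monoʳ-≤ (length α) (ℕ.n≤1+n r)
      length-child α (just x) r = ℕ.≤-reflexive (≡.trans (≡.cong (ℕ._+ r) (length-∷ʳ α x)) (≡.sym (ℕ.+-suc (length α) r)))

      L-pos′ : ∀ {α} r → Lang α → length α ℕ.+ r ℕ.≤ suc k → 0# < L α r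
      L-pos′ r α∈L |α|+r≤1+k = L-pos rank r α∈L (ℕ.≤-trans |α|+r≤1+k k<m)

      hyperbolic : ∀ r {α} → Lang α → length α ℕ.+ r ℕ.< k → Hyperbolic α r
      hyperbolic zero {α} α∈L |α|+0<k v = Base.hyperbolic-zero scaleSequence α∈L (commutes α∈L |α|<k)
          (logMod α α∈L |α|<k) (fewDes α α∈L |α|<k) (synMon α α∈L |α|<k) (scaleMon α α∈L |α|<k) v
        where
        |α|<k = ℕ.≤-trans (ℕ.s≤s (ℕ.m≤m+n (length α) 0)) |α|+0<k
      hyperbolic (suc r) {α} α∈L |α|+1+r<k = Step.hyperbolic-suc α∈L pull
          (λ z z∈L → commutes z∈L (ℕ.≤-trans (ℕ.s≤s (ℕ.m≤m+n _ r)) (bound z)))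
          (λ z z∈L → hyperbolic r z∈L (bound z))
          (λ z z∈L → L-pos′ r z∈L (ℕ.≤-trans (ℕ.<⇒≤ (bound z)) (ℕ.n≤1+n k)))
        where
        bound : ∀ z → length (child α z) ℕ.+ r ℕ.< k
        bound z = ℕ.≤-trans (ℕ.s≤s (length-child α z r)) |α|+1+r<k
        |α|<k : length α ℕ.< k
        |α|<k = ℕ.≤-trans (ℕ.s≤s (ℕ.m≤m+n (length α) r)) (bound nothing)
        pull : Pull α r
        pull = PullProof.pull interval (commutes α∈L |α|<k)
          (λ x αx∈L → commutes αx∈L (ℕ.≤-trans (ℕ.s≤s (ℕ.m≤m+n _ r)) (bound (just x))))
          (λ z αx∈L αy∈L → swap-prefix scaleSequence (contInv α α∈L |α|<k) αx∈L αy∈L (z ∷ []) r)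
          scaleSequence (paMon α α∈L |α|<k)

      -- Log-concavity at αx, where the later ratio is `s`, makes the earlier ratio at least `s`. So
      -- every `D x` is nonnegative, while their sum is zero by the relation at the null point;
      -- hence each of them vanishes, and the ratio is `s` at both levels.
      geometric-child : ∀ {s α r x} → Lang (α ∷ʳ x) → length α ℕ.+ suc r ℕ.< k → Geometric s α (suc r) → Geometric s (α ∷ʳ x) r
      geometric-child {s} {α} {r} {x} αx∈L |α|+1+r<k geo = geometric
          (commutes αx∈L (ℕ.≤-trans (ℕ.s≤s (ℕ.m≤m+n _ r)) (bound x)))
          (hyperbolic r αx∈L (bound x))
          (L-pos′ r αx∈L (ℕ.≤-trans (ℕ.<⇒≤ (bound x)) (ℕ.n≤1+n k)))
          (x-y≈0⇒x≈y (∑≈0⇒term≈0 0≤D ∑D≈0 (∈-allFin x)))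
          (geo (just x))
        where
        bound : ∀ x → length (α ∷ʳ x) ℕ.+ r ℕ.< k
        bound x = ℕ.≤-trans (ℕ.s≤s (length-child α (just x) r)) |α|+1+r<k
        D : Fin n → Carrier
        D x = L (α ∷ʳ x) (suc r) - s * L (α ∷ʳ x) r
        ∑D≈0 : ∑ X D ≈ 0#
        ∑D≈0 = trans (∑-minus X _ _) (x≈y⇒x-y≈0 (trans (geo nothing) (sym (∑-*ˡ X s _))))
        0≤D : ∀ x → 0# ≤ D x
        0≤D x with Lang? (α ∷ʳ x)
        ... | no αx∉L = ≤-reflexive (sym (x≈y⇒x-y≈0 (trans (L-outside (suc r) αx∉L)
          (sym (trans (*-congˡ (L-outside r αx∉L)) (zeroʳ s))))))
        ... | yes αx∈L = 0≤y-x (*-cancelˡ-≤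
          (L-pos′ (suc r) αx∈L (≡.subst (ℕ._≤ suc k) (≡.sym (ℕ.+-suc _ r)) (ℕ.≤-trans (bound x) (ℕ.n≤1+n k))))
          (≤-resp (trans (*-congʳ (geo (just x))) (solve 3 (λ s a b → s :* a :* b := a :* (s :* b)) refl s _ _)) refl
            (log-concave (hyperbolic r αx∈L (bound x)))))

      geometric-descend : ∀ {s} r β α → Lang (α ++ β) → length α ℕ.+ (length β ℕ.+ r) ℕ.< k →
        Geometric s α (length β ℕ.+ r) → Geometric s (α ++ β) r
      geometric-descend {s} r []      α _    _   geo = ≡.subst (λ w → Geometric s w r) (≡.sym (++-identityʳ α)) geo
      geometric-descend {s} r (x ∷ β) α αxβ∈L <k geo = ≡.subst (λ w → Geometric s w r) (++-assoc α (x ∷ []) β)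
        (geometric-descend r β (α ∷ʳ x) αxβ∈L′ (ℕ.≤-trans (ℕ.s≤s (length-child α (just x) (length β ℕ.+ r))) <k)
          (geometric-child (hereditary (α ∷ʳ x) β αxβ∈L′) <k geo))
        where
        αxβ∈L′ : Lang ((α ∷ʳ x) ++ β)
        αxβ∈L′ = ≡.subst Lang (≡.sym (++-assoc α (x ∷ []) β)) αxβ∈L

    GeometricAt : ℕ → Set (c ⊔ ℓ₁ ⊔ ℓ₂)
    GeometricAt k = ∃[ s ] 0# < s × (∀ α → Lang α → length α ≡ k →
      Lqα ℝ G Q α 2 ≈ s * Lqα ℝ G Q α 1 × s * Lqα ℝ G Q α 1 ≈ s * s * Lqα ℝ G Q α 0)

    -- Here `k` is one less than in the theorem: the descent starts from the empty word at level `k`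
    -- and ends at the words of length `k` at level 0.
    equality⇒geometric : IsInterval G → ∀ {m} → IsRank G m → ∀ {k} → suc k ℕ.< m → Admissible ℝ G Q (suc k) →
      L [] (suc k) * L [] (suc k) ≈ L [] k * L [] (suc (suc k)) → GeometricAt k
    equality⇒geometric interval rank {k} 1+k<m adm equality = s , 0<s , λ α α∈L |α|≡k →
      let geo : Geometric s α 0
          geo = geometric-descend 0 α [] α∈L
            (≡.subst (ℕ._< suc k) (≡.sym (≡.trans (ℕ.+-identityʳ _) |α|≡k)) ℕ.≤-refl)
            (≡.subst (Geometric s []) (≡.sym (≡.trans (ℕ.+-identityʳ _) |α|≡k)) geometric-[])
          L₁≈ : L α 1 ≈ s * L α 0
          L₁≈ = geo nothing
          L₂≈ : L α 2 ≈ s * L α 1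
          L₂≈ = trans (∑-cong X (λ x → geo (just x))) (∑-*ˡ X s _)
      in trans (Lqα≈L α 2) (trans L₂≈ (*-congˡ (sym (Lqα≈L α 1))))
       , trans (*-congˡ (trans (Lqα≈L α 1) (trans L₁≈ (*-congˡ (sym (Lqα≈L α 0)))))) (sym (*-assoc s s _))
      where
      open Assembly interval rank 1+k<m adm
      0<Lₖ : 0# < L [] k
      0<Lₖ = L-pos′ k empty (ℕ.≤-trans (ℕ.n≤1+n k) (ℕ.n≤1+n (suc k)))
      0<Lₖ₊₁ : 0# < L [] (suc k)
      0<Lₖ₊₁ = L-pos′ (suc k) empty (ℕ.n≤1+n (suc k))
      -- The ratio of consecutive sums at the empty word; the equality says that the next ratio is
      -- the same.
      s = L [] (suc k) * recip (L [] k) 0<Lₖ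
      0<s : 0# < s
      0<s = *-pos 0<Lₖ₊₁ (recip-pos _ 0<Lₖ)
      Lₖ₊₁≈ : L [] (suc k) ≈ s * L [] k
      Lₖ₊₁≈ = sym (trans (solve 3 (λ a i b → a :* i :* b := a :* (b :* i)) refl _ _ _)
        (trans (*-congˡ (recip-inverse _ 0<Lₖ)) (*-identityʳ _)))
      Lₖ₊₂≈ : L [] (suc (suc k)) ≈ s * L [] (suc k)
      Lₖ₊₂≈ = *-cancelˡ-≈ 0<Lₖ (trans (sym equality) (trans (*-congʳ Lₖ₊₁≈)
        (solve 3 (λ s a b → s :* a :* b := a :* (s :* b)) refl s _ _)))
      geometric-[] : Geometric s [] k
      geometric-[] = geometric (commutes empty (ℕ.s≤s ℕ.z≤n)) (hyperbolic k empty ℕ.≤-refl) 0<Lₖ Lₖ₊₁≈ Lₖ₊₂≈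

    -- A word is split after its first `k` letters, and the relations at these prefixes are summed.
    -- As `s` does not depend on the prefix, both consecutive ratios at the empty word are `s`.
    geometric⇒equality : ∀ k → GeometricAt k → L [] (suc k) * L [] (suc k) ≈ L [] k * L [] (suc (suc k))
    geometric⇒equality k (s , 0<s , geo) = begin
      L [] (suc k) * L [] (suc k)       ≈⟨ *-congʳ Lₖ₊₁≈ ⟩
      s * L [] k * L [] (suc k)         ≈⟨ solve 3 (λ s a b → s :* a :* b := a :* (s :* b)) refl s _ _ ⟩
      L [] k * (s * L [] (suc k))       ≈⟨ *-congˡ Lₖ₊₂≈ ⟨
      L [] k * L [] (suc (suc k))       ∎
      where
      decompose : ∀ j → L [] (j ℕ.+ k) ≈ ∑ (words n k) (λ β → L β j)
      decompose j = trans (reflexive (≡.cong (L []) (ℕ.+-comm j k))) (L-+ [] k j)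
      scale-sum : ∀ i j → (∀ β → Lang β → length β ≡ k → Lqα ℝ G Q β i ≈ s * Lqα ℝ G Q β j) →
        L [] (i ℕ.+ k) ≈ s * L [] (j ℕ.+ k)
      scale-sum i j h = trans (decompose i) (trans (∑-words-cong k term)
        (trans (∑-*ˡ (words n k) s _) (*-congˡ (sym (decompose j)))))
        where
        term : ∀ β → length β ≡ k → L β i ≈ s * L β j
        term β |β|≡k with Lang? β
        ... | yes β∈L = trans (sym (Lqα≈L β i)) (trans (h β β∈L |β|≡k) (*-congˡ (Lqα≈L β j)))
        ... | no  β∉L = trans (L-outside i β∉L) (sym (trans (*-congˡ (L-outside j β∉L)) (zeroʳ s)))
      Lₖ₊₁≈ : L [] (suc k) ≈ s * L [] k
      Lₖ₊₁≈ = scale-sum 1 0 (λ β β∈L |β|≡k → *-cancelˡ-≈ 0<s (trans (proj₂ (geo β β∈L |β|≡k)) (*-assoc s s _)))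
      Lₖ₊₂≈ : L [] (suc (suc k)) ≈ s * L [] (suc k)
      Lₖ₊₂≈ = scale-sum 2 1 (λ β β∈L |β|≡k → proj₁ (geo β β∈L |β|≡k))

theorem1p33 : ∀ {c ℓ₁ ℓ₂ : Level} (ℝ : Reals c ℓ₁ ℓ₂)
    (n : ℕ) (G : Greedoid n) → IsInterval G →
    (m : ℕ) → IsRank G m →
    (k : ℕ) → 1 ℕ.≤ k → k ℕ.< m →
    (Q : WeightFunction ℝ G) → Admissible ℝ G Q k →
    let open Reals ℝ in
    (Lq ℝ G Q k * Lq ℝ G Q k ≈ Lq ℝ G Q (k ∸ 1) * Lq ℝ G Q (k ℕ.+ 1))
    ⇔
    (∃[ s ] 0# < s × (∀ α → Greedoid.Lang G α → length α ≡ k ∸ 1 →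
    Lqα ℝ G Q α 2 ≈ s * Lqα ℝ G Q α 1 ×
    s * Lqα ℝ G Q α 1 ≈ s * s * Lqα ℝ G Q α 0))
theorem1p33 ℝ n G interval m rank (suc k) _ 1+k<m Q adm = mk⇔
    (λ equality → equality⇒geometric ℝ G Q interval rank 1+k<m adm
      (trans (sym L²≈) (trans equality LL≈)))
    (λ geometric → trans L²≈ (trans (geometric⇒equality ℝ G Q k geometric) (sym LL≈)))
  where
  open Reals ℝ
  L²≈ = *-cong (Lq≈L ℝ G Q (suc k)) (Lq≈L ℝ G Q (suc k))
  LL≈ = *-cong (Lq≈L ℝ G Q k) (trans (Lq≈L ℝ G Q (suc k ℕ.+ 1))
    (reflexive (≡.cong (L ℝ G Q []) (ℕ.+-comm (suc k) 1))))
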